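{- Let $n\geq 2$ and let $\mathcal{G}=\{G_1, G_2, \ldots , G_{2n-1}\}$ be a family of (not necessarily distinct) balanced bipartite graphs on the common vertex set $[2n]$ with the common bipartition $(X, Y)$. If $$\rho (G_i) \geq \rho(K_{n,n-1}\cup K_1)$$ for every $i\in [2n-1]$, then $\mathcal{G}$ admits a rainbow Hamilton path unless $G_1=G_2=\cdots =G_{2n-1}\cong K_{n,n-1}\cup K_1$.
   Context: All graphs are simple and undirected. $[k]=\{1,2,\ldots,k\}$. A bipartite graph with bipartition $(X,Y)$ is balanced if $|X|=|Y|$. $\rho(G)$ is the spectral radius of $G$, i.e. the maximum modulus of the eigenvalues of its adjacency matrix. $G\cup H$ denotes disjoint union, and $K_{s,t}$ the complete bipartite graph. $G_i=G_j$ means equality as graphs on the labelled vertex set (same edge set), while $\cong$ denotes isomorphism. For a family $\mathcal{G}=\{G_1,\ldots,G_k\}$ of not necessarily distinct graphs on the same vertex set $V$ and a graph $H$ with $k$ edges and $V(H)\subseteq V$, $H$ is a rainbow copy in $\mathcal{G}$ if there is a bijection $\phi:E(H)\to[k]$ with $e\in E(G_{\phi(e)})$ for all $e\in E(H)$. A rainbow Hamilton path in $\mathcal{G}$ is such an $H$ that is a path visiting every vertex of $V$ exactly once. -}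

module Defs where

open import Algebra.Bundles using (module AbelianGroup)
import Algebra.Properties.CommutativeSemigroup as CommutativeSemigroupₚ
import Algebra.Properties.Group as Groupₚ
open import Data.Bool using (Bool; true; false; if_then_else_)
open import Data.Fin using (Fin; toℕ; splitAt)
import Data.Fin as Fin
open import Data.Fin.Subset using (Subset; _∈_; _∪_; _∩_; ⊤; ⊥; ∣_∣)
open import Data.Nat using (ℕ; suc)
import Data.Nat as ℕ
import Data.Nat.Properties as ℕₚ
open import Data.Product using (Σ-syntax; _×_; _,_; proj₁; proj₂)
open import Data.Rational using (ℚ; 0ℚ; 1ℚ; ½; Positive; positive)
import Data.Rational as ℚ
import Data.Rational.Properties as ℚₚ
open import Data.Sum using (_⊎_; inj₁; inj₂)
import Data.Vec.Functional as VF
open import Function.Bundles using (_⤖_; _⇔_; module Bijection)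
open import Relation.Binary.PropositionalEquality
  using (_≡_; refl; sym; trans; cong; cong₂; subst)
open import Relation.Nullary using (¬_)

open CommutativeSemigroupₚ
  (AbelianGroup.commutativeSemigroup ℚₚ.+-0-abelianGroup) using (interchange)
open Groupₚ (AbelianGroup.group ℚₚ.+-0-abelianGroup) using (//-rightDividesˡ)

infix  4 _≈ℝ_ _≤ℝ_ _≈ℂ_ _≗ᴳ_ _≅_
infixl 6 _+ℝ_ _+ℂ_ _⊔ᴳ_
infixl 7 _*ℝ_ _*ℂ_
infix  8 -ℝ_

------------------------------------------------------------------------
-- Real numbers as Cauchy sequences of rationals (operations are pointwise,
-- equality is "the difference tends to 0")

IsCauchy : (ℕ → ℚ) → Set
IsCauchy x = ∀ (ε : ℚ) → 0ℚ ℚ.< ε →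
  Σ[ N ∈ ℕ ] (∀ m n → N ℕ.≤ m → N ℕ.≤ n → ℚ.∣ x m ℚ.- x n ∣ ℚ.< ε)

record ℝ : Set where
  constructor mkℝ
  field
    seq    : ℕ → ℚ
    cauchy : IsCauchy seq

open ℝ public

_≈ℝ_ : ℝ → ℝ → Set
x ≈ℝ y = ∀ (ε : ℚ) → 0ℚ ℚ.< ε →
  Σ[ N ∈ ℕ ] (∀ n → N ℕ.≤ n → ℚ.∣ seq x n ℚ.- seq y n ∣ ℚ.< ε)

_≤ℝ_ : ℝ → ℝ → Set
x ≤ℝ y = ∀ (ε : ℚ) → 0ℚ ℚ.< ε →
  Σ[ N ∈ ℕ ] (∀ n → N ℕ.≤ n → seq x n ℚ.≤ seq y n ℚ.+ ε)

const-cauchy : ∀ q → IsCauchy (λ _ → q)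
const-cauchy q ε 0<ε = 0 , λ _ _ _ _ →
  subst (ℚ._< ε) (sym (cong ℚ.∣_∣ (ℚₚ.+-inverseʳ q))) 0<ε

neg-cauchy : ∀ x → IsCauchy x → IsCauchy (λ n → ℚ.- x n)
neg-cauchy x cx ε 0<ε with cx ε 0<ε
... | N , h = N , λ m n N≤m N≤n → subst (ℚ._< ε) (eq m n) (h m n N≤m N≤n)
  where
  eq : ∀ m n → ℚ.∣ x m ℚ.- x n ∣ ≡ ℚ.∣ (ℚ.- x m) ℚ.- (ℚ.- x n) ∣
  eq m n = trans (sym (ℚₚ.∣-p∣≡∣p∣ (x m ℚ.- x n)))
                 (cong ℚ.∣_∣ (ℚₚ.neg-distrib-+ (x m) (ℚ.- x n)))

+-cauchy : ∀ x y → IsCauchy x → IsCauchy y → IsCauchy (λ n → x n ℚ.+ y n)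
+-cauchy x y cx cy ε 0<ε with cx (½ ℚ.* ε) 0<ε/2 | cy (½ ℚ.* ε) 0<ε/2
  where
  0<ε/2 : 0ℚ ℚ.< ½ ℚ.* ε
  0<ε/2 = ℚₚ.*-monoʳ-<-pos ½ 0<ε
... | M , hx | N , hy = M ℕ.⊔ N , bound
  where
  open ℚₚ.≤-Reasoning
  rearr : ∀ a b c d → (a ℚ.+ b) ℚ.- (c ℚ.+ d) ≡ (a ℚ.- c) ℚ.+ (b ℚ.- d)
  rearr a b c d = trans (cong (a ℚ.+ b ℚ.+_) (ℚₚ.neg-distrib-+ c d))
                        (interchange a b (ℚ.- c) (ℚ.- d))
  bound : ∀ m n → M ℕ.⊔ N ℕ.≤ m → M ℕ.⊔ N ℕ.≤ n →
          ℚ.∣ (x m ℚ.+ y m) ℚ.- (x n ℚ.+ y n) ∣ ℚ.< ε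
  bound m n p q = begin-strict
    ℚ.∣ (x m ℚ.+ y m) ℚ.- (x n ℚ.+ y n) ∣
      ≡⟨ cong ℚ.∣_∣ (rearr (x m) (y m) (x n) (y n)) ⟩
    ℚ.∣ (x m ℚ.- x n) ℚ.+ (y m ℚ.- y n) ∣
      ≤⟨ ℚₚ.∣p+q∣≤∣p∣+∣q∣ (x m ℚ.- x n) (y m ℚ.- y n) ⟩
    ℚ.∣ x m ℚ.- x n ∣ ℚ.+ ℚ.∣ y m ℚ.- y n ∣
      <⟨ ℚₚ.+-mono-< (hx m n (ℕₚ.m⊔n≤o⇒m≤o M N p) (ℕₚ.m⊔n≤o⇒m≤o M N q))
                     (hy m n (ℕₚ.m⊔n≤o⇒n≤o M N p) (ℕₚ.m⊔n≤o⇒n≤o M N q)) ⟩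
    ½ ℚ.* ε ℚ.+ ½ ℚ.* ε
      ≡⟨ sym (ℚₚ.*-distribʳ-+ ε ½ ½) ⟩
    1ℚ ℚ.* ε
      ≡⟨ ℚₚ.*-identityˡ ε ⟩
    ε ∎

cauchy⇒bounded : ∀ x → IsCauchy x →
  Σ[ B ∈ ℚ ] (0ℚ ℚ.< B) × (Σ[ N ∈ ℕ ] (∀ n → N ℕ.≤ n → ℚ.∣ x n ∣ ℚ.≤ B))
cauchy⇒bounded x cx with cx 1ℚ (ℚₚ.positive⁻¹ 1ℚ)
... | N , h = ℚ.∣ x N ∣ ℚ.+ 1ℚ
            , ℚₚ.+-mono-≤-< (ℚₚ.0≤∣p∣ (x N)) (ℚₚ.positive⁻¹ 1ℚ)
            , N , bound
  where
  open ℚₚ.≤-Reasoning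
  bound : ∀ n → N ℕ.≤ n → ℚ.∣ x n ∣ ℚ.≤ ℚ.∣ x N ∣ ℚ.+ 1ℚ
  bound n N≤n = begin
    ℚ.∣ x n ∣                        ≡⟨ cong ℚ.∣_∣ (sym (//-rightDividesˡ (x N) (x n))) ⟩
    ℚ.∣ (x n ℚ.- x N) ℚ.+ x N ∣      ≤⟨ ℚₚ.∣p+q∣≤∣p∣+∣q∣ (x n ℚ.- x N) (x N) ⟩
    ℚ.∣ x n ℚ.- x N ∣ ℚ.+ ℚ.∣ x N ∣  ≡⟨ ℚₚ.+-comm ℚ.∣ x n ℚ.- x N ∣ ℚ.∣ x N ∣ ⟩
    ℚ.∣ x N ∣ ℚ.+ ℚ.∣ x n ℚ.- x N ∣
      ≤⟨ ℚₚ.+-monoʳ-≤ ℚ.∣ x N ∣ (ℚₚ.<⇒≤ (h n N N≤n ℕₚ.≤-refl)) ⟩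
    ℚ.∣ x N ∣ ℚ.+ 1ℚ                 ∎

*-cauchy : ∀ x y → IsCauchy x → IsCauchy y → IsCauchy (λ n → x n ℚ.* y n)
*-cauchy x y cx cy ε 0<ε = M ℕ.⊔ N , bound
  where
  B C : ℚ
  B = proj₁ (cauchy⇒bounded x cx)
  C = proj₁ (cauchy⇒bounded y cy)
  0<B : 0ℚ ℚ.< B
  0<B = proj₁ (proj₂ (cauchy⇒bounded x cx))
  0<C : 0ℚ ℚ.< C
  0<C = proj₁ (proj₂ (cauchy⇒bounded y cy))
  M₁ N₁ : ℕ
  M₁ = proj₁ (proj₂ (proj₂ (cauchy⇒bounded x cx)))
  N₁ = proj₁ (proj₂ (proj₂ (cauchy⇒bounded y cy)))
  bx : ∀ n → M₁ ℕ.≤ n → ℚ.∣ x n ∣ ℚ.≤ B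
  bx = proj₂ (proj₂ (proj₂ (cauchy⇒bounded x cx)))
  by : ∀ n → N₁ ℕ.≤ n → ℚ.∣ y n ∣ ℚ.≤ C
  by = proj₂ (proj₂ (proj₂ (cauchy⇒bounded y cy)))
  D : ℚ
  D = B ℚ.+ C
  instance
    pos-B : Positive B
    pos-B = positive 0<B
    pos-C : Positive C
    pos-C = positive 0<C
    pos-D : Positive D
    pos-D = ℚₚ.pos+pos⇒pos B C
    nz-D : ℚ.NonZero D
    nz-D = ℚₚ.pos⇒nonZero D
    pos-1/D : Positive (ℚ.1/ D)
    pos-1/D = ℚₚ.1/pos⇒pos D
  δ : ℚ
  δ = ℚ.1/ D ℚ.* ε
  0<δ : 0ℚ ℚ.< δ
  0<δ = subst (ℚ._< δ) (ℚₚ.*-zeroʳ (ℚ.1/ D)) (ℚₚ.*-monoʳ-<-pos (ℚ.1/ D) 0<ε)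
  M₂ N₂ M N : ℕ
  M₂ = proj₁ (cx δ 0<δ)
  N₂ = proj₁ (cy δ 0<δ)
  M  = M₁ ℕ.⊔ M₂
  N  = N₁ ℕ.⊔ N₂
  open ℚₚ.≤-Reasoning
  distrib-- : ∀ a b c → a ℚ.* (b ℚ.- c) ≡ a ℚ.* b ℚ.- a ℚ.* c
  distrib-- a b c = trans (ℚₚ.*-distribˡ-+ a b (ℚ.- c))
                          (cong (a ℚ.* b ℚ.+_) (sym (ℚₚ.neg-distribʳ-* a c)))
  telescope : ∀ p q r → (p ℚ.- q) ℚ.+ (q ℚ.- r) ≡ p ℚ.- r
  telescope p q r = trans (sym (ℚₚ.+-assoc (p ℚ.- q) q (ℚ.- r)))
                          (cong (ℚ._- r) (//-rightDividesˡ q p))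
  rearr : ∀ a b c d → a ℚ.* b ℚ.- c ℚ.* d ≡ a ℚ.* (b ℚ.- d) ℚ.+ d ℚ.* (a ℚ.- c)
  rearr a b c d = sym (trans
    (cong₂ ℚ._+_ (distrib-- a b d)
      (trans (distrib-- d a c) (cong₂ ℚ._-_ (ℚₚ.*-comm d a) (ℚₚ.*-comm d c))))
    (telescope (a ℚ.* b) (a ℚ.* d) (c ℚ.* d)))
  prod< : ∀ E p q → .{{Positive E}} → ℚ.∣ p ∣ ℚ.≤ E → ℚ.∣ q ∣ ℚ.< δ →
          ℚ.∣ p ℚ.* q ∣ ℚ.< E ℚ.* δ
  prod< E p q p≤E q<δ = begin-strict
    ℚ.∣ p ℚ.* q ∣        ≡⟨ ℚₚ.∣p*q∣≡∣p∣*∣q∣ p q ⟩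
    ℚ.∣ p ∣ ℚ.* ℚ.∣ q ∣
      ≤⟨ ℚₚ.*-monoʳ-≤-nonNeg ℚ.∣ q ∣ {{ℚ.nonNegative (ℚₚ.0≤∣p∣ q)}} p≤E ⟩
    E ℚ.* ℚ.∣ q ∣        <⟨ ℚₚ.*-monoʳ-<-pos E q<δ ⟩
    E ℚ.* δ              ∎
  bound : ∀ m n → M ℕ.⊔ N ℕ.≤ m → M ℕ.⊔ N ℕ.≤ n →
          ℚ.∣ x m ℚ.* y m ℚ.- x n ℚ.* y n ∣ ℚ.< ε
  bound m n p q = begin-strict
    ℚ.∣ x m ℚ.* y m ℚ.- x n ℚ.* y n ∣
      ≡⟨ cong ℚ.∣_∣ (rearr (x m) (y m) (x n) (y n)) ⟩
    ℚ.∣ x m ℚ.* (y m ℚ.- y n) ℚ.+ y n ℚ.* (x m ℚ.- x n) ∣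
      ≤⟨ ℚₚ.∣p+q∣≤∣p∣+∣q∣ (x m ℚ.* (y m ℚ.- y n)) (y n ℚ.* (x m ℚ.- x n)) ⟩
    ℚ.∣ x m ℚ.* (y m ℚ.- y n) ∣ ℚ.+ ℚ.∣ y n ℚ.* (x m ℚ.- x n) ∣
      <⟨ ℚₚ.+-mono-<
           (prod< B (x m) (y m ℚ.- y n) (bx m (ℕₚ.m⊔n≤o⇒m≤o M₁ M₂ pM))
             (proj₂ (cy δ 0<δ) m n (ℕₚ.m⊔n≤o⇒n≤o N₁ N₂ pN) (ℕₚ.m⊔n≤o⇒n≤o N₁ N₂ qN)))
           (prod< C (y n) (x m ℚ.- x n) (by n (ℕₚ.m⊔n≤o⇒m≤o N₁ N₂ qN))
             (proj₂ (cx δ 0<δ) m n (ℕₚ.m⊔n≤o⇒n≤o M₁ M₂ pM) (ℕₚ.m⊔n≤o⇒n≤o M₁ M₂ qM))) ⟩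
    B ℚ.* δ ℚ.+ C ℚ.* δ      ≡⟨ sym (ℚₚ.*-distribʳ-+ δ B C) ⟩
    D ℚ.* δ                  ≡⟨ sym (ℚₚ.*-assoc D (ℚ.1/ D) ε) ⟩
    (D ℚ.* ℚ.1/ D) ℚ.* ε     ≡⟨ cong (ℚ._* ε) (ℚₚ.*-inverseʳ D) ⟩
    1ℚ ℚ.* ε                 ≡⟨ ℚₚ.*-identityˡ ε ⟩
    ε                        ∎
    where
    pM = ℕₚ.m⊔n≤o⇒m≤o M N p
    pN = ℕₚ.m⊔n≤o⇒n≤o M N p
    qM = ℕₚ.m⊔n≤o⇒m≤o M N q
    qN = ℕₚ.m⊔n≤o⇒n≤o M N q

0ℝ 1ℝ : ℝ
0ℝ = mkℝ (λ _ → 0ℚ) (const-cauchy 0ℚ)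
1ℝ = mkℝ (λ _ → 1ℚ) (const-cauchy 1ℚ)

_+ℝ_ _*ℝ_ : ℝ → ℝ → ℝ
x +ℝ y = mkℝ (λ n → seq x n ℚ.+ seq y n) (+-cauchy (seq x) (seq y) (cauchy x) (cauchy y))
x *ℝ y = mkℝ (λ n → seq x n ℚ.* seq y n) (*-cauchy (seq x) (seq y) (cauchy x) (cauchy y))

-ℝ_ : ℝ → ℝ
-ℝ x = mkℝ (λ n → ℚ.- seq x n) (neg-cauchy (seq x) (cauchy x))

------------------------------------------------------------------------
-- Complex numbers

record ℂ : Set where
  constructor _+i_
  field
    re im : ℝ

open ℂ public

_≈ℂ_ : ℂ → ℂ → Set
z ≈ℂ w = (re z ≈ℝ re w) × (im z ≈ℝ im w)

0ℂ 1ℂ : ℂ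
0ℂ = 0ℝ +i 0ℝ
1ℂ = 1ℝ +i 0ℝ

_+ℂ_ _*ℂ_ : ℂ → ℂ → ℂ
z +ℂ w = (re z +ℝ re w) +i (im z +ℝ im w)
z *ℂ w = (re z *ℝ re w +ℝ (-ℝ (im z *ℝ im w))) +i (re z *ℝ im w +ℝ im z *ℝ re w)

-- The relation |z| = r, i.e. r is the nonnegative square root of re² + im².
IsModulus : ℂ → ℝ → Set
IsModulus z r = (0ℝ ≤ℝ r) × (r *ℝ r ≈ℝ re z *ℝ re z +ℝ im z *ℝ im z)

------------------------------------------------------------------------
-- Eigenvalues and spectral radius of a complex square matrix

Matrix : ℕ → Set
Matrix m = Fin m → Fin m → ℂ

sumℂ : ∀ {m} → (Fin m → ℂ) → ℂ
sumℂ = VF.foldr _+ℂ_ 0ℂ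

_*ᵛ_ : ∀ {m} → Matrix m → (Fin m → ℂ) → (Fin m → ℂ)
(A *ᵛ x) v = sumℂ (λ w → A v w *ℂ x w)

IsEigenvalue : ∀ {m} → Matrix m → ℂ → Set
IsEigenvalue {m} A z =
  Σ[ x ∈ (Fin m → ℂ) ] (¬ (∀ v → x v ≈ℂ 0ℂ)) × (∀ v → (A *ᵛ x) v ≈ℂ z *ℂ x v)

IsEigenvalueModulus : ∀ {m} → Matrix m → ℝ → Set
IsEigenvalueModulus A r = Σ[ z ∈ ℂ ] IsEigenvalue A z × IsModulus z r

-- r is the maximum of the set of moduli of eigenvalues.
IsMaxEigenvalueModulus : ∀ {m} → Matrix m → ℝ → Set
IsMaxEigenvalueModulus A r =
  IsEigenvalueModulus A r × (∀ s → IsEigenvalueModulus A s → s ≤ℝ r)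

------------------------------------------------------------------------
-- Simple undirected graphs on the labelled vertex set Fin m

record Graph (m : ℕ) : Set where
  field
    adj       : Fin m → Fin m → Bool
    symmetric : ∀ u v → adj u v ≡ adj v u
    loopless  : ∀ v → adj v v ≡ false

open Graph public

Adj : ∀ {m} → Graph m → Fin m → Fin m → Set
Adj G u v = adj G u v ≡ true

adjacencyMatrix : ∀ {m} → Graph m → Matrix m
adjacencyMatrix G u v = if adj G u v then 1ℂ else 0ℂ

-- The relation ρ(G) = r.
IsSpectralRadius : ∀ {m} → Graph m → ℝ → Set
IsSpectralRadius G = IsMaxEigenvalueModulus (adjacencyMatrix G)

-- Equality as labelled graphs.
_≗ᴳ_ : ∀ {m} → Graph m → Graph m → Set
G ≗ᴳ H = ∀ u v → adj G u v ≡ adj H u v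

_≅_ : ∀ {m k} → Graph m → Graph k → Set
_≅_ {m} {k} G H =
  Σ[ f ∈ Fin m ⤖ Fin k ] (∀ u v → adj G u v ≡ adj H (Bijection.to f u) (Bijection.to f v))

-- The first s vertices form one side of K[ s , t ], the last t the other.
K[_,_] : ∀ s t → Graph (s ℕ.+ t)
K[ s , t ] = record
  { adj       = λ u v → side (splitAt s u) (splitAt s v)
  ; symmetric = λ u v → side-sym (splitAt s u) (splitAt s v)
  ; loopless  = λ v → side-irr (splitAt s v)
  }
  where
  side : Fin s ⊎ Fin t → Fin s ⊎ Fin t → Bool
  side (inj₁ _) (inj₁ _) = false
  side (inj₁ _) (inj₂ _) = true
  side (inj₂ _) (inj₁ _) = true
  side (inj₂ _) (inj₂ _) = false
  side-sym : ∀ a b → side a b ≡ side b a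
  side-sym (inj₁ _) (inj₁ _) = refl
  side-sym (inj₁ _) (inj₂ _) = refl
  side-sym (inj₂ _) (inj₁ _) = refl
  side-sym (inj₂ _) (inj₂ _) = refl
  side-irr : ∀ a → side a a ≡ false
  side-irr (inj₁ _) = refl
  side-irr (inj₂ _) = refl

K₁ : Graph 1
K₁ = record
  { adj       = λ _ _ → false
  ; symmetric = λ _ _ → refl
  ; loopless  = λ _ → refl
  }

-- Disjoint union.
_⊔ᴳ_ : ∀ {m k} → Graph m → Graph k → Graph (m ℕ.+ k)
_⊔ᴳ_ {m} {k} G H = record
  { adj       = λ u v → join (splitAt m u) (splitAt m v)
  ; symmetric = λ u v → join-sym (splitAt m u) (splitAt m v)
  ; loopless  = λ v → join-irr (splitAt m v)
  }
  where
  join : Fin m ⊎ Fin k → Fin m ⊎ Fin k → Bool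
  join (inj₁ u) (inj₁ v) = adj G u v
  join (inj₁ _) (inj₂ _) = false
  join (inj₂ _) (inj₁ _) = false
  join (inj₂ u) (inj₂ v) = adj H u v
  join-sym : ∀ a b → join a b ≡ join b a
  join-sym (inj₁ u) (inj₁ v) = symmetric G u v
  join-sym (inj₁ _) (inj₂ _) = refl
  join-sym (inj₂ _) (inj₁ _) = refl
  join-sym (inj₂ u) (inj₂ v) = symmetric H u v
  join-irr : ∀ a → join a a ≡ false
  join-irr (inj₁ u) = loopless G u
  join-irr (inj₂ v) = loopless H v

------------------------------------------------------------------------
-- Balanced bipartite graphs

IsBalancedBipartition : ∀ {m} → Subset m → Subset m → Set
IsBalancedBipartition X Y = (X ∪ Y ≡ ⊤) × (X ∩ Y ≡ ⊥) × (∣ X ∣ ≡ ∣ Y ∣)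

IsBipartiteWith : ∀ {m} → Subset m → Subset m → Graph m → Set
IsBipartiteWith X Y G =
  ∀ u v → Adj G u v → (u ∈ X × v ∈ Y) ⊎ (u ∈ Y × v ∈ X)

------------------------------------------------------------------------
-- Rainbow Hamilton paths

-- The edge set; each unordered pair is listed once, smaller endpoint first.
Edge : ∀ {m} → Graph m → Set
Edge {m} H = Σ[ u ∈ Fin m ] Σ[ v ∈ Fin m ] (u Fin.< v × Adj H u v)

-- The bijection φ forces H to have exactly k edges.
IsRainbowCopy : ∀ {m k} → Graph m → (Fin k → Graph m) → Set
IsRainbowCopy {k = k} H 𝒢 =
  Σ[ φ ∈ Edge H ⤖ Fin k ] (∀ (e@(u , v , _) : Edge H) → Adj (𝒢 (Bijection.to φ e)) u v)

-- p lists every vertex exactly once, and the edges of H are exactly the pairs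
-- of vertices that are consecutive in this list.
IsHamiltonPath : ∀ {m} → Graph m → Set
IsHamiltonPath {m} H =
  Σ[ p ∈ Fin m ⤖ Fin m ] (∀ i j →
    Adj H (Bijection.to p i) (Bijection.to p j)
      ⇔ (toℕ j ≡ suc (toℕ i) ⊎ toℕ i ≡ suc (toℕ j)))

HasRainbowHamiltonPath : ∀ {m k} → (Fin k → Graph m) → Set
HasRainbowHamiltonPath {m} 𝒢 = Σ[ H ∈ Graph m ] IsHamiltonPath H × IsRainbowCopy H 𝒢

-- Let M j be the set of pairs of X × Y that are not edges of G j.  Applying Cauchy–Schwarz to each
-- row of the adjacency matrix gives ρ² ≤ e(G) for bipartite G, with a definite gap if some
-- non-adjacent u ∈ X, v ∈ Y are both non-isolated.  As ρ(K_{n,n−1} ∪ K₁) = √(n(n−1)), each M j has at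
-- most n pairs, and if it has n pairs it consists of all the pairs at one vertex (a star).
--
-- With a further, complete bipartite graph as free colour, a rainbow Hamilton path becomes a rainbow
-- Hamilton cycle.  Call an edge of a coloured cycle bad if it is missing from the graph of its
-- colour, and take a bad edge e of colour i.  Exchanging e with every second edge of the cycle
-- (2-opt), or swapping their colours, makes progress unless that position yields a pair of M i of
-- its own.  Together with e and the free edge this gives n pairs of M i, so M i is a star at an end
-- of e.  Swapping the colour of e with any other colour j then forces M j to be the same star.

module Submission where

open import Defs

open import Algebra.Bundles using (module CommutativeRing)
import Algebra.Properties.Semiring.Mult as Multₚ
import Algebra.Properties.Semiring.Sum as Sumₚ
open import Axiom.UniquenessOfIdentityProofs using (module Decidable⇒UIP)
open import Data.Bool using (Bool; true; false; not; _∧_; if_then_else_)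
import Data.Bool.Properties as Boolₚ
open import Data.Empty using (⊥; ⊥-elim)
open import Data.Fin using (Fin; zero; suc; toℕ; inject₁; splitAt; join; _↑ˡ_; _↑ʳ_)
import Data.Fin as Fin
import Data.Fin.Properties as Finₚ
open import Data.Fin.Subset using (Subset; ∁)
import Data.Fin.Subset as Subset
import Data.Fin.Subset.Properties as Subsetₚ
import Data.Integer as ℤ
import Data.Integer.Properties as ℤₚ
open import Data.List using (List; []; _∷_; _++_; length; map; allFin)
import Data.List as List
open import Data.List.Membership.Propositional using (_∈_; _∉_)
import Data.List.Membership.Propositional.Properties as ∈ₚ
import Data.List.Properties as Listₚ
open import Data.List.Relation.Binary.Permutation.Propositional
  using (_↭_; ↭-refl; ↭-sym; ↭-trans; ↭-prep; ↭-swap; ↭-reflexive; ↭⇒↭ₛ)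
open import Data.List.Relation.Binary.Permutation.Propositional.Properties
  using (∈-resp-↭; shift; ↭-length; drop-∷; ++⁺ʳ) renaming (++-comm to ↭-++-comm; map⁺ to ↭-map⁺)
import Data.List.Relation.Binary.Permutation.Setoid.Properties as Permₛ
open import Data.List.Relation.Unary.All as All using (All; []; _∷_)
import Data.List.Relation.Unary.All.Properties as Allₚ
open import Data.List.Relation.Unary.AllPairs using ([]; _∷_)
open import Data.List.Relation.Unary.Any as Any using (here; there)
import Data.List.Relation.Unary.Any.Properties as Anyₚ
open import Data.List.Relation.Unary.Unique.Propositional using (Unique)
import Data.List.Relation.Unary.Unique.Propositional.Properties as Uniqueₚ
open import Data.Maybe using (Maybe; just; nothing)
import Data.Maybe.Properties as Maybeₚ
open import Data.Nat using (ℕ; zero; suc)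
import Data.Nat as ℕ
open import Data.Nat.Induction using (<-wellFounded)
import Data.Nat.Properties as ℕₚ
import Data.Nat.Solver as ℕSolver
open import Data.Product using (∃; _×_; _,_; proj₁; proj₂; Σ-syntax)
import Data.Product as Product
import Data.Rational as ℚ
import Data.Rational.Properties as ℚₚ
import Data.Rational.Solver as ℚSolver
import Data.Rational.Unnormalised as ℚᵘ
import Data.Rational.Unnormalised.Properties as ℚᵘₚ
open import Data.Sum using (_⊎_; inj₁; inj₂)
import Data.Sum as Sum
import Data.Vec as Vec
import Data.Vec.Properties as Vecₚ
open import Function using (_∘_; id)
open import Function.Bundles using (_↔_; mk↔ₛ′; mk⇔; module Inverse)
open import Function.Properties.Inverse using (↔⇒⤖; ↔-trans; ↔-sym)
open import Induction.WellFounded using (Acc; acc)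
open import Relation.Binary.Definitions using (tri<; tri≈; tri>)
open import Relation.Binary.PropositionalEquality
open import Relation.Nullary using (¬_; Dec; yes; no; does)
open import Relation.Nullary.Decidable using (dec-true; dec-false; _⊎-dec_; _→-dec_; does-⇔)

-- Real numbers are Cauchy sequences, so an eigenvector is available only through rational
-- approximants that satisfy its equation up to null sequences. Both spectral facts are therefore
-- proved as K |Ab|² + |b|² ≤ K N |b|² for every rational vector b, with N = n(n - 1) and an
-- explicit K. The definite gap |b|² absorbs the errors: for approximants of an eigenvector whose
-- eigenvalue has modulus ρ, with ρ² ≥ N in the limit, it forces the norms to tend to 0. For the
-- comparison graph, ρ₀ ≥ √N is derived from an explicit eigenvector, whose eigenvalue has to be
-- constructed as a Cauchy sequence.
--
-- The obstacle in the search is that swapping two colours may leave the number of bad edges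
-- unchanged. Progress is therefore measured lexicographically, by `cost` and then `blocked`: in
-- `charge-step`, a swap that does not lower the cost gives the inspected step a colour in which it
-- is not blocked.

module Spectral where

  open import Data.Rational using (ℚ; 0ℚ; 1ℚ; ½; _+_; _*_; -_; _-_; _≤_; _<_; ∣_∣; Positive; positive; nonNegative)
  open ℚSolver.+-*-Solver using (solve; _:+_; _:*_; _:-_; :-_; _:=_; con)
  open Sumₚ (CommutativeRing.semiring ℚₚ.+-*-commutativeRing)
    using (sum; sum-cong-≗; ∑-distrib-+; *-distribˡ-sum; *-distribʳ-sum; sum-replicate-zero)
  open Multₚ (CommutativeRing.semiring ℚₚ.+-*-commutativeRing)
    using (×-homo-+; ×1-homo-*) renaming (_×_ to _·_)

  -- Inequalities between finite rational sums

  ι : ℕ → ℚ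
  ι n = n · 1ℚ

  2ℚ : ℚ
  2ℚ = 1ℚ + 1ℚ

  χ : Bool → ℚ
  χ true  = 1ℚ
  χ false = 0ℚ

  ≤-by : ∀ {x y} t → 0ℚ ≤ t → y ≡ x + t → x ≤ y
  ≤-by {x} t 0≤t refl = subst (_≤ x + t) (ℚₚ.+-identityʳ x) (ℚₚ.+-monoʳ-≤ x 0≤t)

  ≤⇒0≤- : ∀ {x y} → x ≤ y → 0ℚ ≤ y - x
  ≤⇒0≤- {x} {y} x≤y = subst (_≤ y - x) (ℚₚ.+-inverseʳ x) (ℚₚ.+-monoˡ-≤ (- x) x≤y)

  0≤+ : ∀ {x y} → 0ℚ ≤ x → 0ℚ ≤ y → 0ℚ ≤ x + y
  0≤+ {x} {y} p q = subst (_≤ x + y) (ℚₚ.+-identityˡ 0ℚ) (ℚₚ.+-mono-≤ p q)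

  0≤* : ∀ {x y} → 0ℚ ≤ x → 0ℚ ≤ y → 0ℚ ≤ x * y
  0≤* {x} {y} p q = subst (_≤ x * y) (ℚₚ.*-zeroʳ x) (ℚₚ.*-monoˡ-≤-nonNeg x {{nonNegative p}} q)

  0≤sq : ∀ x → 0ℚ ≤ x * x
  0≤sq x with ℚₚ.≤-total 0ℚ x
  ... | inj₁ p = 0≤* p p
  ... | inj₂ p = subst (0ℚ ≤_) (solve 1 (λ a → (:- a) :* (:- a) := a :* a) refl x) (0≤* 0≤-x 0≤-x)
    where
    0≤-x : 0ℚ ≤ - x
    0≤-x = subst (_≤ - x) refl (ℚₚ.neg-antimono-≤ p)

  0≤1 : 0ℚ ≤ 1ℚ
  0≤1 = ℚₚ.nonNegative⁻¹ 1ℚ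

  0≤χ : ∀ b → 0ℚ ≤ χ b
  0≤χ true  = 0≤1
  0≤χ false = ℚₚ.≤-refl

  0≤ι : ∀ n → 0ℚ ≤ ι n
  0≤ι zero    = ℚₚ.≤-refl
  0≤ι (suc n) = 0≤+ 0≤1 (0≤ι n)

  1≤ι : ∀ n → 1ℚ ≤ ι (suc n)
  1≤ι n = ≤-by (ι n) (0≤ι n) refl

  ι-mono : ∀ {m n} → m ℕ.≤ n → ι m ≤ ι n
  ι-mono {n = n} ℕ.z≤n   = 0≤ι n
  ι-mono (ℕ.s≤s m≤n)     = ℚₚ.+-monoʳ-≤ 1ℚ (ι-mono m≤n)

  *-mono-≤ˡ : ∀ {x y} z → 0ℚ ≤ z → x ≤ y → z * x ≤ z * y
  *-mono-≤ˡ z p = ℚₚ.*-monoˡ-≤-nonNeg z {{nonNegative p}}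

  *-mono-≤ʳ : ∀ {x y} z → 0ℚ ≤ z → x ≤ y → x * z ≤ y * z
  *-mono-≤ʳ z p = ℚₚ.*-monoʳ-≤-nonNeg z {{nonNegative p}}

  sum-mono : ∀ {m} {f g : Fin m → ℚ} → (∀ i → f i ≤ g i) → sum f ≤ sum g
  sum-mono {zero}  p = ℚₚ.≤-refl
  sum-mono {suc m} p = ℚₚ.+-mono-≤ (p zero) (sum-mono (p ∘ suc))

  0≤sum : ∀ {m} {f : Fin m → ℚ} → (∀ i → 0ℚ ≤ f i) → 0ℚ ≤ sum f
  0≤sum {zero}  p = ℚₚ.≤-refl
  0≤sum {suc m} p = 0≤+ (p zero) (0≤sum (p ∘ suc))

  term≤sum : ∀ {m} {f : Fin m → ℚ} → (∀ i → 0ℚ ≤ f i) → ∀ i → f i ≤ sum f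
  term≤sum {f = f} p zero    = ≤-by _ (0≤sum (p ∘ suc)) refl
  term≤sum {f = f} p (suc i) = ℚₚ.≤-trans (term≤sum (p ∘ suc) i)
    (≤-by (f zero) (p zero) (ℚₚ.+-comm (f zero) (sum (f ∘ suc))))

  two-terms≤sum : ∀ {m} {f : Fin m → ℚ} → (∀ i → 0ℚ ≤ f i) → ∀ i j → i ≢ j → f i + f j ≤ sum f
  two-terms≤sum {f = f} p zero    zero    i≢j = ⊥-elim (i≢j refl)
  two-terms≤sum {f = f} p zero    (suc j) i≢j = ℚₚ.+-monoʳ-≤ (f zero) (term≤sum (p ∘ suc) j)
  two-terms≤sum {f = f} p (suc i) zero    i≢j =
    subst (_≤ sum f) (ℚₚ.+-comm (f zero) (f (suc i))) (ℚₚ.+-monoʳ-≤ (f zero) (term≤sum (p ∘ suc) i))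
  two-terms≤sum {f = f} p (suc i) (suc j) i≢j =
    ℚₚ.≤-trans (two-terms≤sum (p ∘ suc) i j (i≢j ∘ cong suc))
      (≤-by (f zero) (p zero) (ℚₚ.+-comm (f zero) (sum (f ∘ suc))))

  sum-neg : ∀ {m} (f : Fin m → ℚ) → sum (λ i → - f i) ≡ - sum f
  sum-neg {zero}  f = refl
  sum-neg {suc m} f = trans (cong (- f zero +_) (sum-neg (f ∘ suc))) (sym (ℚₚ.neg-distrib-+ (f zero) (sum (f ∘ suc))))

  sum-minus : ∀ {m} (f g : Fin m → ℚ) → sum (λ i → f i - g i) ≡ sum f - sum g
  sum-minus f g = trans (∑-distrib-+ f (λ i → - g i)) (cong (sum f +_) (sum-neg g))

  -- Cauchy-Schwarz for a row of zeros and ones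

  module Weighted {m : ℕ} (a : Fin m → Bool) where

    degree : ℚ
    degree = sum (χ ∘ a)

    -- For a row a = A u of an adjacency matrix, `linear` is the entry of A b at u, and `square` is
    -- the squared norm of b restricted to the neighbours of u.
    linear square : (Fin m → ℚ) → ℚ
    linear b = sum λ w → χ (a w) * b w
    square b = sum λ w → χ (a w) * (b w * b w)

    0≤degree : 0ℚ ≤ degree
    0≤degree = 0≤sum (0≤χ ∘ a)

    0≤square : ∀ b → 0ℚ ≤ square b
    0≤square b = 0≤sum λ w → 0≤* (0≤χ (a w)) (0≤sq (b w))

  open Weighted public

  -- Expand the sum of (b w - x)² over the w selected by a. With x the new entry, this is the cross
  -- term in the induction step of `cauchy-schwarz`.
  deviation : ∀ {m} (a : Fin m → Bool) (b : Fin m → ℚ) x →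
    2ℚ * (x * linear a b) ≤ square a b + degree a * (x * x)
  deviation {zero} a b x = ≤-by 0ℚ ℚₚ.≤-refl (solve 1 (λ x → con 0ℚ :+ con 0ℚ :* (x :* x) := con 2ℚ :* (x :* con 0ℚ) :+ con 0ℚ) refl x)
  deviation {suc m} a b x = ≤-by
    (χ (a zero) * ((b zero - x) * (b zero - x)) + (square a′ b′ + degree a′ * (x * x) - 2ℚ * (x * linear a′ b′)))
    (0≤+ (0≤* (0≤χ (a zero)) (0≤sq (b zero - x))) (≤⇒0≤- (deviation a′ b′ x)))
    (solve 6 (λ c b x Q d R →
      (c :* (b :* b) :+ Q) :+ (c :+ d) :* (x :* x) :=
      con 2ℚ :* (x :* (c :* b :+ R)) :+ (c :* ((b :- x) :* (b :- x)) :+ (Q :+ d :* (x :* x) :- con 2ℚ :* (x :* R))))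
      refl (χ (a zero)) (b zero) x (square a′ b′) (degree a′) (linear a′ b′))
    where
    a′ = a ∘ suc
    b′ = b ∘ suc

  cauchy-schwarz : ∀ {m} (a : Fin m → Bool) (b : Fin m → ℚ) →
    linear a b * linear a b ≤ degree a * square a b
  cauchy-schwarz {zero} a b = ℚₚ.≤-refl
  cauchy-schwarz {suc m} a b with a zero
  ... | false = subst₂ _≤_
    (solve 2 (λ b R → R :* R := (con 0ℚ :* b :+ R) :* (con 0ℚ :* b :+ R)) refl (b zero) (linear a′ b′))
    (solve 3 (λ b d Q → d :* Q := (con 0ℚ :+ d) :* (con 0ℚ :* (b :* b) :+ Q)) refl (b zero) (degree a′) (square a′ b′))
    (cauchy-schwarz a′ b′)
    where
    a′ = a ∘ suc
    b′ = b ∘ suc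
  ... | true = ≤-by
    ((square a′ b′ + degree a′ * (x * x) - 2ℚ * (x * linear a′ b′)) + (degree a′ * square a′ b′ - linear a′ b′ * linear a′ b′))
    (0≤+ (≤⇒0≤- (deviation a′ b′ x)) (≤⇒0≤- (cauchy-schwarz a′ b′)))
    (solve 4 (λ x Q d R →
      (con 1ℚ :+ d) :* (con 1ℚ :* (x :* x) :+ Q) :=
      (con 1ℚ :* x :+ R) :* (con 1ℚ :* x :+ R) :+ ((Q :+ d :* (x :* x) :- con 2ℚ :* (x :* R)) :+ (d :* Q :- R :* R)))
      refl x (square a′ b′) (degree a′) (linear a′ b′))
    where
    a′ = a ∘ suc
    b′ = b ∘ suc
    x = b zero

  χ-mono : ∀ {a b} → (a ≡ true → b ≡ true) → χ a ≤ χ b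
  χ-mono {true}  p rewrite p refl = ℚₚ.≤-refl
  χ-mono {false} {b} p = 0≤χ b

  square-mono : ∀ {m} {a s : Fin m → Bool} (b : Fin m → ℚ) → (∀ w → a w ≡ true → s w ≡ true) →
    square a b ≤ square s b
  square-mono b a⊆s = sum-mono λ w → *-mono-≤ʳ (b w * b w) (0≤sq (b w)) (χ-mono (a⊆s w))

  square-gap : ∀ {m} {a s : Fin m → Bool} (b : Fin m → ℚ) → (∀ w → a w ≡ true → s w ≡ true) →
    ∀ i → a i ≡ false → s i ≡ true → square a b + b i * b i ≤ square s b
  square-gap {a = a} {s} b a⊆s i ai si = subst (square a b + b i * b i ≤_) eq
    (ℚₚ.+-monoʳ-≤ (square a b) (subst (_≤ sum gap) gap-i (term≤sum 0≤gap i)))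
    where
    gap : _ → ℚ
    gap w = χ (s w) * (b w * b w) - χ (a w) * (b w * b w)
    0≤gap : ∀ w → 0ℚ ≤ gap w
    0≤gap w = ≤⇒0≤- (*-mono-≤ʳ (b w * b w) (0≤sq (b w)) (χ-mono (a⊆s w)))
    gap-i : gap i ≡ b i * b i
    gap-i rewrite ai | si = solve 1 (λ x → con 1ℚ :* (x :* x) :- con 0ℚ :* (x :* x) := x :* x) refl (b i)
    eq : square a b + sum gap ≡ square s b
    eq = trans (cong (square a b +_) (sum-minus (λ w → χ (s w) * (b w * b w)) (λ w → χ (a w) * (b w * b w))))
      (solve 2 (λ x y → x :+ (y :- x) := y) refl (square a b) (square s b))

  without : ∀ {m} → (Fin m → Bool) → Fin m → Fin m → Bool
  without a zero    zero    = false
  without a zero    (suc j) = a (suc j)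
  without a (suc i) zero    = a zero
  without a (suc i) (suc j) = without (a ∘ suc) i j

  without-⊆ : ∀ {m} (a : Fin m → Bool) i j → without a i j ≡ true → a j ≡ true
  without-⊆ a zero    (suc j) e = e
  without-⊆ a (suc i) zero    e = e
  without-⊆ a (suc i) (suc j) e = without-⊆ (a ∘ suc) i j e

  sum-without : ∀ {m} (a : Fin m → Bool) (f : Fin m → ℚ) i → a i ≡ true →
    sum (λ w → χ (a w) * f w) ≡ f i + sum (λ w → χ (without a i w) * f w)
  sum-without a f zero    e rewrite e =
    solve 2 (λ x r → con 1ℚ :* x :+ r := x :+ (con 0ℚ :* x :+ r)) refl (f zero) (sum (λ w → χ (a (suc w)) * f (suc w)))
  sum-without a f (suc i) e = trans (cong (χ (a zero) * f zero +_) (sum-without (a ∘ suc) (f ∘ suc) i e))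
    (solve 3 (λ x y z → x :+ (y :+ z) := y :+ (x :+ z)) refl (χ (a zero) * f zero) (f (suc i)) (sum (λ w → χ (without (a ∘ suc) i w) * f (suc w))))

  degree-as-sum : ∀ {m} (a : Fin m → Bool) → degree a ≡ sum (λ w → χ (a w) * 1ℚ)
  degree-as-sum a = sum-cong-≗ λ w → sym (ℚₚ.*-identityʳ (χ (a w)))

  degree-without : ∀ {m} (a : Fin m → Bool) i → a i ≡ true → degree a ≡ 1ℚ + degree (without a i)
  degree-without a i e = trans (degree-as-sum a)
    (trans (sum-without a (λ _ → 1ℚ) i e) (cong (1ℚ +_) (sym (degree-as-sum (without a i)))))

  degree≤ : ∀ {m} (a : Fin m → Bool) → degree a ≤ ι m
  degree≤ {zero}  a = ℚₚ.≤-refl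
  degree≤ {suc m} a = ℚₚ.+-mono-≤ (χ≤1 (a zero)) (degree≤ (a ∘ suc))
    where
    χ≤1 : ∀ b → χ b ≤ 1ℚ
    χ≤1 true  = ℚₚ.≤-refl
    χ≤1 false = 0≤1

  -- Defined by cases on the first argument, so that `is true ∘ side` and `is false ∘ side` reduce
  -- to `side` and its negation; `by-side` relies on this.
  is : Bool → Bool → Bool
  is true  b = b
  is false b = not b

  is-refl : ∀ {σ b} → b ≡ σ → is σ b ≡ true
  is-refl {true}  e = e
  is-refl {false} refl = refl

  is-sound : ∀ σ b → is σ b ≡ true → b ≡ σ
  is-sound true  b e = e
  is-sound false false e = refl

  norm² : ∀ {m} → (Fin m → ℚ) → ℚ
  norm² b = sum λ v → b v * b v

  image² : ∀ {m} → (Fin m → Fin m → Bool) → (Fin m → ℚ) → ℚ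
  image² A b = sum λ u → linear (A u) b * linear (A u) b

  -- The bound ρ² ≤ e(G) for bipartite graphs, with a definite gap

  module Rows {m : ℕ} (side : Fin m → Bool) (adj : Fin m → Fin m → Bool)
    (opp : ∀ u w → adj u w ≡ true → side w ≡ not (side u)) where

    members : Bool → Fin m → Bool
    members σ = is σ ∘ side

    -- The number of edges, counted from the side σ.
    volume : Bool → ℚ
    volume σ = sum λ u → χ (members σ u) * degree (adj u)

    mass energy : Bool → (Fin m → ℚ) → ℚ
    mass σ b = square (members σ) b
    energy σ b = sum λ u → χ (members σ u) * (linear (adj u) b * linear (adj u) b)

    row⊆ : ∀ {σ} u → side u ≡ σ → ∀ w → adj u w ≡ true → members (not σ) w ≡ true
    row⊆ u refl w e = is-refl (opp u w e)

    -- The loss of the row u in the proof of ρ² ≤ e(G). The losses are nonnegative and add up to the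
    -- whole gap (`total-slack`), so a definite loss in one or two rows is a definite loss of the
    -- graph.
    slack : Bool → (Fin m → ℚ) → Fin m → ℚ
    slack σ b u = χ (members σ u) * (degree (adj u) * mass (not σ) b - linear (adj u) b * linear (adj u) b)

    row-bound : ∀ {σ} b u → side u ≡ σ →
      linear (adj u) b * linear (adj u) b ≤ degree (adj u) * mass (not σ) b
    row-bound b u e = ℚₚ.≤-trans (cauchy-schwarz (adj u) b)
      (*-mono-≤ˡ (degree (adj u)) (0≤degree (adj u)) (square-mono b (row⊆ u e)))

    0≤slack : ∀ σ b u → 0ℚ ≤ slack σ b u
    0≤slack σ b u with members σ u in eq
    ... | false = ℚₚ.≤-reflexive (sym (ℚₚ.*-zeroˡ (degree (adj u) * mass (not σ) b - linear (adj u) b * linear (adj u) b)))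
    ... | true  = 0≤* 0≤1 (≤⇒0≤- (row-bound b u (is-sound σ (side u) eq)))

    total-slack : ∀ σ b → sum (slack σ b) ≡ volume σ * mass (not σ) b - energy σ b
    total-slack σ b = trans
      (sum-cong-≗ λ u → solve 4 (λ c d s q → c :* (d :* s :- q) := (c :* d) :* s :- c :* q) refl
        (χ (members σ u)) (degree (adj u)) (mass (not σ) b) (linear (adj u) b * linear (adj u) b))
      (trans (sum-minus (λ u → (χ (members σ u) * degree (adj u)) * mass (not σ) b)
                        (λ u → χ (members σ u) * (linear (adj u) b * linear (adj u) b)))
        (cong (_- energy σ b) (sym (*-distribʳ-sum (mass (not σ) b) (λ u → χ (members σ u) * degree (adj u))))))

    energy≤ : ∀ σ b → energy σ b ≤ volume σ * mass (not σ) b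
    energy≤ σ b = ≤-by (sum (slack σ b)) (0≤sum (0≤slack σ b))
      (trans (solve 2 (λ x y → y := x :+ (y :- x)) refl (energy σ b) (volume σ * mass (not σ) b))
        (cong (energy σ b +_) (sym (total-slack σ b))))

    0≤mass : ∀ σ b → 0ℚ ≤ mass σ b
    0≤mass σ b = 0≤square (members σ) b

    slack-at : ∀ σ b u → side u ≡ σ →
      slack σ b u ≡ degree (adj u) * mass (not σ) b - linear (adj u) b * linear (adj u) b
    slack-at σ b u e rewrite is-refl {σ} e = ℚₚ.*-identityˡ _

    -- A row missing the column v₀ does not see the entry b v₀ ...
    slack-missing : ∀ σ b u v₀ w → side u ≡ σ → side v₀ ≡ not σ → adj u v₀ ≡ false → adj u w ≡ true →
      b v₀ * b v₀ ≤ slack σ b u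
    slack-missing σ b u v₀ w su sv e ew = subst (b v₀ * b v₀ ≤_) (sym (slack-at σ b u su)) (≤-by
      ((degree (adj u) - 1ℚ) * (b v₀ * b v₀) + degree (adj u) * (mass (not σ) b - (square (adj u) b + b v₀ * b v₀))
        + (degree (adj u) * square (adj u) b - linear (adj u) b * linear (adj u) b))
      (0≤+ (0≤+ (0≤* (≤⇒0≤- 1≤degree) (0≤sq (b v₀)))
                (0≤* (0≤degree (adj u)) (≤⇒0≤- (square-gap b (row⊆ u su) v₀ e (is-refl sv)))))
           (≤⇒0≤- (cauchy-schwarz (adj u) b)))
      (solve 5 (λ d s p q r → d :* s :- r :* r :=
          p :* p :+ ((d :- con 1ℚ) :* (p :* p) :+ d :* (s :- (q :+ p :* p)) :+ (d :* q :- r :* r)))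
        refl (degree (adj u)) (mass (not σ) b) (b v₀) (square (adj u) b) (linear (adj u) b)))
      where
      1≤degree : 1ℚ ≤ degree (adj u)
      1≤degree = ≤-by (degree (without (adj u) w)) (0≤degree (without (adj u) w)) (degree-without (adj u) w ew)

    -- Twice the number of vertices, hence at least 2d for every degree d. This keeps the term (κ -
    -- 2d) s in `slack-present` nonnegative.
    κ : ℚ
    κ = ι (m ℕ.+ m)

    -- ... while Cauchy–Schwarz in a row containing v₀ can be tight only if |b v₀| is comparable with the other entries.
    slack-present : ∀ σ b u v₀ → side u ≡ σ → adj u v₀ ≡ true → Positive κ →
      mass (not σ) b ≤ 2ℚ * slack σ b u + 2ℚ * ((1ℚ + κ) * (b v₀ * b v₀))
    slack-present σ b u v₀ su e pos = ℚₚ.*-cancelˡ-≤-pos κ {{pos}} (subst (λ z → κ * s ≤ κ * (2ℚ * z + 2ℚ * ((1ℚ + κ) * (p * p))))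
        (sym (trans (slack-at σ b u su) (cong₂ (λ x y → x * s - y * y) (degree-without (adj u) v₀ e) (sum-without (adj u) b v₀ e))))
      -- The square (κp - q)² is the weighted AM-GM inequality 2pq ≤ κp² + q²/κ with its denominator
      -- cleared; it separates the entry at v₀ from the rest of the row.
      (≤-by (2ℚ * ((κ * p - q) * (κ * p - q)) + 2ℚ * ((κ + 1ℚ) * (d * s - q * q)) + (κ - 2ℚ * d) * s)
        (0≤+ (0≤+ (0≤* 0≤2 (0≤sq (κ * p - q)))
                  (0≤* 0≤2 (0≤* (0≤+ (0≤ι (m ℕ.+ m)) 0≤1) (≤⇒0≤- q²≤))))
             (0≤* (≤⇒0≤- 2d≤κ) (0≤mass (not σ) b)))
        (solve 5 (λ k s p q d →
          k :* (con 2ℚ :* ((con 1ℚ :+ d) :* s :- (p :+ q) :* (p :+ q)) :+ con 2ℚ :* ((con 1ℚ :+ k) :* (p :* p))) :=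
          k :* s :+ (con 2ℚ :* ((k :* p :- q) :* (k :* p :- q)) :+ con 2ℚ :* ((k :+ con 1ℚ) :* (d :* s :- q :* q)) :+ (k :- con 2ℚ :* d) :* s))
          refl κ s p q d)))
      where
      a′ = without (adj u) v₀
      s = mass (not σ) b
      p = b v₀
      q = linear a′ b
      d = degree a′
      0≤2 : 0ℚ ≤ 2ℚ
      0≤2 = 0≤+ 0≤1 0≤1
      q²≤ : q * q ≤ d * s
      q²≤ = ℚₚ.≤-trans (cauchy-schwarz a′ b) (*-mono-≤ˡ d (0≤degree a′)
        (square-mono b λ w ew → row⊆ u su w (without-⊆ (adj u) v₀ w ew)))
      2d≤κ : 2ℚ * d ≤ κ
      2d≤κ = subst₂ _≤_ (solve 1 (λ x → x :+ x := con 2ℚ :* x) refl d) (sym (×-homo-+ 1ℚ m m))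
        (ℚₚ.+-mono-≤ (degree≤ a′) (degree≤ a′))

    -- The coefficient of `b v₀ * b v₀` in `slack-present`: Λ times the loss in a row that misses v₀
    -- pays for that term.
    Λ : ℚ
    Λ = 2ℚ * (1ℚ + κ)

    0≤Λ : 0ℚ ≤ Λ
    0≤Λ = 0≤* (0≤+ 0≤1 0≤1) (0≤+ 0≤1 (0≤ι (m ℕ.+ m)))

    -- If |b v₀| is large, the row u₀, which misses v₀, loses; if it is small, the row u₁, which
    -- contains v₀, loses. Adding Λ times the first estimate to the second cancels b v₀ and leaves a
    -- loss proportional to the mass.
    strict-energy : ∀ σ b u₀ v₀ w₀ u₁ → side u₀ ≡ σ → side u₁ ≡ σ → side v₀ ≡ not σ →
      adj u₀ v₀ ≡ false → adj u₀ w₀ ≡ true → adj u₁ v₀ ≡ true → Positive κ →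
      Λ * energy σ b + mass (not σ) b ≤ Λ * (volume σ * mass (not σ) b)
    strict-energy σ b u₀ v₀ w₀ u₁ s₀ s₁ sv e₀ ew e₁ pos = ≤-by
      (Λ * (sum (slack σ b) - (slack σ b u₀ + slack σ b u₁))
        + Λ * (slack σ b u₀ - b v₀ * b v₀)
        + 2ℚ * (κ * slack σ b u₁)
        + (2ℚ * slack σ b u₁ + Λ * (b v₀ * b v₀) - mass (not σ) b))
      (0≤+ (0≤+ (0≤+
        (0≤* 0≤Λ (≤⇒0≤- (two-terms≤sum (0≤slack σ b) u₀ u₁ u₀≢u₁)))
        (0≤* 0≤Λ (≤⇒0≤- (slack-missing σ b u₀ v₀ w₀ s₀ sv e₀ ew))))
        (0≤* (0≤+ 0≤1 0≤1) (0≤* (0≤ι (m ℕ.+ m)) (0≤slack σ b u₁))))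
        (≤⇒0≤- (subst (λ z → mass (not σ) b ≤ 2ℚ * slack σ b u₁ + z) (sym (ℚₚ.*-assoc 2ℚ (1ℚ + κ) (b v₀ * b v₀)))
          (slack-present σ b u₁ v₀ s₁ e₁ pos))))
      (trans (cong (Λ *_) (trans
          (solve 2 (λ x y → y := x :+ (y :- x)) refl (energy σ b) (volume σ * mass (not σ) b))
          (cong (energy σ b +_) (sym (total-slack σ b)))))
        (solve 7 (λ k e S a c p s →
          con 2ℚ :* (con 1ℚ :+ k) :* (e :+ S) :=
          (con 2ℚ :* (con 1ℚ :+ k) :* e :+ s) :+
          (con 2ℚ :* (con 1ℚ :+ k) :* (S :- (a :+ c)) :+ con 2ℚ :* (con 1ℚ :+ k) :* (a :- p)
            :+ con 2ℚ :* (k :* c) :+ (con 2ℚ :* c :+ con 2ℚ :* (con 1ℚ :+ k) :* p :- s)))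
          refl κ (energy σ b) (sum (slack σ b)) (slack σ b u₀) (slack σ b u₁) (b v₀ * b v₀) (mass (not σ) b)))
      where
      u₀≢u₁ : u₀ ≢ u₁
      u₀≢u₁ refl with () ← trans (sym e₀) e₁

    by-side : ∀ (f : Fin m → ℚ) →
      sum f ≡ sum (λ u → χ (members true u) * f u) + sum (λ u → χ (members false u) * f u)
    by-side f = trans (sum-cong-≗ split) (∑-distrib-+ (λ u → χ (members true u) * f u) (λ u → χ (members false u) * f u))
      where
      split : ∀ u → f u ≡ χ (side u) * f u + χ (not (side u)) * f u
      split u with side u
      ... | true  = solve 1 (λ x → x := con 1ℚ :* x :+ con 0ℚ :* x) refl (f u)
      ... | false = solve 1 (λ x → x := con 0ℚ :* x :+ con 1ℚ :* x) refl (f u)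

    -- Rows of one side only see entries of the other, so the estimates for the two sides add up,
    -- and their masses recombine to the full norm.
    norm-bound : ∀ c N → (∀ σ b → c * energy σ b + mass (not σ) b ≤ c * (N * mass (not σ) b)) →
      ∀ b → c * image² adj b + norm² b ≤ c * (N * norm² b)
    norm-bound c N h b = subst₂ _≤_
      (trans (solve 5 (λ c x y s t → (c :* x :+ t) :+ (c :* y :+ s) := c :* (x :+ y) :+ (s :+ t)) refl
          c (energy true b) (energy false b) (mass true b) (mass false b))
        (sym (cong₂ (λ x y → c * x + y) (by-side (λ u → linear (adj u) b * linear (adj u) b)) (by-side (λ v → b v * b v)))))
      (trans (solve 4 (λ c N s t → c :* (N :* t) :+ c :* (N :* s) := c :* (N :* (s :+ t))) refl c N (mass true b) (mass false b))
        (sym (cong (λ x → c * (N * x)) (by-side (λ v → b v * b v)))))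
      (ℚₚ.+-mono-≤ (h true b) (h false b))

    -- One edge fewer than N already yields a gap of a full unit of mass on each side, so here K =
    -- 1.
    small-volume : ∀ N → (∀ σ → volume σ + 1ℚ ≤ N) → ∀ b → 1ℚ * image² adj b + norm² b ≤ 1ℚ * (N * norm² b)
    small-volume N h = norm-bound 1ℚ N λ σ b → ≤-by
      ((volume σ * mass (not σ) b - energy σ b) + (N - (volume σ + 1ℚ)) * mass (not σ) b)
      (0≤+ (≤⇒0≤- (energy≤ σ b)) (0≤* (≤⇒0≤- (h σ)) (0≤mass (not σ) b)))
      (solve 4 (λ N s v e → con 1ℚ :* (N :* s) := (con 1ℚ :* e :+ s) :+ ((v :* s :- e) :+ (N :- (v :+ con 1ℚ)) :* s)) refl
        N (mass (not σ) b) (volume σ) (energy σ b))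

    -- The missing pair u₀, v₀ is both a row with a missing column and, read from the other side, a
    -- column with a missing row. The neighbours v₁ and u₁ of its ends supply the nonempty row and
    -- the row that contains the column, in either reading.
    unbalanced : ∀ N → (∀ σ → volume σ ≤ N) → (∀ u v → adj u v ≡ adj v u) → Positive κ →
      ∀ u₀ v₀ u₁ v₁ → side v₀ ≡ not (side u₀) → adj u₀ v₀ ≡ false → adj u₀ v₁ ≡ true → adj u₁ v₀ ≡ true →
      ∀ b → Λ * image² adj b + norm² b ≤ Λ * (N * norm² b)
    unbalanced N h adj-sym pos u₀ v₀ u₁ v₁ sv e e₁ e₂ = norm-bound Λ N bound
      where
      su₁ : side u₁ ≡ side u₀
      su₁ = trans (opp v₀ u₁ (trans (adj-sym v₀ u₁) e₂)) (trans (cong not sv) (Boolₚ.not-involutive (side u₀)))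
      relax : ∀ σ b → Λ * energy σ b + mass (not σ) b ≤ Λ * (volume σ * mass (not σ) b) →
        Λ * energy σ b + mass (not σ) b ≤ Λ * (N * mass (not σ) b)
      relax σ b p = ℚₚ.≤-trans p (*-mono-≤ˡ Λ 0≤Λ (*-mono-≤ʳ (mass (not σ) b) (0≤mass (not σ) b) (h σ)))
      bound : ∀ σ b → Λ * energy σ b + mass (not σ) b ≤ Λ * (N * mass (not σ) b)
      bound σ b with σ Boolₚ.≟ side u₀
      ... | yes refl = relax σ b (strict-energy σ b u₀ v₀ v₁ u₁ refl su₁ sv e e₁ e₂ pos)
      -- On the other side the roles are exchanged: v₀ is the deficient row, u₀ the missing column,
      -- and v₁ the row that contains u₀.
      ... | no σ≢ = relax σ b (strict-energy σ b v₀ u₀ u₁ v₁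
            (trans sv (sym (Boolₚ.¬-not σ≢)))
            (trans (opp u₀ v₁ e₁) (sym (Boolₚ.¬-not σ≢)))
            (trans (sym (Boolₚ.not-involutive (side u₀))) (cong not (sym (Boolₚ.¬-not σ≢))))
            (trans (adj-sym v₀ u₀) e) (trans (adj-sym v₀ u₁) e₂) (trans (adj-sym v₁ u₀) e₁) pos)

  -- Null sequences and bounded sequences

  Eventually : (ℕ → Set) → Set
  Eventually P = Σ[ N ∈ ℕ ] (∀ n → N ℕ.≤ n → P n)

  -- `x ≈ℝ y` unfolds to `Null` of the pointwise difference, so the eigenvalue equations are null
  -- sequences as they stand.
  Null : (ℕ → ℚ) → Set
  Null f = ∀ ε → 0ℚ < ε → Eventually λ n → ∣ f n ∣ < ε

  Bounded : (ℕ → ℚ) → Set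
  Bounded f = Σ[ B ∈ ℚ ] (0ℚ < B) × Eventually λ n → ∣ f n ∣ ≤ B

  both : ∀ {P Q : ℕ → Set} → Eventually P → Eventually Q → Eventually λ n → P n × Q n
  both (M , p) (N , q) = M ℕ.⊔ N , λ n le → p n (ℕₚ.m⊔n≤o⇒m≤o M N le) , q n (ℕₚ.m⊔n≤o⇒n≤o M N le)

  eventually-map : ∀ {P Q : ℕ → Set} → (∀ n → P n → Q n) → Eventually P → Eventually Q
  eventually-map f (N , p) = N , λ n le → f n (p n le)

  p≤∣p∣ : ∀ p → p ≤ ∣ p ∣
  p≤∣p∣ p with ℚₚ.≤-total 0ℚ p
  ... | inj₁ 0≤p = ℚₚ.≤-reflexive (sym (ℚₚ.0≤p⇒∣p∣≡p 0≤p))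
  ... | inj₂ p≤0 = ℚₚ.≤-trans p≤0 (ℚₚ.0≤∣p∣ p)

  0<½* : ∀ {ε} → 0ℚ < ε → 0ℚ < ½ * ε
  0<½* p = ℚₚ.*-monoʳ-<-pos ½ p

  ½+½ : ∀ ε → ½ * ε + ½ * ε ≡ ε
  ½+½ ε = trans (sym (ℚₚ.*-distribʳ-+ ε ½ ½)) (ℚₚ.*-identityˡ ε)

  null-≤ : ∀ {f g} → Null g → Eventually (λ n → ∣ f n ∣ ≤ ∣ g n ∣) → Null f
  null-≤ ng le ε 0<ε = eventually-map (λ n (p , q) → ℚₚ.≤-<-trans p q) (both le (ng ε 0<ε))

  null-cong : ∀ {f g} → (∀ n → f n ≡ g n) → Null f → Null g
  null-cong e nf ε 0<ε = eventually-map (λ n → subst (λ x → ∣ x ∣ < ε) (e n)) (nf ε 0<ε)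

  null-0 : Null (λ _ → 0ℚ)
  null-0 ε 0<ε = 0 , λ _ _ → 0<ε

  null-+ : ∀ {f g} → Null f → Null g → Null (λ n → f n + g n)
  null-+ {f} {g} nf ng ε 0<ε = eventually-map
    (λ n (p , q) → ℚₚ.≤-<-trans (ℚₚ.∣p+q∣≤∣p∣+∣q∣ (f n) (g n))
      (subst (∣ f n ∣ + ∣ g n ∣ <_) (½+½ ε) (ℚₚ.+-mono-< p q)))
    (both (nf (½ * ε) (0<½* 0<ε)) (ng (½ * ε) (0<½* 0<ε)))

  null-* : ∀ {f g} → Null f → Bounded g → Null (λ n → f n * g n)
  null-* {f} {g} nf (B , 0<B , bg) ε 0<ε = eventually-map
    (λ n (p , q) → subst₂ _<_ (sym (ℚₚ.∣p*q∣≡∣p∣*∣q∣ (f n) (g n))) δB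
      (ℚₚ.≤-<-trans (*-mono-≤ˡ ∣ f n ∣ (ℚₚ.0≤∣p∣ (f n)) q) (ℚₚ.*-monoˡ-<-pos B {{positive 0<B}} p)))
    (both (nf (ε * 1/B) 0<δ) bg)
    where
    instance
      pos-B : Positive B
      pos-B = positive 0<B
      nz-B : ℚ.NonZero B
      nz-B = ℚₚ.pos⇒nonZero B
      pos-1/B : Positive (ℚ.1/ B)
      pos-1/B = ℚₚ.1/pos⇒pos B
    1/B = ℚ.1/ B
    0<δ : 0ℚ < ε * 1/B
    0<δ = subst (_< ε * 1/B) (ℚₚ.*-zeroˡ 1/B) (ℚₚ.*-monoˡ-<-pos 1/B 0<ε)
    δB : (ε * 1/B) * B ≡ ε
    δB = trans (ℚₚ.*-assoc ε 1/B B) (trans (cong (ε *_) (ℚₚ.*-inverseˡ B)) (ℚₚ.*-identityʳ ε))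

  bounded-const : ∀ q → Bounded (λ _ → q)
  bounded-const q = ∣ q ∣ + 1ℚ , ℚₚ.+-mono-≤-< (ℚₚ.0≤∣p∣ q) (ℚₚ.positive⁻¹ 1ℚ) , 0 , λ _ _ → ≤-by 1ℚ 0≤1 refl

  bounded-ℝ : ∀ (x : ℝ) → Bounded (seq x)
  bounded-ℝ x = cauchy⇒bounded (seq x) (cauchy x)

  bounded-+ : ∀ {f g} → Bounded f → Bounded g → Bounded (λ n → f n + g n)
  bounded-+ {f} {g} (B , 0<B , bf) (C , 0<C , bg) = B + C , ℚₚ.+-mono-< 0<B 0<C ,
    eventually-map (λ n (p , q) → ℚₚ.≤-trans (ℚₚ.∣p+q∣≤∣p∣+∣q∣ (f n) (g n)) (ℚₚ.+-mono-≤ p q)) (both bf bg)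

  null⇒bounded : ∀ {f} → Null f → Bounded f
  null⇒bounded nf = 1ℚ , ℚₚ.positive⁻¹ 1ℚ , eventually-map (λ _ → ℚₚ.<⇒≤) (nf 1ℚ (ℚₚ.positive⁻¹ 1ℚ))

  null-scale : ∀ {f} c → Null f → Null (λ n → f n * c)
  null-scale c nf = null-* nf (bounded-const c)

  null-sum : ∀ {m} (f : Fin m → ℕ → ℚ) → (∀ i → Null (f i)) → Null (λ n → sum (λ i → f i n))
  null-sum {zero}  f nf = null-0
  null-sum {suc m} f nf = null-+ (nf zero) (null-sum (f ∘ suc) (nf ∘ suc))

  bounded-sum : ∀ {m} (f : Fin m → ℕ → ℚ) → (∀ i → Bounded (f i)) → Bounded (λ n → sum (λ i → f i n))
  bounded-sum {zero}  f bf = bounded-const 0ℚ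
  bounded-sum {suc m} f bf = bounded-+ (bf zero) (bounded-sum (f ∘ suc) (bf ∘ suc))

  null-dominated : ∀ {f g} → Null g → Eventually (λ n → 0ℚ ≤ f n × f n ≤ g n) → Null f
  null-dominated {f} {g} ng le = null-≤ ng (eventually-map
    (λ n (p , q) → ℚₚ.≤-trans (ℚₚ.≤-reflexive (ℚₚ.0≤p⇒∣p∣≡p p)) (ℚₚ.≤-trans q (p≤∣p∣ (g n)))) le)

  0<* : ∀ {x y} → 0ℚ < x → 0ℚ < y → 0ℚ < x * y
  0<* {x} {y} p q = subst (_< x * y) (ℚₚ.*-zeroʳ x) (ℚₚ.*-monoʳ-<-pos x {{positive p}} q)

  null-√ : ∀ {f} → Null (λ n → f n * f n) → Null f
  null-√ {f} nf ε 0<ε = eventually-map small (nf (ε * ε) (0<* 0<ε 0<ε))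
    where
    small : ∀ n → ∣ f n * f n ∣ < ε * ε → ∣ f n ∣ < ε
    small n p with ∣ f n ∣ ℚₚ.<? ε
    ... | yes q = q
    ... | no ¬q = ⊥-elim (ℚₚ.<-irrefl refl (ℚₚ.≤-<-trans
      (ℚₚ.≤-trans (*-mono-≤ˡ ε (ℚₚ.<⇒≤ 0<ε) ε≤) (*-mono-≤ʳ ∣ f n ∣ (ℚₚ.0≤∣p∣ (f n)) ε≤))
      (subst (_< ε * ε) (ℚₚ.∣p*q∣≡∣p∣*∣q∣ (f n) (f n)) p)))
      where
      ε≤ : ε ≤ ∣ f n ∣
      ε≤ = ℚₚ.≮⇒≥ ¬q

  null-square-difference : ∀ {x y} → x ≈ℝ y → Null (λ n → seq x n * seq x n - seq y n * seq y n)
  null-square-difference {x} {y} e = null-cong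
    (λ n → solve 2 (λ a b → (a :- b) :* (a :+ b) := a :* a :- b :* b) refl (seq x n) (seq y n))
    (null-* e (bounded-ℝ (x +ℝ y)))

  -- The positive part of the difference serves as q. It replaces the family of all ε by one error
  -- sequence, which can be added along a chain of inequalities and squared.
  ≤ℝ-excess : ∀ {x y} → x ≤ℝ y → Σ[ q ∈ (ℕ → ℚ) ] Null q × (∀ n → 0ℚ ≤ q n × seq x n ≤ seq y n + q n)
  ≤ℝ-excess {x} {y} x≤y = q , null , λ n → ℚₚ.p≤q⊔p (seq x n - seq y n) 0ℚ , bound n
    where
    q : ℕ → ℚ
    q n = (seq x n - seq y n) ℚ.⊔ 0ℚ
    bound : ∀ n → seq x n ≤ seq y n + q n
    bound n = ℚₚ.≤-trans (ℚₚ.≤-reflexive (solve 2 (λ a b → a := b :+ (a :- b)) refl (seq x n) (seq y n)))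
      (ℚₚ.+-monoʳ-≤ (seq y n) (ℚₚ.p≤p⊔q (seq x n - seq y n) 0ℚ))
    null : Null q
    null ε 0<ε = eventually-map
      (λ n p → subst (_< ε) (sym (ℚₚ.0≤p⇒∣p∣≡p (ℚₚ.p≤q⊔p (seq x n - seq y n) 0ℚ)))
        (ℚₚ.≤-<-trans (ℚₚ.⊔-lub
            (subst (seq x n - seq y n ≤_) (solve 2 (λ b e → (b :+ e) :- b := e) refl (seq y n) (½ * ε))
              (ℚₚ.+-monoˡ-≤ (- seq y n) p))
            (ℚₚ.<⇒≤ (0<½* 0<ε)))
          (½ε<ε)))
      (x≤y (½ * ε) (0<½* 0<ε))
      where
      ½ε<ε : ½ * ε < ε
      ½ε<ε = subst₂ _<_ (ℚₚ.+-identityʳ (½ * ε)) (½+½ ε) (ℚₚ.+-monoʳ-< (½ * ε) (0<½* 0<ε))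

  square-mono-≤ : ∀ {x y} → 0ℚ ≤ x → x ≤ y → x * x ≤ y * y
  square-mono-≤ {x} {y} 0≤x x≤y = ℚₚ.≤-trans (*-mono-≤ˡ x 0≤x x≤y) (*-mono-≤ʳ y (ℚₚ.≤-trans 0≤x x≤y) x≤y)

  square-excess : ∀ {N σ ρ q e δ} → 0ℚ ≤ σ → σ ≤ ρ + q → σ * σ - N ≡ e → q * ((ρ + ρ) + q) + e * (- 1ℚ) ≤ δ →
    N ≤ ρ * ρ + δ
  square-excess {N} {σ} {ρ} {q} {e} {δ} 0≤σ σ≤ refl r≤δ = ≤-by
    ((δ - (q * ((ρ + ρ) + q) + (σ * σ - N) * (- 1ℚ))) + ((ρ + q) * (ρ + q) - σ * σ))
    (0≤+ (≤⇒0≤- r≤δ) (≤⇒0≤- (square-mono-≤ 0≤σ σ≤)))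
    (solve 5 (λ N ρ q σ δ → ρ :* ρ :+ δ :=
      N :+ ((δ :- (q :* ((ρ :+ ρ) :+ q) :+ (σ :* σ :- N) :* (:- con 1ℚ))) :+ ((ρ :+ q) :* (ρ :+ q) :- σ :* σ)))
      refl N ρ q σ δ)

  -- Squares the chain σ ≤ ρ₀ ≤ ρ, where σ plays the role of √N. The errors of both links form one
  -- null sequence, multiplied by the bounded factor 2ρ + q that squaring produces.
  square-lower-bound : ∀ N (σ ρ₀ ρ : ℝ) → (∀ n → 0ℚ ≤ seq σ n) → Null (λ n → seq σ n * seq σ n - N) →
    σ ≤ℝ ρ₀ → ρ₀ ≤ℝ ρ → ∀ δ → 0ℚ < δ → Eventually λ n → N ≤ seq ρ n * seq ρ n + δ
  square-lower-bound N σ ρ₀ ρ 0≤σ σ²≈N σ≤ρ₀ ρ₀≤ρ δ 0<δ = combine (≤ℝ-excess {σ} {ρ₀} σ≤ρ₀) (≤ℝ-excess {ρ₀} {ρ} ρ₀≤ρ)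
    where
    combine : Σ[ q ∈ (ℕ → ℚ) ] Null q × (∀ n → 0ℚ ≤ q n × seq σ n ≤ seq ρ₀ n + q n) →
              Σ[ q ∈ (ℕ → ℚ) ] Null q × (∀ n → 0ℚ ≤ q n × seq ρ₀ n ≤ seq ρ n + q n) →
              Eventually λ n → N ≤ seq ρ n * seq ρ n + δ
    combine (q₁ , n₁ , h₁) (q₂ , n₂ , h₂) = eventually-map
      (λ n p → square-excess {ρ = seq ρ n} {q = q n} (0≤σ n) (σ≤ n) refl (ℚₚ.<⇒≤ (ℚₚ.≤-<-trans (p≤∣p∣ (r n)) p)))
      (null-r δ 0<δ)
      where
      q r : ℕ → ℚ
      q n = q₂ n + q₁ n
      r n = q n * ((seq ρ n + seq ρ n) + q n) + (seq σ n * seq σ n - N) * (- 1ℚ)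
      null-q : Null q
      null-q = null-+ n₂ n₁
      null-r : Null r
      null-r = null-+ (null-* null-q (bounded-+ (bounded-ℝ (ρ +ℝ ρ)) (null⇒bounded null-q)))
                      (null-scale (- 1ℚ) σ²≈N)
      σ≤ : ∀ n → seq σ n ≤ seq ρ n + q n
      σ≤ n = ℚₚ.≤-trans (proj₂ (h₁ n)) (ℚₚ.≤-trans (ℚₚ.+-monoˡ-≤ (q₁ n) (proj₂ (h₂ n)))
        (ℚₚ.≤-reflexive (ℚₚ.+-assoc (seq ρ n) (q₂ n) (q₁ n))))

  -- From complex eigenvectors to rational approximants

  seq-sumℂ-re : ∀ {m} (f : Fin m → ℂ) n {g : Fin m → ℚ} → (∀ i → seq (re (f i)) n ≡ g i) →
    seq (re (sumℂ f)) n ≡ sum g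
  seq-sumℂ-re {zero}  f n e = refl
  seq-sumℂ-re {suc m} f n e = cong₂ _+_ (e zero) (seq-sumℂ-re (f ∘ suc) n (e ∘ suc))

  seq-sumℂ-im : ∀ {m} (f : Fin m → ℂ) n {g : Fin m → ℚ} → (∀ i → seq (im (f i)) n ≡ g i) →
    seq (im (sumℂ f)) n ≡ sum g
  seq-sumℂ-im {zero}  f n e = refl
  seq-sumℂ-im {suc m} f n e = cong₂ _+_ (e zero) (seq-sumℂ-im (f ∘ suc) n (e ∘ suc))

  entry-re : ∀ b (y : ℂ) n → seq (re ((if b then 1ℂ else 0ℂ) *ℂ y)) n ≡ χ b * seq (re y) n
  entry-re true y n = identity (seq (re y) n) (seq (im y) n)
    where
    identity : ∀ a b → 1ℚ * a + - (0ℚ * b) ≡ 1ℚ * a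
    identity = solve 2 (λ a b → con 1ℚ :* a :+ :- (con 0ℚ :* b) := con 1ℚ :* a) refl
  entry-re false y n = identity (seq (re y) n) (seq (im y) n)
    where
    identity : ∀ a b → 0ℚ * a + - (0ℚ * b) ≡ 0ℚ * a
    identity = solve 2 (λ a b → con 0ℚ :* a :+ :- (con 0ℚ :* b) := con 0ℚ :* a) refl

  entry-im : ∀ b (y : ℂ) n → seq (im ((if b then 1ℂ else 0ℂ) *ℂ y)) n ≡ χ b * seq (im y) n
  entry-im true y n = identity (seq (re y) n) (seq (im y) n)
    where
    identity : ∀ a b → 1ℚ * b + 0ℚ * a ≡ 1ℚ * b
    identity = solve 2 (λ a b → con 1ℚ :* b :+ con 0ℚ :* a := con 1ℚ :* b) refl
  entry-im false y n = identity (seq (re y) n) (seq (im y) n)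
    where
    identity : ∀ a b → 0ℚ * b + 0ℚ * a ≡ 0ℚ * b
    identity = solve 2 (λ a b → con 0ℚ :* b :+ con 0ℚ :* a := con 0ℚ :* b) refl

  adjacency-re : ∀ {m} (G : Graph m) (x : Fin m → ℂ) u n →
    seq (re ((adjacencyMatrix G *ᵛ x) u)) n ≡ linear (adj G u) (λ w → seq (re (x w)) n)
  adjacency-re G x u n = seq-sumℂ-re (λ w → adjacencyMatrix G u w *ℂ x w) n (λ w → entry-re (adj G u w) (x w) n)

  adjacency-im : ∀ {m} (G : Graph m) (x : Fin m → ℂ) u n →
    seq (im ((adjacencyMatrix G *ᵛ x) u)) n ≡ linear (adj G u) (λ w → seq (im (x w)) n)
  adjacency-im G x u n = seq-sumℂ-im (λ w → adjacencyMatrix G u w *ℂ x w) n (λ w → entry-im (adj G u w) (x w) n)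

  -- The modulus is multiplicative, |zx|² = |z|² |x|². Summed over all vertices, this turns the
  -- eigenvalue equation into |Ax|² - |z|² |x|² → 0, without any phases.
  residual-null : ∀ (a b zr zi xr xi : ℝ) →
    Null (λ n → seq a n - (seq zr n * seq xr n + - (seq zi n * seq xi n))) →
    Null (λ n → seq b n - (seq zr n * seq xi n + seq zi n * seq xr n)) →
    Null λ n → (seq a n * seq a n + seq b n * seq b n)
      - (seq zr n * seq zr n + seq zi n * seq zi n) * (seq xr n * seq xr n + seq xi n * seq xi n)
  residual-null a b zr zi xr xi ea eb = null-cong
    (λ n → solve 6 (λ a b zr zi xr xi →
      (a :* a :- (zr :* xr :+ :- (zi :* xi)) :* (zr :* xr :+ :- (zi :* xi)))
        :+ (b :* b :- (zr :* xi :+ zi :* xr) :* (zr :* xi :+ zi :* xr))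
      := (a :* a :+ b :* b) :- (zr :* zr :+ zi :* zi) :* (xr :* xr :+ xi :* xi)) refl
      (seq a n) (seq b n) (seq zr n) (seq zi n) (seq xr n) (seq xi n))
    (null-+ (null-square-difference {a} {zr *ℝ xr +ℝ (-ℝ (zi *ℝ xi))} ea)
            (null-square-difference {b} {zr *ℝ xi +ℝ zi *ℝ xr} eb))

  module Eigenvector {m : ℕ} (G : Graph m) (K N : ℚ) (0<K : 0ℚ < K)
    (bound : ∀ b → K * image² (adj G) b + norm² b ≤ K * (N * norm² b))
    (x y Ax Ay : Fin m → ℝ) (zr zi ρ : ℝ)
    (Ax-linear : ∀ v n → seq (Ax v) n ≡ linear (adj G v) (λ w → seq (x w) n))
    (Ay-linear : ∀ v n → seq (Ay v) n ≡ linear (adj G v) (λ w → seq (y w) n))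
    (eigen-re : ∀ v → Null λ n → seq (Ax v) n - (seq zr n * seq (x v) n + - (seq zi n * seq (y v) n)))
    (eigen-im : ∀ v → Null λ n → seq (Ay v) n - (seq zr n * seq (y v) n + seq zi n * seq (x v) n))
    (modulus : Null λ n → seq ρ n * seq ρ n - (seq zr n * seq zr n + seq zi n * seq zi n))
    (large : ∀ δ → 0ℚ < δ → Eventually λ n → N ≤ seq ρ n * seq ρ n + δ)
    where

    xr xi : ℕ → Fin m → ℚ
    xr n v = seq (x v) n
    xi n v = seq (y v) n

    S E ρ² z² : ℕ → ℚ
    S n = norm² (xr n) + norm² (xi n)
    E n = image² (adj G) (xr n) + image² (adj G) (xi n)
    ρ² n = seq ρ n * seq ρ n
    z² n = seq zr n * seq zr n + seq zi n * seq zi n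

    bounded-S : Bounded S
    bounded-S = bounded-+ (bounded-sum (λ v n → xr n v * xr n v) (λ v → bounded-ℝ (x v *ℝ x v)))
                          (bounded-sum (λ v n → xi n v * xi n v) (λ v → bounded-ℝ (y v *ℝ y v)))

    residual : Fin m → ℕ → ℚ
    residual v n = (linear (adj G v) (xr n) * linear (adj G v) (xr n) + linear (adj G v) (xi n) * linear (adj G v) (xi n))
      - z² n * (xr n v * xr n v + xi n v * xi n v)

    null-residual : ∀ v → Null (residual v)
    null-residual v = null-cong
      (λ n → cong₂ (λ a b → (a * a + b * b) - z² n * (xr n v * xr n v + xi n v * xi n v)) (Ax-linear v n) (Ay-linear v n))
      (residual-null (Ax v) (Ay v) zr zi (x v) (y v) (eigen-re v) (eigen-im v))

    null-E : Null (λ n → E n - z² n * S n)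
    null-E = null-cong eq (null-sum residual null-residual)
      where
      eq : ∀ n → sum (λ v → residual v n) ≡ E n - z² n * S n
      eq n = trans (sum-minus (λ v → linear (adj G v) (xr n) * linear (adj G v) (xr n) + linear (adj G v) (xi n) * linear (adj G v) (xi n))
                              (λ v → z² n * (xr n v * xr n v + xi n v * xi n v)))
        (cong₂ _-_
          (∑-distrib-+ (λ v → linear (adj G v) (xr n) * linear (adj G v) (xr n)) (λ v → linear (adj G v) (xi n) * linear (adj G v) (xi n)))
          (trans (sym (*-distribˡ-sum (z² n) (λ v → xr n v * xr n v + xi n v * xi n v)))
            (cong (z² n *_) (∑-distrib-+ (λ v → xr n v * xr n v) (λ v → xi n v * xi n v)))))

    η : ℕ → ℚ
    η n = ρ² n * S n - E n

    null-η : Null η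
    null-η = null-cong
      (λ n → solve 4 (λ r z s e → (r :- z) :* s :+ (e :- z :* s) :* (:- con 1ℚ) := r :* s :- e) refl (ρ² n) (z² n) (S n) (E n))
      (null-+ (null-* modulus bounded-S) (null-scale (- 1ℚ) null-E))

    0≤norm : ∀ (b : Fin m → ℚ) → 0ℚ ≤ norm² b
    0≤norm b = 0≤sum (λ v → 0≤sq (b v))

    -- The hypothesis `bound`, added over real and imaginary parts, gives K E + S ≤ K N S, and
    -- `large` gives N ≤ ρ² + δ eventually. Together S ≤ K η + K δ S, where η is null.
    null-S : Null S
    null-S = null-dominated (null-scale (2ℚ * K) null-η) (eventually-map dominated (large δ 0<δ))
      where
      instance
        pos-K : Positive K
        pos-K = positive 0<K
        nz-K : ℚ.NonZero K
        nz-K = ℚₚ.pos⇒nonZero K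
        pos-1/K : Positive (ℚ.1/ K)
        pos-1/K = ℚₚ.1/pos⇒pos K
      -- With K δ = ½ the last term absorbs half of S, which leaves S ≤ 2 K η.
      δ : ℚ
      δ = ½ * ℚ.1/ K
      0<δ : 0ℚ < δ
      0<δ = 0<½* (ℚₚ.positive⁻¹ (ℚ.1/ K))
      Kδ : K * δ + K * δ ≡ 1ℚ
      Kδ = trans (solve 2 (λ k i → k :* (con ½ :* i) :+ k :* (con ½ :* i) := k :* i) refl K (ℚ.1/ K)) (ℚₚ.*-inverseʳ K)
      dominated : ∀ n → N ≤ ρ² n + δ → 0ℚ ≤ S n × S n ≤ η n * (2ℚ * K)
      dominated n p = 0≤+ (0≤norm (xr n)) (0≤norm (xi n)) , ≤-by
        (2ℚ * (K * ((ρ² n + δ) - N)) * S n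
          + 2ℚ * (K * (N * norm² (xr n)) - (K * image² (adj G) (xr n) + norm² (xr n))
                + (K * (N * norm² (xi n)) - (K * image² (adj G) (xi n) + norm² (xi n)))))
        (0≤+ (0≤* (0≤* 0≤2 (0≤* (ℚₚ.<⇒≤ 0<K) (≤⇒0≤- p))) (0≤+ (0≤norm (xr n)) (0≤norm (xi n))))
             (0≤* 0≤2 (0≤+ (≤⇒0≤- (bound (xr n))) (≤⇒0≤- (bound (xi n))))))
        (trans
          (solve 8 (λ k r d N a b e f →
            (r :* (a :+ b) :- (e :+ f)) :* (con 2ℚ :* k) :=
            (con 1ℚ :- (k :* d :+ k :* d)) :* (a :+ b) :+
            ((a :+ b) :+ (con 2ℚ :* (k :* ((r :+ d) :- N)) :* (a :+ b)
              :+ con 2ℚ :* (k :* (N :* a) :- (k :* e :+ a) :+ (k :* (N :* b) :- (k :* f :+ b))))))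
            refl K (ρ² n) δ N (norm² (xr n)) (norm² (xi n)) (image² (adj G) (xr n)) (image² (adj G) (xi n)))
          (trans (cong (λ y → (1ℚ - y) * S n + rest n) Kδ)
            (solve 2 (λ s t → (con 1ℚ :- con 1ℚ) :* s :+ t := t) refl (S n) (rest n))))
        where
        0≤2 : 0ℚ ≤ 2ℚ
        0≤2 = 0≤+ 0≤1 0≤1
        rest : ℕ → ℚ
        rest n = S n + (2ℚ * (K * ((ρ² n + δ) - N)) * S n
          + 2ℚ * (K * (N * norm² (xr n)) - (K * image² (adj G) (xr n) + norm² (xr n))
                + (K * (N * norm² (xi n)) - (K * image² (adj G) (xi n) + norm² (xi n)))))

    vanishes : ∀ v → Null (λ n → seq (x v) n - 0ℚ) × Null (λ n → seq (y v) n - 0ℚ)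
    vanishes v = small (x v) (λ n → ℚₚ.≤-trans (term≤sum (λ v → 0≤sq (xr n v)) v)
                     (≤-by (norm² (xi n)) (0≤norm (xi n)) refl))
               , small (y v) (λ n → ℚₚ.≤-trans (term≤sum (λ v → 0≤sq (xi n v)) v)
                     (≤-by (norm² (xr n)) (0≤norm (xr n)) (ℚₚ.+-comm (norm² (xr n)) (norm² (xi n)))))
      where
      small : (y : ℝ) → (∀ n → seq y n * seq y n ≤ S n) → Null (λ n → seq y n - 0ℚ)
      small y h = null-cong (λ n → solve 1 (λ a → a := a :- con 0ℚ) refl (seq y n))
        (null-√ (null-dominated null-S (0 , λ n _ → 0≤sq (seq y n) , h n)))

  -- Stated on rational sequences: unifying reals would compare their Cauchy proofs.
  ≈ℂ-*-re : ∀ (a z x : ℂ) → a ≈ℂ z *ℂ x →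
    Null (λ n → seq (re a) n - (seq (re z) n * seq (re x) n + - (seq (im z) n * seq (im x) n)))
  ≈ℂ-*-re a z x e = proj₁ e

  ≈ℂ-*-im : ∀ (a z x : ℂ) → a ≈ℂ z *ℂ x →
    Null (λ n → seq (im a) n - (seq (re z) n * seq (im x) n + seq (im z) n * seq (re x) n))
  ≈ℂ-*-im a z x e = proj₂ e

  no-large-radius : ∀ {m} (G : Graph m) (K N : ℚ) → 0ℚ < K →
    (∀ b → K * image² (adj G) b + norm² b ≤ K * (N * norm² b)) →
    ∀ ρ → IsSpectralRadius G ρ →
    (∀ δ → 0ℚ < δ → Eventually λ n → N ≤ seq ρ n * seq ρ n + δ) → ⊥
  no-large-radius G K N 0<K bound ρ ((z , (x , x≉0 , eigen) , _ , modulus) , _) large =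
    x≉0 (Eigenvector.vanishes G K N 0<K bound (re ∘ x) (im ∘ x)
      (λ v → re ((adjacencyMatrix G *ᵛ x) v)) (λ v → im ((adjacencyMatrix G *ᵛ x) v)) (re z) (im z) ρ
      (λ v n → adjacency-re G x v n) (λ v n → adjacency-im G x v n)
      (λ v → ≈ℂ-*-re ((adjacencyMatrix G *ᵛ x) v) z (x v) (eigen v))
      (λ v → ≈ℂ-*-im ((adjacencyMatrix G *ᵛ x) v) z (x v) (eigen v)) modulus large)

  -- Rational approximation of √(a(a + 1))

  toℚᵘ-ι : ∀ n → ℚ.toℚᵘ (ι n) ℚᵘ.≃ ℚᵘ.mkℚᵘ (ℤ.+ n) 0
  toℚᵘ-ι zero    = ℚᵘₚ.≃-refl
  toℚᵘ-ι (suc n) = ℚᵘₚ.≃-trans (ℚₚ.toℚᵘ-homo-+ 1ℚ (ι n)) (ℚᵘₚ.≃-trans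
    (ℚᵘₚ.+-congʳ ℚᵘ.1ℚᵘ (toℚᵘ-ι n))
    (ℚᵘ.*≡* (trans (ℤₚ.*-identityʳ _) (trans (cong (ℤ._+_ (ℤ.+ 1)) (ℤₚ.*-identityʳ (ℤ.+ n))) (sym (ℤₚ.*-identityʳ _))))))

  archimedean : ∀ ε → 0ℚ < ε → Σ[ M ∈ ℕ ] 1ℚ < ι M * ε
  archimedean ε 0<ε = M , ℚₚ.toℚᵘ-cancel-< (ℚᵘₚ.<-respʳ-≃ (ℚᵘₚ.≃-sym
      (ℚᵘₚ.≃-trans (ℚₚ.toℚᵘ-homo-* (ι M) ε) (ℚᵘₚ.*-congʳ (toℚᵘ-ι M)))) (lt ε 0<ε))
    where
    -- A positive rational is at least the reciprocal of its denominator; the successor makes the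
    -- inequality strict.
    M = suc (ℚ.↧ₙ ε)
    lt : ∀ ε → 0ℚ < ε → ℚᵘ.1ℚᵘ ℚᵘ.< ℚᵘ.mkℚᵘ (ℤ.+ suc (ℚ.↧ₙ ε)) 0 ℚᵘ.* ℚ.toℚᵘ ε
    lt (ℚ.mkℚ (ℤ.+ zero) d _)  p with ℤ.+<+ () ← ℚₚ.drop-*<* p
    lt (ℚ.mkℚ (ℤ.-[1+ k ]) d _) p with () ← ℚₚ.drop-*<* p
    lt (ℚ.mkℚ (ℤ.+ suc k) d _) p = ℚᵘ.*<* (subst₂ ℤ._<_
      (sym (trans (ℤₚ.*-identityˡ (ℤ.+ (1 ℕ.* suc d))) (cong ℤ.+_ (ℕₚ.*-identityˡ (suc d)))))
      (trans (ℤₚ.pos-* (suc (suc d)) (suc k)) (sym (ℤₚ.*-identityʳ (ℤ.+ suc (suc d) ℤ.* ℤ.+ suc k))))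
      (ℤ.+<+ (ℕₚ.≤-trans (ℕₚ.n<1+n (suc d)) (ℕₚ.m≤m*n (suc (suc d)) (suc k)))))

  -- As all values are at least 1, the factor y k + y l exceeds 1, and so |y k - y l| ≤ |y k² - y
  -- l²|.
  √-cauchy : ∀ (y : ℕ → ℚ) N → (∀ n → 1ℚ ≤ y n) → Null (λ n → y n * y n - N) → IsCauchy y
  √-cauchy y N 1≤y null ε 0<ε with null (½ * ε) (0<½* 0<ε)
  ... | M , h = M , λ k l M≤k M≤l → ℚₚ.≤-<-trans (close k l) (subst (∣ r k - r l ∣ <_) (½+½ ε)
      (ℚₚ.≤-<-trans (ℚₚ.∣p-q∣≤∣p∣+∣q∣ (r k) (r l)) (ℚₚ.+-mono-< (h k M≤k) (h l M≤l))))
    where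
    r : ℕ → ℚ
    r n = y n * y n - N
    close : ∀ k l → ∣ y k - y l ∣ ≤ ∣ r k - r l ∣
    close k l = subst₂ _≤_ (ℚₚ.*-identityʳ ∣ d ∣)
      (trans (cong (∣ d ∣ *_) (sym (ℚₚ.0≤p⇒∣p∣≡p (ℚₚ.≤-trans 0≤1 1≤s))))
        (trans (sym (ℚₚ.∣p*q∣≡∣p∣*∣q∣ d (y k + y l)))
          (cong ∣_∣ (solve 3 (λ a b N → (a :- b) :* (a :+ b) := (a :* a :- N) :- (b :* b :- N)) refl (y k) (y l) N))))
      (*-mono-≤ˡ ∣ d ∣ (ℚₚ.0≤∣p∣ d) 1≤s)
      where
      d = y k - y l
      1≤s : 1ℚ ≤ y k + y l
      1≤s = ℚₚ.≤-trans (1≤y k) (≤-by (y l) (ℚₚ.≤-trans 0≤1 (1≤y l)) refl)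

  -- √(a(a+1)) through the Pell equation p² = a(a+1)q² + 1 with fundamental solution (2a+1, 2).
  module Pell (a : ℕ) (1≤a : 1 ℕ.≤ a) where

    pell : ℕ → ℕ × ℕ
    pell zero    = a ℕ.+ suc a , 2
    pell (suc k) = (a ℕ.+ suc a) ℕ.* proj₁ (pell k) ℕ.+ (2 ℕ.* (a ℕ.* suc a)) ℕ.* proj₂ (pell k)
                 , 2 ℕ.* proj₁ (pell k) ℕ.+ (a ℕ.+ suc a) ℕ.* proj₂ (pell k)

    p q : ℕ → ℕ
    p = proj₁ ∘ pell
    q = proj₂ ∘ pell

    -- Each step multiplies p + q√N by the unit (2a + 1) + 2√N, whose norm is (2a + 1)² - 4a(a + 1)
    -- = 1, so p² - N q² is preserved. Over the naturals, `norm-preserved` states this with the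
    -- negative terms moved across.
    pell-equation : ∀ k → p k ℕ.* p k ≡ suc ((a ℕ.* suc a) ℕ.* (q k ℕ.* q k))
    pell-equation zero = S.solve 1 (λ a → (a S.:+ (S.con 1 S.:+ a)) S.:* (a S.:+ (S.con 1 S.:+ a))
        S.:= S.con 1 S.:+ (a S.:* (S.con 1 S.:+ a)) S.:* S.con 4) refl a
      where module S = ℕSolver.+-*-Solver
    pell-equation (suc k) = ℕₚ.+-cancelʳ-≡ (N′ ℕ.* (Q ℕ.* Q)) _ _ (begin
      p (suc k) ℕ.* p (suc k) ℕ.+ N′ ℕ.* (Q ℕ.* Q)             ≡⟨ norm-preserved ⟩
      N′ ℕ.* (q (suc k) ℕ.* q (suc k)) ℕ.+ P ℕ.* P              ≡⟨ cong (N′ ℕ.* (q (suc k) ℕ.* q (suc k)) ℕ.+_) (pell-equation k) ⟩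
      N′ ℕ.* (q (suc k) ℕ.* q (suc k)) ℕ.+ suc (N′ ℕ.* (Q ℕ.* Q)) ≡⟨ ℕₚ.+-suc (N′ ℕ.* (q (suc k) ℕ.* q (suc k))) (N′ ℕ.* (Q ℕ.* Q)) ⟩
      suc (N′ ℕ.* (q (suc k) ℕ.* q (suc k))) ℕ.+ N′ ℕ.* (Q ℕ.* Q) ∎)
      where
      open ≡-Reasoning
      module S = ℕSolver.+-*-Solver
      N′ P Q : ℕ
      N′ = a ℕ.* suc a
      P = p k
      Q = q k
      norm-preserved : p (suc k) ℕ.* p (suc k) ℕ.+ N′ ℕ.* (Q ℕ.* Q) ≡ N′ ℕ.* (q (suc k) ℕ.* q (suc k)) ℕ.+ P ℕ.* P
      norm-preserved = S.solve 3 (λ a p q →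
        let A = a S.:+ (S.con 1 S.:+ a)
            N = a S.:* (S.con 1 S.:+ a)
            p′ = A S.:* p S.:+ (S.con 2 S.:* N) S.:* q
            q′ = S.con 2 S.:* p S.:+ A S.:* q
        in p′ S.:* p′ S.:+ N S.:* (q S.:* q) S.:= N S.:* (q′ S.:* q′) S.:+ p S.:* p) refl a P Q

    1≤2a+1 : 1 ℕ.≤ a ℕ.+ suc a
    1≤2a+1 = ℕₚ.≤-trans (ℕ.s≤s ℕ.z≤n) (ℕₚ.m≤n+m (suc a) a)

    2≤2a+1 : 2 ℕ.≤ a ℕ.+ suc a
    2≤2a+1 = ℕₚ.≤-trans (ℕ.s≤s 1≤a) (ℕₚ.m≤n+m (suc a) a)

    -- Makes p/q at least 1, which `√-cauchy` requires of the approximants.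
    q≤p : ∀ k → q k ℕ.≤ p k
    q≤p zero    = 2≤2a+1
    q≤p (suc k) = ℕₚ.+-mono-≤ (ℕₚ.*-monoˡ-≤ (p k) 2≤2a+1) (ℕₚ.*-monoˡ-≤ (q k) 2a+1≤2N)
      where
      2a+1≤2N : a ℕ.+ suc a ℕ.≤ 2 ℕ.* (a ℕ.* suc a)
      2a+1≤2N = ℕₚ.+-mono-≤ (ℕₚ.m≤m*n a (suc a))
        (ℕₚ.≤-trans (ℕₚ.m≤n*m (suc a) a {{ℕ.>-nonZero 1≤a}}) (ℕₚ.≤-reflexive (sym (ℕₚ.+-identityʳ (a ℕ.* suc a)))))

    -- The error of (p/q)² is exactly 1/q², so it suffices that the denominators grow without bound.
    k<q : ∀ k → suc k ℕ.≤ q k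
    k<q zero    = ℕ.s≤s ℕ.z≤n
    k<q (suc k) = ℕₚ.+-mono-≤
      (ℕₚ.≤-trans (ℕₚ.≤-trans (ℕ.s≤s ℕ.z≤n) (ℕₚ.≤-trans (k<q k) (q≤p k))) (ℕₚ.m≤n*m (p k) 2))
      (ℕₚ.≤-trans (k<q k) (ℕₚ.m≤n*m (q k) (a ℕ.+ suc a) {{ℕ.>-nonZero 1≤2a+1}}))

    N : ℚ
    N = ι (a ℕ.* suc a)

    1≤ιq : ∀ k → 1ℚ ≤ ι (q k)
    1≤ιq k = ℚₚ.≤-trans (1≤ι 0) (ι-mono (ℕₚ.≤-trans (ℕ.s≤s ℕ.z≤n) (k<q k)))

    pos-q : ∀ k → Positive (ι (q k))
    pos-q k = positive (ℚₚ.<-≤-trans (ℚₚ.positive⁻¹ 1ℚ) (1≤ιq k))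

    u y : ℕ → ℚ
    u k = (ℚ.1/ ι (q k)) {{ℚₚ.pos⇒nonZero (ι (q k)) {{pos-q k}}}}
    y k = ι (p k) * u k

    qu≡1 : ∀ k → ι (q k) * u k ≡ 1ℚ
    qu≡1 k = ℚₚ.*-inverseʳ (ι (q k)) {{ℚₚ.pos⇒nonZero (ι (q k)) {{pos-q k}}}}

    0<u : ∀ k → 0ℚ < u k
    0<u k = ℚₚ.positive⁻¹ (u k) {{ℚₚ.1/pos⇒pos (ι (q k)) {{pos-q k}}}}

    1≤y : ∀ k → 1ℚ ≤ y k
    1≤y k = subst (_≤ y k) (qu≡1 k) (*-mono-≤ʳ (u k) (ℚₚ.<⇒≤ (0<u k)) (ι-mono (q≤p k)))

    y²-N : ∀ k → u k * u k ≡ y k * y k - N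
    y²-N k = sym (begin
      y k * y k - N
        ≡⟨ solve 3 (λ p u N → (p :* u) :* (p :* u) :- N := (p :* p) :* (u :* u) :- N) refl (ι (p k)) (u k) N ⟩
      (ι (p k) * ι (p k)) * (u k * u k) - N
        ≡⟨ cong (λ z → z * (u k * u k) - N) (trans (sym (×1-homo-* (p k) (p k))) (trans (cong ι (pell-equation k)) (cong (1ℚ +_)
             (trans (×1-homo-* (a ℕ.* suc a) (q k ℕ.* q k)) (cong (N *_) (×1-homo-* (q k) (q k))))))) ⟩
      (1ℚ + N * (ι (q k) * ι (q k))) * (u k * u k) - N
        ≡⟨ solve 3 (λ N q u → (con 1ℚ :+ N :* (q :* q)) :* (u :* u) :- N
             := u :* u :+ N :* ((q :* u) :* (q :* u) :- con 1ℚ)) refl N (ι (q k)) (u k) ⟩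
      u k * u k + N * ((ι (q k) * u k) * (ι (q k) * u k) - 1ℚ)
        ≡⟨ cong (λ z → u k * u k + N * (z * z - 1ℚ)) (qu≡1 k) ⟩
      u k * u k + N * (1ℚ * 1ℚ - 1ℚ)
        ≡⟨ solve 2 (λ x N → x :+ N :* (con 1ℚ :* con 1ℚ :- con 1ℚ) := x) refl (u k * u k) N ⟩
      u k * u k ∎)
      where open ≡-Reasoning

    null-u : Null u
    null-u ε 0<ε with archimedean ε 0<ε
    ... | M , 1<Mε = M , λ k M≤k → subst₂ _<_
      (trans (ℚₚ.*-identityˡ (u k)) (sym (ℚₚ.0≤p⇒∣p∣≡p (ℚₚ.<⇒≤ (0<u k)))))
      (trans (solve 3 (λ q e u → (q :* e) :* u := (q :* u) :* e) refl (ι (q k)) ε (u k))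
        (trans (cong (_* ε) (qu≡1 k)) (ℚₚ.*-identityˡ ε)))
      (ℚₚ.*-monoˡ-<-pos (u k) {{positive (0<u k)}} (ℚₚ.<-≤-trans 1<Mε
        (*-mono-≤ʳ ε (ℚₚ.<⇒≤ 0<ε) (ι-mono (ℕₚ.≤-trans M≤k (ℕₚ.≤-trans (ℕₚ.n≤1+n k) (k<q k)))))))

    null-y² : Null (λ k → y k * y k - N)
    null-y² = null-cong y²-N (null-* null-u (null⇒bounded null-u))

    σ : ℝ
    σ = mkℝ y (√-cauchy y N 1≤y null-y²)

  -- A lower bound for the spectral radius of the comparison graph

  sum-++ : ∀ s t (f : Fin (s ℕ.+ t) → ℚ) → sum f ≡ sum (f ∘ (_↑ˡ t)) + sum (f ∘ (s ↑ʳ_))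
  sum-++ zero    t f = sym (ℚₚ.+-identityˡ (sum f))
  sum-++ (suc s) t f = trans (cong (f zero +_) (sum-++ s t (f ∘ suc)))
    (sym (ℚₚ.+-assoc (f zero) (sum (f ∘ suc ∘ (_↑ˡ t))) (sum (f ∘ suc ∘ (s ↑ʳ_)))))

  sum-const : ∀ n c → sum {n} (λ _ → c) ≡ ι n * c
  sum-const zero    c = sym (ℚₚ.*-zeroˡ c)
  sum-const (suc n) c = trans (cong (c +_) (sum-const n c))
    (solve 2 (λ c n → c :+ n :* c := (con 1ℚ :+ n) :* c) refl c (ι n))

  module KView (s t : ℕ) where

    -- Sorting the vertices into parts replaces the nested `splitAt` on indices by a case
    -- distinction, for adjacency as well as for sums.
    Part : Set
    Part = (Fin s ⊎ Fin t) ⊎ Fin 1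

    view : Fin ((s ℕ.+ t) ℕ.+ 1) → Part
    view w = Sum.map₁ (splitAt s) (splitAt (s ℕ.+ t) w)

    joined : Part → Part → Bool
    joined (inj₁ (inj₁ _)) (inj₁ (inj₂ _)) = true
    joined (inj₁ (inj₂ _)) (inj₁ (inj₁ _)) = true
    joined _               _               = false

    adj-view : ∀ u v → adj (K[ s , t ] ⊔ᴳ K₁) u v ≡ joined (view u) (view v)
    adj-view u v with splitAt (s ℕ.+ t) u | splitAt (s ℕ.+ t) v
    ... | inj₁ u′ | inj₂ _ with splitAt s u′
    ...   | inj₁ _ = refl
    ...   | inj₂ _ = refl
    adj-view u v | inj₂ _ | inj₁ _ = refl
    adj-view u v | inj₂ _ | inj₂ _ = refl
    adj-view u v | inj₁ u′ | inj₁ v′ with splitAt s u′ | splitAt s v′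
    ... | inj₁ _ | inj₁ _ = refl
    ... | inj₁ _ | inj₂ _ = refl
    ... | inj₂ _ | inj₁ _ = refl
    ... | inj₂ _ | inj₂ _ = refl

    sum-view : (F : Part → ℚ) → sum (F ∘ view) ≡
      (sum (λ i → F (inj₁ (inj₁ i))) + sum (λ j → F (inj₁ (inj₂ j)))) + F (inj₂ zero)
    sum-view F = trans (sum-++ (s ℕ.+ t) 1 (F ∘ view)) (cong₂ _+_
      (trans (sum-cong-≗ λ i → cong (F ∘ Sum.map₁ (splitAt s)) (Finₚ.splitAt-↑ˡ (s ℕ.+ t) i 1))
        (trans (sum-++ s t (F ∘ inj₁ ∘ splitAt s)) (cong₂ _+_
          (sum-cong-≗ λ i → cong (F ∘ inj₁) (Finₚ.splitAt-↑ˡ s i t))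
          (sum-cong-≗ λ j → cong (F ∘ inj₁) (Finₚ.splitAt-↑ʳ s t j)))))
      (trans (ℚₚ.+-identityʳ _) (cong (F ∘ Sum.map₁ (splitAt s)) (Finₚ.splitAt-↑ʳ (s ℕ.+ t) 1 zero))))

  ≈ℂ-*-real : ∀ (a : ℂ) (s v : ℝ) {L R I : ℕ → ℚ} → (∀ n → seq (re a) n ≡ L n) → (∀ n → seq (im a) n ≡ I n) →
    (∀ n → L n ≡ R n) → (∀ n → I n ≡ 0ℚ) → Null (λ n → R n - (seq s n * seq v n + - (0ℚ * 0ℚ))) →
    a ≈ℂ (s +i 0ℝ) *ℂ (v +i 0ℝ)
  ≈ℂ-*-real a s v r i r′ i′ null =
      null-cong (λ n → cong (_- (seq s n * seq v n + - (0ℚ * 0ℚ))) (sym (trans (r n) (r′ n)))) null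
    , null-cong (λ n → sym (trans (cong (_- (seq s n * 0ℚ + 0ℚ * seq v n)) (trans (i n) (i′ n)))
        (solve 2 (λ y x → con 0ℚ :- (y :* con 0ℚ :+ con 0ℚ :* x) := con 0ℚ) refl (seq s n) (seq v n)))) null-0

  module ExtremalEigenvector (a : ℕ) (1≤a : 1 ℕ.≤ a) where

    open Pell a 1≤a
    open KView (suc a) (suc a ℕ.∸ 1)

    -- The Perron vector of the nontrivial component, scaled to be rational on the larger side:
    -- there the eigenvalue equation a σ = σ a is exact, while on the smaller side (a + 1) a = σ²
    -- holds up to a null sequence. The isolated vertex gets 0.
    value : Part → ℝ
    value (inj₁ (inj₁ _)) = mkℝ (λ _ → ι a) (const-cauchy (ι a))
    value (inj₁ (inj₂ _)) = σ
    value (inj₂ _)        = 0ℝ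

    x : Fin ((suc a ℕ.+ (suc a ℕ.∸ 1)) ℕ.+ 1) → ℂ
    x w = value (view w) +i 0ℝ

    z : ℂ
    z = σ +i 0ℝ

    row-sum : Part → ℕ → ℚ
    row-sum part n = (sum {suc a} (λ i → χ (joined part (inj₁ (inj₁ i))) * ι a)
      + sum {a} (λ j → χ (joined part (inj₁ (inj₂ j))) * y n)) + χ (joined part (inj₂ zero)) * 0ℚ

    linear-value : ∀ v n → linear (adj (K[ suc a , suc a ℕ.∸ 1 ] ⊔ᴳ K₁) v) (λ w → seq (re (x w)) n) ≡ row-sum (view v) n
    linear-value v n = trans
      (sum-cong-≗ λ w → cong (λ c → χ c * seq (value (view w)) n) (adj-view v w))
      (sum-view (λ part → χ (joined (view v) part) * seq (value part) n))

    residual-re : ∀ part → Null λ n → row-sum part n - (y n * seq (value part) n + - (0ℚ * 0ℚ))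
    residual-re (inj₁ (inj₁ i)) = null-cong (λ n → sym (trans
      (cong₂ (λ s t → ((s + t) + 0ℚ * 0ℚ) - (y n * ι a + - (0ℚ * 0ℚ))) (sum-const (suc a) (0ℚ * ι a)) (sum-const a (1ℚ * y n)))
      (solve 3 (λ s a y → ((s :* (con 0ℚ :* a) :+ a :* (con 1ℚ :* y)) :+ con 0ℚ :* con 0ℚ) :- (y :* a :+ :- (con 0ℚ :* con 0ℚ)) := con 0ℚ)
        refl (ι (suc a)) (ι a) (y n)))) null-0
    residual-re (inj₁ (inj₂ j)) = null-cong (λ n → sym (trans
      (cong₂ (λ s t → ((s + t) + 0ℚ * 0ℚ) - (y n * y n + - (0ℚ * 0ℚ))) (sum-const (suc a) (1ℚ * ι a)) (sum-const a (0ℚ * y n)))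
      (trans (solve 3 (λ s a y → ((s :* (con 1ℚ :* a) :+ a :* (con 0ℚ :* y)) :+ con 0ℚ :* con 0ℚ) :- (y :* y :+ :- (con 0ℚ :* con 0ℚ))
          := (y :* y :- a :* s) :* (:- con 1ℚ)) refl (ι (suc a)) (ι a) (y n))
        (cong (λ c → (y n * y n - c) * (- 1ℚ)) (sym (×1-homo-* a (suc a)))))))
      (null-scale (- 1ℚ) null-y²)
    residual-re (inj₂ _) = null-cong (λ n → sym (trans
      (cong₂ (λ s t → ((s + t) + 0ℚ * 0ℚ) - (y n * 0ℚ + - (0ℚ * 0ℚ))) (sum-const (suc a) (0ℚ * ι a)) (sum-const a (0ℚ * y n)))
      (solve 3 (λ s a y → ((s :* (con 0ℚ :* a) :+ a :* (con 0ℚ :* y)) :+ con 0ℚ :* con 0ℚ) :- (y :* con 0ℚ :+ :- (con 0ℚ :* con 0ℚ)) := con 0ℚ)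
        refl (ι (suc a)) (ι a) (y n)))) null-0

    linear-zero : ∀ {m} (c : Fin m → Bool) → linear c (λ _ → 0ℚ) ≡ 0ℚ
    linear-zero {m} c = trans (sum-cong-≗ λ w → ℚₚ.*-zeroʳ (χ (c w))) (sum-replicate-zero m)

    eigen : ∀ v → (adjacencyMatrix (K[ suc a , suc a ℕ.∸ 1 ] ⊔ᴳ K₁) *ᵛ x) v ≈ℂ z *ℂ x v
    eigen v = ≈ℂ-*-real ((adjacencyMatrix (K[ suc a , suc a ℕ.∸ 1 ] ⊔ᴳ K₁) *ᵛ x) v) σ (value (view v))
      (adjacency-re (K[ suc a , suc a ℕ.∸ 1 ] ⊔ᴳ K₁) x v) (adjacency-im (K[ suc a , suc a ℕ.∸ 1 ] ⊔ᴳ K₁) x v) (linear-value v) (λ _ → linear-zero (adj (K[ suc a , suc a ℕ.∸ 1 ] ⊔ᴳ K₁) v)) (residual-re (view v))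

    x≉0 : (∀ v → x v ≈ℂ 0ℂ) → ⊥
    -- Vertex `zero` lies on the larger side, where the entry is a ≥ 1.
    x≉0 h with proj₁ (h zero) 1ℚ (ℚₚ.positive⁻¹ 1ℚ)
    ... | M , lt = ℚₚ.<-irrefl refl (ℚₚ.≤-<-trans 1≤ (lt M ℕₚ.≤-refl))
      where
      1≤ : 1ℚ ≤ ∣ ι a - 0ℚ ∣
      1≤ = ℚₚ.≤-trans (ℚₚ.≤-trans (ι-mono 1≤a) (ℚₚ.≤-reflexive (sym (ℚₚ.+-identityʳ (ι a))))) (p≤∣p∣ (ι a - 0ℚ))

    0≤σ : ∀ n → 0ℚ ≤ seq σ n
    0≤σ n = ℚₚ.≤-trans 0≤1 (1≤y n)

    σ-modulus : IsModulus z σ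
    σ-modulus = (λ ε 0<ε → 0 , λ n _ → 0≤+ (0≤σ n) (ℚₚ.<⇒≤ 0<ε))
      , null-cong (λ n → solve 1 (λ y → con 0ℚ := y :* y :- (y :* y :+ con 0ℚ :* con 0ℚ)) refl (y n)) null-0

    σ≤spectralRadius : ∀ ρ₀ → IsSpectralRadius (K[ suc a , suc a ℕ.∸ 1 ] ⊔ᴳ K₁) ρ₀ → σ ≤ℝ ρ₀
    σ≤spectralRadius ρ₀ (_ , max) = max σ (z , (x , x≉0 , eigen) , σ-modulus)

    spectralRadius-large : ∀ (ρ₀ ρ : ℝ) → IsSpectralRadius (K[ suc a , suc a ℕ.∸ 1 ] ⊔ᴳ K₁) ρ₀ → ρ₀ ≤ℝ ρ →
      ∀ δ → 0ℚ < δ → Eventually λ n → ι (a ℕ.* suc a) ≤ seq ρ n * seq ρ n + δ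
    spectralRadius-large ρ₀ ρ spectral ρ₀≤ρ =
      square-lower-bound (ι (a ℕ.* suc a)) σ ρ₀ ρ 0≤σ null-y² (σ≤spectralRadius ρ₀ spectral) ρ₀≤ρ

  ι-0 : ι 0 ≡ 0ℚ
  ι-0 = refl

  ι-1 : ι 1 ≡ 1ℚ
  ι-1 = refl

  -- Counting pairs in a Boolean matrix

  sum-bump : ∀ {m} (f g : Fin m → ℚ) i → f i ≡ 1ℚ + g i → (∀ j → j ≢ i → f j ≡ g j) → sum f ≡ 1ℚ + sum g
  sum-bump f g zero    e h = trans (cong₂ _+_ e (sum-cong-≗ λ j → h (suc j) λ ()))
    (ℚₚ.+-assoc 1ℚ (g zero) (sum (g ∘ suc)))
  sum-bump f g (suc i) e h = trans
    (cong₂ _+_ (h zero λ ()) (sum-bump (f ∘ suc) (g ∘ suc) i e λ j j≢i → h (suc j) (j≢i ∘ Finₚ.suc-injective)))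
    (solve 2 (λ x y → x :+ (con 1ℚ :+ y) := con 1ℚ :+ (x :+ y)) refl (g zero) (sum (g ∘ suc)))

  without-other : ∀ {m} (a : Fin m → Bool) i j → j ≢ i → without a i j ≡ a j
  without-other a zero    zero    j≢i = ⊥-elim (j≢i refl)
  without-other a zero    (suc j) j≢i = refl
  without-other a (suc i) zero    j≢i = refl
  without-other a (suc i) (suc j) j≢i = without-other (a ∘ suc) i j (j≢i ∘ cong suc)

  module Cells {m : ℕ} (c : Fin m → Bool) where

    area : (Fin m → Fin m → Bool) → ℚ
    area A = sum λ u → χ (c u) * degree (A u)

    erase : Fin m → Fin m → (Fin m → Fin m → Bool) → Fin m → Fin m → Bool
    erase u₀ w₀ A u with u Finₚ.≟ u₀
    ... | yes _ = without (A u) w₀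
    ... | no _  = A u

    erase-row : ∀ u₀ w₀ A → erase u₀ w₀ A u₀ ≡ without (A u₀) w₀
    erase-row u₀ w₀ A with u₀ Finₚ.≟ u₀
    ... | yes _ = refl
    ... | no ne = ⊥-elim (ne refl)

    erase-other-row : ∀ u₀ w₀ A u → u ≢ u₀ → erase u₀ w₀ A u ≡ A u
    erase-other-row u₀ w₀ A u ne with u Finₚ.≟ u₀
    ... | yes e = ⊥-elim (ne e)
    ... | no _  = refl

    erase-other : ∀ u₀ w₀ A u w → (u₀ , w₀) ≢ (u , w) → A u w ≡ true → erase u₀ w₀ A u w ≡ true
    erase-other u₀ w₀ A u w ne e with u Finₚ.≟ u₀
    ... | no _     = e
    ... | yes refl = trans (without-other (A u) w₀ w λ { refl → ne refl }) e

    area-erase : ∀ u₀ w₀ A → c u₀ ≡ true → A u₀ w₀ ≡ true → area A ≡ 1ℚ + area (erase u₀ w₀ A)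
    area-erase u₀ w₀ A cu e = sum-bump (λ u → χ (c u) * degree (A u)) (λ u → χ (c u) * degree (erase u₀ w₀ A u)) u₀
      at-row (λ u ne → cong (λ r → χ (c u) * degree r) (sym (erase-other-row u₀ w₀ A u ne)))
      where
      at-row : χ (c u₀) * degree (A u₀) ≡ 1ℚ + χ (c u₀) * degree (erase u₀ w₀ A u₀)
      at-row rewrite cu | erase-row u₀ w₀ A = trans (ℚₚ.*-identityˡ (degree (A u₀)))
        (trans (degree-without (A u₀) w₀ e) (cong (1ℚ +_) (sym (ℚₚ.*-identityˡ (degree (without (A u₀) w₀))))))

    -- Erasing the first cell lowers the area by one, and by uniqueness the remaining cells of the
    -- list stay true.
    length≤area : ∀ (L : List (Fin m × Fin m)) A → Unique L → All (λ (u , w) → A u w ≡ true × c u ≡ true) L → ι (length L) ≤ area A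
    length≤area []            A U all = 0≤sum λ u → 0≤* (0≤χ (c u)) (0≤degree (A u))
    length≤area ((u , w) ∷ L) A (new ∷ U) ((e , cu) ∷ all) = subst (ι (suc (length L)) ≤_) (sym (area-erase u w A cu e))
      (ℚₚ.+-monoʳ-≤ 1ℚ (length≤area L (erase u w A) U
        (All.zipWith (λ { (ne , e′ , c′) → erase-other u w A _ _ ne e′ , c′ }) (new , all))))

  -- What the spectral condition says about the missing pairs of one graph

  module SingleGraph {m : ℕ} (a : ℕ) (side : Fin m → Bool)
    (class-size : ∀ σ → degree (is σ ∘ side) ≡ ι (suc a))
    (G : Graph m) (bipartite : ∀ u v → Adj G u v → side v ≡ not (side u))
    where

    open Rows side (adj G) bipartite

    -- The set M of missing pairs as a symmetric relation; `MissingCells σ` lists each pair only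
    -- once, starting from its end on the side σ.
    missing : Fin m → Fin m → Bool
    missing u v = is (not (side u)) (side v) ∧ not (adj G u v)

    missing-opp : ∀ u v → missing u v ≡ true → side v ≡ not (side u)
    missing-opp u v e = is-sound (not (side u)) (side v) (Boolₚ.∧-conicalˡ (is (not (side u)) (side v)) (not (adj G u v)) e)

    missing⇒¬adj : ∀ u v → missing u v ≡ true → adj G u v ≡ false
    missing⇒¬adj u v e = trans (sym (Boolₚ.not-involutive (adj G u v))) (cong not (Boolₚ.∧-conicalʳ (is (not (side u)) (side v)) (not (adj G u v)) e))

    ¬adj⇒missing : ∀ u v → side v ≡ not (side u) → adj G u v ≡ false → missing u v ≡ true
    ¬adj⇒missing u v o e = cong₂ _∧_ (is-refl o) (cong not e)

    ¬missing⇒adj : ∀ u v → side v ≡ not (side u) → missing u v ≡ false → adj G u v ≡ true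
    ¬missing⇒adj u v o e = Boolₚ.¬-not λ eq → Boolₚ.not-¬ (¬adj⇒missing u v o eq) e

    missing-sym : ∀ u v → missing u v ≡ missing v u
    missing-sym u v = cong₂ _∧_ (opposite (side u) (side v)) (cong not (symmetric G u v))
      where
      opposite : ∀ x y → is (not x) y ≡ is (not y) x
      opposite true  true  = refl
      opposite true  false = refl
      opposite false true  = refl
      opposite false false = refl

    -- Equivalently, x is an isolated vertex of G.
    StarAt : Fin m → Set
    StarAt x = ∀ v → side v ≡ not (side x) → missing x v ≡ true

    MissingCells : Bool → List (Fin m × Fin m) → Set
    MissingCells σ L = Unique L × All (λ (u , v) → missing u v ≡ true × side u ≡ σ) L

    transpose : ∀ {σ L} → MissingCells σ L → MissingCells (not σ) (map Product.swap L)
    transpose (U , all) = Uniqueₚ.map⁺ (λ { refl → refl }) U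
      , Allₚ.map⁺ (All.map (λ { {u , v} (e , refl) → trans (missing-sym v u) e , missing-opp u v e }) all)

    -- In every row of the side σ the degree and the number of missing pairs add up to n = a + 1,
    -- which over the n rows makes n².
    volume+length : ∀ σ L → MissingCells σ L → volume σ + ι (length L) ≤ ι (suc a ℕ.* suc a)
    volume+length σ L (U , all) = ℚₚ.≤-trans
      (ℚₚ.+-monoʳ-≤ (volume σ) (Cells.length≤area (members σ) L missing U
        (All.map (λ (e , s) → e , is-refl s) all)))
      (ℚₚ.≤-reflexive total)
      where
      row : ∀ u → χ (members σ u) * degree (adj G u) + χ (members σ u) * degree (missing u) ≡ χ (members σ u) * ι (suc a)
      row u with members σ u in eq
      ... | false = solve 3 (λ x y z → con 0ℚ :* x :+ con 0ℚ :* y := con 0ℚ :* z) refl (degree (adj G u)) (degree (missing u)) (ι (suc a))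
      ... | true  = trans (sym (ℚₚ.*-distribˡ-+ 1ℚ (degree (adj G u)) (degree (missing u)))) (cong (1ℚ *_)
        (trans (sym (∑-distrib-+ (χ ∘ adj G u) (χ ∘ missing u))) (trans (sum-cong-≗ cell) (class-size (not (side u))))))
        where
        cell : ∀ w → χ (adj G u w) + χ (missing u w) ≡ χ (members (not (side u)) w)
        cell w with adj G u w in e
        ... | true  rewrite is-refl (bipartite u w e) = refl
        ... | false rewrite Boolₚ.∧-identityʳ (is (not (side u)) (side w)) = ℚₚ.+-identityˡ _
      total : volume σ + sum (λ u → χ (members σ u) * degree (missing u)) ≡ ι (suc a ℕ.* suc a)
      total = trans (sym (∑-distrib-+ (λ u → χ (members σ u) * degree (adj G u)) (λ u → χ (members σ u) * degree (missing u))))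
        (trans (sum-cong-≗ row) (trans (sym (*-distribʳ-sum (ι (suc a)) (χ ∘ members σ)))
          (trans (cong (_* ι (suc a)) (class-size σ)) (sym (×1-homo-* (suc a) (suc a))))))

    -- Since (a + 1)² - (a + 1) = a(a + 1), n + c missing pairs leave at most N - c edges. The case
    -- c = 1 serves `few-missing`, the case c = 0 `all-missing`.
    volume-bound : ∀ σ L c → MissingCells σ L → suc a ℕ.+ c ℕ.≤ length L → volume σ + ι c ≤ ι (a ℕ.* suc a)
    volume-bound σ L c cells le = ≤-by
      (((s + N) - (volume σ + ι (length L))) + (ι (length L) - (s + ι c)))
      (0≤+ (≤⇒0≤- (subst (volume σ + ι (length L) ≤_) (×-homo-+ 1ℚ (suc a) (a ℕ.* suc a)) (volume+length σ L cells)))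
           (≤⇒0≤- (subst (_≤ ι (length L)) (×-homo-+ 1ℚ (suc a) c) (ι-mono le))))
      (solve 5 (λ N s v c l → N := (v :+ c) :+ (((s :+ N) :- (v :+ l)) :+ (l :- (s :+ c)))) refl
        N s (volume σ) (ι c) (ι (length L)))
      where
      s N : ℚ
      s = ι (suc a)
      N = ι (a ℕ.* suc a)

    StarAt? : ∀ x → Dec (StarAt x)
    StarAt? x = Finₚ.all? λ v → (side v Boolₚ.≟ not (side x)) →-dec (missing x v Boolₚ.≟ true)

    ¬StarAt⇒neighbour : ∀ x → ¬ StarAt x → Σ[ v ∈ Fin m ] adj G x v ≡ true
    ¬StarAt⇒neighbour x ¬star = found (Finₚ.¬∀⟶∃¬ m _ (λ v → (side v Boolₚ.≟ not (side x)) →-dec (missing x v Boolₚ.≟ true)) ¬star)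
      where
      found : Σ[ v ∈ Fin m ] ¬ (side v ≡ not (side x) → missing x v ≡ true) → Σ[ v ∈ Fin m ] adj G x v ≡ true
      found (v , ¬p) = v , neighbour (side v Boolₚ.≟ not (side x))
        where
        neighbour : Dec (side v ≡ not (side x)) → adj G x v ≡ true
        neighbour (no ¬o) = ⊥-elim (¬p (⊥-elim ∘ ¬o))
        neighbour (yes o) = ¬missing⇒adj x v o (Boolₚ.¬-not (λ e → ¬p λ _ → e))

    0<κ : Fin m → 0ℚ < κ
    0<κ u = positive-κ m u
      where
      positive-κ : ∀ m → Fin m → 0ℚ < ι (m ℕ.+ m)
      positive-κ (suc m) _ = ℚₚ.<-≤-trans (ℚₚ.positive⁻¹ 1ℚ) (1≤ι (m ℕ.+ suc m))

    0<Λ : Fin m → 0ℚ < Λ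
    0<Λ u = ℚₚ.<-≤-trans (ℚₚ.<-≤-trans (0<κ u) (≤-by (1ℚ + (1ℚ + κ)) (0≤+ 0≤1 (0≤+ 0≤1 (ℚₚ.<⇒≤ (0<κ u)))) refl))
      (ℚₚ.≤-reflexive (solve 1 (λ k → k :+ (con 1ℚ :+ (con 1ℚ :+ k)) := con 2ℚ :* (con 1ℚ :+ k)) refl κ))

    -- Transposing the pairs changes the side from which they are counted, so one list bounds both
    -- volumes.
    volumes-bound : ∀ σ L c → MissingCells σ L → suc a ℕ.+ c ℕ.≤ length L → ∀ τ → volume τ + ι c ≤ ι (a ℕ.* suc a)
    volumes-bound σ L c cells le τ = by-cases (τ Boolₚ.≟ σ)
      where
      by-cases : Dec (τ ≡ σ) → volume τ + ι c ≤ ι (a ℕ.* suc a)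
      by-cases (yes refl) = volume-bound σ L c cells le
      by-cases (no τ≢σ)   = subst (λ τ → volume τ + ι c ≤ ι (a ℕ.* suc a)) (sym (Boolₚ.¬-not τ≢σ))
        (volume-bound (not σ) (map Product.swap L) c (transpose cells)
          (subst (suc a ℕ.+ c ℕ.≤_) (sym (Listₚ.length-map Product.swap L)) le))

    module _ (ρ : ℝ) (spectral : IsSpectralRadius G ρ)
      (large : ∀ δ → 0ℚ < δ → Eventually λ n → ι (a ℕ.* suc a) ≤ seq ρ n * seq ρ n + δ) where

      -- With more than n missing pairs the edge count is at most N - 1, and `small-volume`
      -- contradicts the size of ρ.
      few-missing : ∀ σ L → MissingCells σ L → length L ℕ.≤ suc a
      few-missing σ L cells = ℕₚ.≮⇒≥ λ lt → no-large-radius G 1ℚ (ι (a ℕ.* suc a)) (ℚₚ.positive⁻¹ 1ℚ)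
        (small-volume (ι (a ℕ.* suc a)) λ τ → subst (λ c → volume τ + c ≤ ι (a ℕ.* suc a)) ι-1
          (volumes-bound σ L 1 cells (subst (ℕ._≤ length L) (ℕₚ.+-comm 1 (suc a)) lt) τ))
        ρ spectral large

      -- If neither end of a missing pair is isolated, a neighbour of each completes the
      -- configuration of `unbalanced`, which with at most N edges contradicts the size of ρ.
      all-missing : ∀ σ L → MissingCells σ L → length L ≡ suc a →
        ∀ u v → missing u v ≡ true → StarAt u ⊎ StarAt v
      all-missing σ L cells len u v e = by-cases (StarAt? u) (StarAt? v)
        where
        by-cases : Dec (StarAt u) → Dec (StarAt v) → StarAt u ⊎ StarAt v
        by-cases (yes star) _          = inj₁ star
        by-cases (no _)     (yes star) = inj₂ star
        by-cases (no ¬su)   (no ¬sv)   = ⊥-elim (no-large-radius G Λ (ι (a ℕ.* suc a)) (0<Λ u)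
          (unbalanced (ι (a ℕ.* suc a))
            (λ τ → subst (_≤ ι (a ℕ.* suc a)) (trans (cong (volume τ +_) ι-0) (ℚₚ.+-identityʳ (volume τ)))
              (volumes-bound σ L 0 cells (ℕₚ.≤-reflexive (trans (ℕₚ.+-identityʳ (suc a)) (sym len))) τ))
            (symmetric G) (positive (0<κ u)) u v (proj₁ nv) (proj₁ nu) (missing-opp u v e) (missing⇒¬adj u v e)
            (proj₂ nu) (trans (symmetric G (proj₁ nv) v) (proj₂ nv)))
          ρ spectral large)
          where
          nu = ¬StarAt⇒neighbour u ¬su
          nv = ¬StarAt⇒neighbour v ¬sv

open Spectral

-- From sequences of vertices and colours to a rainbow Hamilton path

module PathGraph {L k : ℕ} (p : Fin (suc L) ↔ Fin (suc L)) (c : Fin L ↔ Fin k)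
  (G : Fin k → Graph (suc L))
  (good : ∀ j → Adj (G (Inverse.to c j)) (Inverse.to p (inject₁ j)) (Inverse.to p (suc j)))
  where

  at = Inverse.to p
  pos = Inverse.from p

  Next : Fin (suc L) → Fin (suc L) → Set
  Next i j = toℕ j ≡ suc (toℕ i)

  Consecutive : Fin (suc L) → Fin (suc L) → Set
  Consecutive i j = Next i j ⊎ Next j i

  consecutive? : ∀ i j → Dec (Consecutive i j)
  consecutive? i j = (toℕ j ℕₚ.≟ suc (toℕ i)) ⊎-dec (toℕ i ℕₚ.≟ suc (toℕ j))

  from-does : ∀ {A : Set} (d : Dec A) → does d ≡ true → A
  from-does (yes a) _ = a

  does-sym : ∀ i j → does (consecutive? i j) ≡ does (consecutive? j i)
  does-sym i j = does-⇔ (mk⇔ Sum.swap Sum.swap) (consecutive? i j) (consecutive? j i)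

  ¬self : ∀ i → ¬ Consecutive i i
  ¬self i (inj₁ e) = ℕₚ.1+n≢n (sym e)
  ¬self i (inj₂ e) = ℕₚ.1+n≢n (sym e)

  H : Graph (suc L)
  H = record
    { adj       = λ u v → does (consecutive? (pos u) (pos v))
    ; symmetric = λ u v → does-sym (pos u) (pos v)
    ; loopless  = λ v → dec-false (consecutive? (pos v) (pos v)) (¬self (pos v))
    }

  pos-at : ∀ i → pos (at i) ≡ i
  pos-at = Inverse.strictlyInverseʳ p

  at-pos : ∀ v → at (pos v) ≡ v
  at-pos = Inverse.strictlyInverseˡ p

  H-path : IsHamiltonPath H
  H-path = ↔⇒⤖ p , λ i j → mk⇔
    (λ a → subst₂ Consecutive (pos-at i) (pos-at j) (from-does (consecutive? _ _) a))
    (λ a → dec-true (consecutive? _ _) (subst₂ Consecutive (sym (pos-at i)) (sym (pos-at j)) a))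

  next⇒ : ∀ i j → Next i j → Σ[ l ∈ Fin L ] (i ≡ inject₁ l × j ≡ suc l)
  next⇒ i (suc l) e = l , Finₚ.toℕ-injective (trans (sym (ℕₚ.suc-injective e)) (sym (Finₚ.toℕ-inject₁ l))) , refl

  next-step : ∀ l → Next (inject₁ l) (suc l)
  next-step l = cong suc (sym (Finₚ.toℕ-inject₁ l))

  -- `Edge` puts the smaller endpoint first, so the path may traverse an edge in either direction.
  Joins : Fin L → Fin (suc L) → Fin (suc L) → Set
  Joins l u v = (u ≡ at (inject₁ l) × v ≡ at (suc l)) ⊎ (v ≡ at (inject₁ l) × u ≡ at (suc l))

  locate : ∀ u v → Adj H u v → Σ[ l ∈ Fin L ] Joins l u v
  locate u v a with from-does (consecutive? (pos u) (pos v)) a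
  ... | inj₁ e with next⇒ _ _ e
  ...   | l , eu , ev = l , inj₁ (trans (sym (at-pos u)) (cong at eu) , trans (sym (at-pos v)) (cong at ev))
  locate u v a | inj₂ e with next⇒ _ _ e
  ...   | l , ev , eu = l , inj₂ (trans (sym (at-pos v)) (cong at ev) , trans (sym (at-pos u)) (cong at eu))

  joins-adj : ∀ l u v → Joins l u v → Adj H u v
  joins-adj l u v (inj₁ (refl , refl)) = dec-true (consecutive? _ _)
    (inj₁ (subst₂ Next (sym (pos-at _)) (sym (pos-at _)) (next-step l)))
  joins-adj l u v (inj₂ (refl , refl)) = dec-true (consecutive? _ _)
    (inj₂ (subst₂ Next (sym (pos-at _)) (sym (pos-at _)) (next-step l)))

  at-injective : ∀ {i j} → at i ≡ at j → i ≡ j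
  at-injective {i} {j} e = trans (sym (pos-at i)) (trans (cong pos e) (pos-at j))

  crossed : ∀ (l l′ : Fin L) → inject₁ l ≡ suc l′ → inject₁ l′ ≡ suc l → ⊥
  crossed l l′ e e′ = ℕₚ.<-asym
    (ℕₚ.≤-reflexive (sym (trans (sym (Finₚ.toℕ-inject₁ l)) (cong toℕ e))))
    (ℕₚ.≤-reflexive (sym (trans (sym (Finₚ.toℕ-inject₁ l′)) (cong toℕ e′))))

  joins-unique : ∀ l l′ u v → Joins l u v → Joins l′ u v → l ≡ l′
  joins-unique l l′ u v (inj₁ (_ , e)) (inj₁ (_ , e′)) = Finₚ.suc-injective (at-injective (trans (sym e) e′))
  joins-unique l l′ u v (inj₂ (_ , e)) (inj₂ (_ , e′)) = Finₚ.suc-injective (at-injective (trans (sym e) e′))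
  joins-unique l l′ u v (inj₁ (eu , ev)) (inj₂ (ev′ , eu′)) =
    ⊥-elim (crossed l l′ (at-injective (trans (sym eu) eu′)) (at-injective (trans (sym ev′) ev)))
  joins-unique l l′ u v (inj₂ (ev , eu)) (inj₁ (eu′ , ev′)) =
    ⊥-elim (crossed l l′ (at-injective (trans (sym ev) ev′)) (at-injective (trans (sym eu′) eu)))

  edge-≡ : ∀ {u v u′ v′ : Fin (suc L)} {x : u Fin.< v × Adj H u v} {y : u′ Fin.< v′ × Adj H u′ v′} →
    u ≡ u′ → v ≡ v′ → _≡_ {A = Edge H} (u , v , x) (u′ , v′ , y)
  edge-≡ {x = x , a} {y = y , b} refl refl =
    cong₂ (λ s t → _ , _ , s , t) (Finₚ.<-irrelevant x y) (Decidable⇒UIP.≡-irrelevant Boolₚ._≟_ a b)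

  edge-of : Fin L → Edge H
  edge-of l with Finₚ.<-cmp (at (inject₁ l)) (at (suc l))
  ... | tri< lt _ _ = _ , _ , lt , joins-adj l _ _ (inj₁ (refl , refl))
  ... | tri> _ _ gt = _ , _ , gt , joins-adj l _ _ (inj₂ (refl , refl))
  ... | tri≈ _ eq _ = ⊥-elim (ℕₚ.1+n≢n (sym (trans (sym (Finₚ.toℕ-inject₁ l)) (cong toℕ (at-injective eq)))))

  edge-of-joins : ∀ l → Joins l (proj₁ (edge-of l)) (proj₁ (proj₂ (edge-of l)))
  edge-of-joins l with Finₚ.<-cmp (at (inject₁ l)) (at (suc l))
  ... | tri< lt _ _ = inj₁ (refl , refl)
  ... | tri> _ _ gt = inj₂ (refl , refl)
  ... | tri≈ _ eq _ = ⊥-elim (ℕₚ.1+n≢n (sym (trans (sym (Finₚ.toℕ-inject₁ l)) (cong toℕ (at-injective eq)))))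

  joins-edge : ∀ l {u v u′ v′} (x : u Fin.< v × Adj H u v) (y : u′ Fin.< v′ × Adj H u′ v′) →
    Joins l u v → Joins l u′ v′ → _≡_ {A = Edge H} (u , v , x) (u′ , v′ , y)
  joins-edge l x y (inj₁ (refl , refl)) (inj₁ (refl , refl)) = edge-≡ refl refl
  joins-edge l x y (inj₂ (refl , refl)) (inj₂ (refl , refl)) = edge-≡ refl refl
  joins-edge l (x , _) (y , _) (inj₁ (refl , refl)) (inj₂ (refl , refl)) = ⊥-elim (Finₚ.<-asym x y)
  joins-edge l (x , _) (y , _) (inj₂ (refl , refl)) (inj₁ (refl , refl)) = ⊥-elim (Finₚ.<-asym x y)

  index : Edge H → Fin L
  index (u , v , _ , a) = proj₁ (locate u v a)

  index-joins : ∀ e → Joins (index e) (proj₁ e) (proj₁ (proj₂ e))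
  index-joins (u , v , _ , a) = proj₂ (locate u v a)

  edges : Edge H ↔ Fin L
  edges = mk↔ₛ′ index edge-of
    (λ l → joins-unique (index (edge-of l)) l (proj₁ (edge-of l)) (proj₁ (proj₂ (edge-of l)))
             (index-joins (edge-of l)) (edge-of-joins l))
    (λ e → joins-edge (index e) (proj₂ (proj₂ (edge-of (index e)))) (proj₂ (proj₂ e))
             (edge-of-joins (index e)) (index-joins e))

  good′ : ∀ l u v → Joins l u v → Adj (G (Inverse.to c l)) u v
  good′ l u v (inj₁ (refl , refl)) = good l
  good′ l u v (inj₂ (refl , refl)) = trans (symmetric (G (Inverse.to c l)) _ _) (good l)

  rainbow-path : HasRainbowHamiltonPath G
  rainbow-path = H , H-path , ↔⇒⤖ (↔-trans edges c) ,
    λ e → good′ (index e) (proj₁ e) (proj₁ (proj₂ e)) (index-joins e)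

-- The number of steps is computed from a walk, so its successor agrees with m only up to a proof;
-- with m still a variable that proof can be matched away.
path⇒rainbow : ∀ {m k L} → suc L ≡ m → (p : Fin (suc L) ↔ Fin m) (c : Fin L ↔ Fin k) (G : Fin k → Graph m) →
  (∀ j → Adj (G (Inverse.to c j)) (Inverse.to p (inject₁ j)) (Inverse.to p (suc j))) →
  HasRainbowHamiltonPath G
path⇒rainbow refl p c G good = PathGraph.rainbow-path p c G good

open import Data.Nat using (_+_; _*_; _∸_; _≤_; _<_; s≤s; z≤n)

Unique-resp-↭ : ∀ {A : Set} {xs ys : List A} → xs ↭ ys → Unique xs → Unique ys
Unique-resp-↭ {A} p = Permₛ.Unique-resp-↭ (setoid A) (↭⇒↭ₛ p)

not-flip : ∀ {a b} → b ≡ not a → a ≡ not b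
not-flip {a} refl = sym (Boolₚ.not-involutive a)

bit : Bool → ℕ
bit true  = 1
bit false = 0

-- Side-alternating walks with coloured steps

module Walks {m : ℕ} (C : Set) (side : Fin m → Bool) where

  V : Set
  V = Fin m

  Opp : V → V → Set
  Opp u v = side v ≡ not (side u)

  data Walk : V → V → Set where
    ε    : ∀ {u} → Walk u u
    step : ∀ {u v w} (c : C) → Opp u v → Walk v w → Walk u w

  infixr 5 _⊙_

  _⊙_ : ∀ {u v w} → Walk u v → Walk v w → Walk u w
  ε          ⊙ b = b
  step c p a ⊙ b = step c p (a ⊙ b)

  ⊙-assoc : ∀ {u v w x} (a : Walk u v) (b : Walk v w) (d : Walk w x) → (a ⊙ b) ⊙ d ≡ a ⊙ (b ⊙ d)
  ⊙-assoc ε            b d = refl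
  ⊙-assoc (step c p a) b d = cong (step c p) (⊙-assoc a b d)

  -- A 2-opt move keeps one arc of the cycle and traverses the other backwards; this is the reversal
  -- of the latter, with the former as accumulator.
  revOnto : ∀ {u v w} → Walk u v → Walk u w → Walk v w
  revOnto ε            b = b
  revOnto (step c p a) b = revOnto a (step c (not-flip p) b)

  -- `ends` omits the start of the walk and is thereby additive under `⊙`; the vertex where two
  -- walks meet is counted once.
  ends verts : ∀ {u v} → Walk u v → List V
  ends ε                = []
  ends (step {v = v} c p w) = v ∷ ends w
  verts {u} w = u ∷ ends w

  cols : ∀ {u v} → Walk u v → List C
  cols ε            = []
  cols (step c p w) = c ∷ cols w

  total : (C → V → V → ℕ) → ∀ {u v} → Walk u v → ℕ
  total g ε                        = 0
  total g (step {u} {v} c p w) = g c u v + total g w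

  ends-⊙ : ∀ {u v w} (a : Walk u v) (b : Walk v w) → ends (a ⊙ b) ≡ ends a ++ ends b
  ends-⊙ ε            b = refl
  ends-⊙ (step c p a) b = cong (_ ∷_) (ends-⊙ a b)

  cols-⊙ : ∀ {u v w} (a : Walk u v) (b : Walk v w) → cols (a ⊙ b) ≡ cols a ++ cols b
  cols-⊙ ε            b = refl
  cols-⊙ (step c p a) b = cong (_ ∷_) (cols-⊙ a b)

  total-⊙ : ∀ g {u v w} (a : Walk u v) (b : Walk v w) → total g (a ⊙ b) ≡ total g a + total g b
  total-⊙ g ε            b = refl
  total-⊙ g (step {u} {v} c p a) b =
    trans (cong (g c u v +_) (total-⊙ g a b)) (sym (ℕₚ.+-assoc (g c u v) (total g a) (total g b)))

  verts-revOnto : ∀ {u v w} (a : Walk u v) (b : Walk u w) → verts (revOnto a b) ↭ ends a ++ verts b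
  verts-revOnto ε            b = ↭-refl
  verts-revOnto (step c p a) b =
    ↭-trans (verts-revOnto a (step c (not-flip p) b)) (shift _ (ends a) (verts b))

  cols-revOnto : ∀ {u v w} (a : Walk u v) (b : Walk u w) → cols (revOnto a b) ↭ cols a ++ cols b
  cols-revOnto ε            b = ↭-refl
  cols-revOnto (step c p a) b =
    ↭-trans (cols-revOnto a (step c (not-flip p) b)) (shift c (cols a) (cols b))

  -- Two weights, because reversing a whole walk also exchanges its ends, which turns
  -- `blockedAt s t` into `blockedAt t s`.
  total-revOnto : ∀ (g h : C → V → V → ℕ) → (∀ c u v → h c v u ≡ g c u v) →
    ∀ {u v w} (a : Walk u v) (b : Walk u w) → total h (revOnto a b) ≡ total g a + total h b
  total-revOnto g h gh ε            b = refl
  total-revOnto g h gh (step {u} {v} c p a) b = begin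
    total h (revOnto a (step c _ b))  ≡⟨ total-revOnto g h gh a _ ⟩
    total g a + (h c v u + total h b) ≡⟨ cong (λ x → total g a + (x + total h b)) (gh c u v) ⟩
    total g a + (g c u v + total h b) ≡⟨ solve 3 (λ x y z → x :+ (y :+ z) := (y :+ x) :+ z) refl (total g a) (g c u v) (total h b) ⟩
    (g c u v + total g a) + total h b ∎
    where
    open ≡-Reasoning
    open ℕSolver.+-*-Solver using (solve; _:+_; _:=_)

  data Has (x : V) (c : C) (y : V) : ∀ {u w} → Walk u w → Set where
    here  : ∀ {w p} {a : Walk y w} → Has x c y (step {x} c p a)
    there : ∀ {u v w d p} {a : Walk v w} → Has x c y a → Has x c y (step {u} {v} d p a)

  has-⊙ʳ : ∀ {x c y u v w} (a : Walk u v) {b : Walk v w} → Has x c y b → Has x c y (a ⊙ b)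
  has-⊙ʳ ε            h = h
  has-⊙ʳ (step c p a) h = there (has-⊙ʳ a h)

  has-opp : ∀ {x c y u w} {a : Walk u w} → Has x c y a → Opp x y
  has-opp (here {p = p}) = p
  has-opp (there h)      = has-opp h

  has-start : ∀ {x c y u w} {a : Walk u w} → Has x c y a → x ∈ verts a
  has-start here      = here refl
  has-start (there h) = there (has-start h)

  has-end : ∀ {x c y u w} {a : Walk u w} → Has x c y a → y ∈ ends a
  has-end here      = here refl
  has-end (there h) = there (has-end h)

  last∈ : ∀ {u w} (a : Walk u w) → w ∈ verts a
  last∈ ε            = here refl
  last∈ (step c p a) = there (last∈ a)

  has-nonempty : ∀ {x c y u w} {a : Walk u w} → Has x c y a → w ∈ ends a
  has-nonempty {a = step c p a} h = last∈ a

  uniq-tail : ∀ {x : V} {xs} → Unique (x ∷ xs) → Unique xs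
  uniq-tail (_ ∷ u) = u

  uniq-head : ∀ {x : V} {xs} → Unique (x ∷ xs) → x ∉ xs
  uniq-head = Uniqueₚ.Unique[x∷xs]⇒x∉xs

  has-start≢last : ∀ {x c y u w} {a : Walk u w} → Unique (verts a) → Has x c y a → x ≢ w
  has-start≢last {a = step c p a} U here refl = uniq-head U (last∈ a)
  has-start≢last U (there h) = has-start≢last (uniq-tail U) h

  has-functional : ∀ {x c d y z u w} {a : Walk u w} → Unique (verts a) →
    Has x c y a → Has x d z a → (c ≡ d) × (y ≡ z)
  has-functional U here      here      = refl , refl
  has-functional U here      (there k) = ⊥-elim (uniq-head U (has-start k))
  has-functional U (there h) here      = ⊥-elim (uniq-head U (has-start h))
  has-functional U (there h) (there k) = has-functional (uniq-tail U) h k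

  has-injective : ∀ {x x′ c d y u w} {a : Walk u w} → Unique (verts a) →
    Has x c y a → Has x′ d y a → x ≡ x′
  has-injective U here      here      = refl
  has-injective U here      (there k) = ⊥-elim (uniq-head (uniq-tail U) (has-end k))
  has-injective U (there h) here      = ⊥-elim (uniq-head (uniq-tail U) (has-end h))
  has-injective U (there h) (there k) = has-injective (uniq-tail U) h k

  -- A view: matching on it replaces the walk by its decomposition at a step, the form on which the
  -- moves operate.
  data Split (c : C) : ∀ {s t} → Walk s t → Set where
    split : ∀ {s u v t} (a : Walk s u) (p : Opp u v) (b : Walk v t) → Split c (a ⊙ step c p b)

  find-colour : ∀ {c s t} (w : Walk s t) → c ∈ cols w → Split c w
  find-colour (step c p w) (here refl) = split ε p w
  find-colour (step c p w) (there c∈) with find-colour w c∈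
  ... | split a q b = split (step c p a) q b

  data SplitBad (bad : C → V → V → Bool) : ∀ {s t} → Walk s t → Set where
    splitBad : ∀ {s u v t} (c : C) (a : Walk s u) (p : Opp u v) (b : Walk v t) →
               bad c u v ≡ true → SplitBad bad (a ⊙ step c p b)

  find-bad : ∀ bad {s t} (w : Walk s t) → total (λ c u v → bit (bad c u v)) w ≢ 0 → SplitBad bad w
  find-bad bad ε ne = ⊥-elim (ne refl)
  find-bad bad (step {u} {v} c p w) ne with bad c u v in eq
  ... | true  = splitBad c ε p w eq
  ... | false with find-bad bad w ne
  ...   | splitBad d a q b e = splitBad d (step c p a) q b e

  steps : ∀ {s t} → Walk s t → ℕ
  steps ε            = 0
  steps (step c p w) = suc (steps w)

  steps-verts : ∀ {s t} (w : Walk s t) → length (verts w) ≡ suc (steps w)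
  steps-verts ε            = refl
  steps-verts (step c p w) = cong suc (steps-verts w)

  vertexAt : ∀ {s t} (w : Walk s t) → Fin (suc (steps w)) → V
  vertexAt {s} w        zero    = s
  vertexAt (step c p w) (suc i) = vertexAt w i

  colourAt : ∀ {s t} (w : Walk s t) → Fin (steps w) → C
  colourAt (step c p w) zero    = c
  colourAt (step c p w) (suc i) = colourAt w i

  has-at : ∀ {s t} (w : Walk s t) (i : Fin (steps w)) →
    Has (vertexAt w (inject₁ i)) (colourAt w i) (vertexAt w (suc i)) w
  has-at (step c p w) zero    = here
  has-at (step c p w) (suc i) = there (has-at w i)

  vertexAt∈ : ∀ {s t} (w : Walk s t) i → vertexAt w i ∈ verts w
  vertexAt∈ w            zero    = here refl
  vertexAt∈ (step c p w) (suc i) = there (vertexAt∈ w i)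

  colourAt∈ : ∀ {s t} (w : Walk s t) i → colourAt w i ∈ cols w
  colourAt∈ (step c p w) zero    = here refl
  colourAt∈ (step c p w) (suc i) = there (colourAt∈ w i)

  vertexAt-surjective : ∀ {s t} (w : Walk s t) {x} → x ∈ verts w → ∃ λ i → vertexAt w i ≡ x
  vertexAt-surjective w            (here refl) = zero , refl
  vertexAt-surjective (step c p w) (there x∈)  with vertexAt-surjective w x∈
  ... | i , e = suc i , e

  colourAt-surjective : ∀ {s t} (w : Walk s t) {c} → c ∈ cols w → ∃ λ i → colourAt w i ≡ c
  colourAt-surjective (step c p w) (here refl) = zero , refl
  colourAt-surjective (step c p w) (there c∈)  with colourAt-surjective w c∈
  ... | i , e = suc i , e

  vertexAt-injective : ∀ {s t} (w : Walk s t) → Unique (verts w) →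
    ∀ i j → vertexAt w i ≡ vertexAt w j → i ≡ j
  vertexAt-injective w            U zero    zero    e = refl
  vertexAt-injective (step c p w) U zero    (suc j) e = ⊥-elim (uniq-head U (subst (_∈ verts w) (sym e) (vertexAt∈ w j)))
  vertexAt-injective (step c p w) U (suc i) zero    e = ⊥-elim (uniq-head U (subst (_∈ verts w) e (vertexAt∈ w i)))
  vertexAt-injective (step c p w) U (suc i) (suc j) e = cong suc (vertexAt-injective w (uniq-tail U) i j e)

  colourAt-injective : ∀ {s t} (w : Walk s t) → Unique (cols w) →
    ∀ i j → colourAt w i ≡ colourAt w j → i ≡ j
  colourAt-injective (step c p w) U zero    zero    e = refl
  colourAt-injective (step c p w) U zero    (suc j) e =
    ⊥-elim (Uniqueₚ.Unique[x∷xs]⇒x∉xs U (subst (_∈ cols w) (sym e) (colourAt∈ w j)))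
  colourAt-injective (step c p w) U (suc i) zero    e =
    ⊥-elim (Uniqueₚ.Unique[x∷xs]⇒x∉xs U (subst (_∈ cols w) e (colourAt∈ w i)))
  colourAt-injective (step c p w) (_ ∷ U) (suc i) (suc j) e = cong suc (colourAt-injective w U i j e)

  total-zero : ∀ g {x c y s t} {w : Walk s t} → Has x c y w → total g w ≡ 0 → g c x y ≡ 0
  total-zero g {w = step c p w} here      z = ℕₚ.m+n≡0⇒m≡0 (g c _ _) z
  total-zero g {w = step c p w} (there h) z = total-zero g h (ℕₚ.m+n≡0⇒n≡0 (g c _ _) z)

true≢false : ∀ {b} → b ≡ true → b ≡ false → ⊥
true≢false refl ()

not-≡-cancel : ∀ {a b c} → a ≡ not b → c ≡ not a → c ≡ b
not-≡-cancel {b = b} refl refl = Boolₚ.not-involutive b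

double-injective : ∀ {a b} → a + a ≡ b + b → a ≡ b
double-injective {a} {b} eq with ℕₚ.<-cmp a b
... | tri< a<b _ _ = ⊥-elim (ℕₚ.<-irrefl eq (ℕₚ.+-mono-< a<b a<b))
... | tri≈ _ a≡b _ = a≡b
... | tri> _ _ b<a = ⊥-elim (ℕₚ.<-irrefl (sym eq) (ℕₚ.+-mono-< b<a b<a))

-- Coloured Hamilton cycles and the moves on them

module Rainbow {m k : ℕ} (n : ℕ) (side : Fin m → Bool)
  (miss : Fin k → Fin m → Fin m → Bool)
  (miss-sym : ∀ j u v → miss j u v ≡ miss j v u)
  (miss-opp : ∀ j u v → miss j u v ≡ true → side v ≡ not (side u))
  (m≡2n : m ≡ n + n) (m≡1+k : m ≡ suc k) (2≤n : 2 ≤ n)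
  (class : Bool → List (Fin m))
  (class-unique : ∀ σ → Unique (class σ))
  (class-side : ∀ σ → All (λ v → side v ≡ σ) (class σ))
  (class-length : ∀ σ → length (class σ) ≡ n)
  (classes : class true ++ class false ↭ allFin m)
  where

  -- nothing is the free colour; its edge is the one deleted to turn a Hamilton cycle into a path.
  Colour : Set
  Colour = Maybe (Fin k)

  open Walks Colour side public

  Cells : Fin k → Bool → List (V × V) → Set
  Cells j σ L = Unique L × All (λ (u , v) → miss j u v ≡ true × side u ≡ σ) L

  StarAt : V → Fin k → Set
  StarAt x j = ∀ v → Opp x v → miss j x v ≡ true

  bad : Colour → V → V → Bool
  bad nothing  _ _ = false
  bad (just j) u v = miss j u v

  bad-sym : ∀ c u v → bad c u v ≡ bad c v u
  bad-sym nothing  u v = refl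
  bad-sym (just j) u v = miss-sym j u v

  κ : Colour → V → V → ℕ
  κ c u v = bit (bad c u v)

  κ-sym : ∀ c u v → κ c u v ≡ κ c v u
  κ-sym c u v = cong bit (bad-sym c u v)

  -- Measures how many 2-opt moves are useless because both inserted edges are missing in the colour c.
  blockedAt : V → V → Colour → V → V → ℕ
  blockedAt s t c u v = bit (bad c u t ∧ bad c s v)

  blockedAt-sym : ∀ s t c u v → blockedAt t s c v u ≡ blockedAt s t c u v
  blockedAt-sym s t c u v = cong bit (trans (Boolₚ.∧-comm (bad c v s) (bad c t u))
    (cong₂ _∧_ (bad-sym c t u) (bad-sym c v s)))

  colours : List Colour
  colours = nothing ∷ map just (allFin k)

  -- The cycle consists of the walk and the closing edge t – s, which has colour i.
  record Closed {s t} (i : Colour) (w : Walk s t) : Set where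
    field
      opp : Opp s t
      vs  : verts w ↭ allFin m
      cs  : i ∷ cols w ↭ colours

    uniq : Unique (verts w)
    uniq = Unique-resp-↭ (↭-sym vs) (Uniqueₚ.allFin⁺ m)

  open Closed

  cost : ∀ {s t} → Colour → Walk s t → ℕ
  cost {s} {t} i w = κ i t s + total κ w

  blocked : ∀ {s t} → Walk s t → ℕ
  blocked {s} {t} w = total (blockedAt s t) w

  Better : ℕ → Set
  Better N = Σ[ s ∈ V ] Σ[ t ∈ V ] Σ[ i ∈ Colour ] Σ[ w ∈ Walk s t ] Closed i w × cost i w < N

  -- The closing edge must stay bad, because `improve` continues from the new cycle with its closing
  -- edge as the bad one.
  Lower : ℕ → ℕ → Set
  Lower N β = Σ[ s ∈ V ] Σ[ t ∈ V ] Σ[ i ∈ Colour ] Σ[ w ∈ Walk s t ]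
    Closed i w × bad i t s ≡ true × cost i w ≤ N × blocked w < β

  Smaller : ℕ → ℕ → Set
  Smaller N β = Better N ⊎ Lower N β

  smaller-mono : ∀ {N N′ β β′} → N ≤ N′ → β ≤ β′ → Smaller N β → Smaller N′ β′
  smaller-mono p q (inj₁ (s , t , i , w , cl , lt)) =
    inj₁ (s , t , i , w , cl , ℕₚ.<-≤-trans lt p)
  smaller-mono p q (inj₂ (s , t , i , w , cl , b , le , lt)) =
    inj₂ (s , t , i , w , cl , b , ℕₚ.≤-trans le p , ℕₚ.<-≤-trans lt q)

  total-step : ∀ g {s u v t} (a : Walk s u) c (p : Opp u v) (b : Walk v t) →
    total g (a ⊙ step c p b) ≡ g c u v + (total g a + total g b)
  total-step g {u = u} {v} a c p b = trans (total-⊙ g a (step c p b))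
    (solve 3 (λ x y z → x :+ (y :+ z) := y :+ (x :+ z)) refl (total g a) (g c u v) (total g b))
    where open ℕSolver.+-*-Solver using (solve; _:+_; _:=_)

  cost-step : ∀ {s u v t} i (a : Walk s u) c (p : Opp u v) (b : Walk v t) →
    cost i (a ⊙ step c p b) ≡ (κ i t s + κ c u v) + (total κ a + total κ b)
  cost-step {s} {u} {v} {t} i a c p b =
    trans (cong (κ i t s +_) (total-step κ a c p b)) (sym (ℕₚ.+-assoc (κ i t s) _ _))

  swap-verts : ∀ {s u v t} c d (a : Walk s u) (p : Opp u v) (b : Walk v t) →
    verts (a ⊙ step c p b) ≡ verts (a ⊙ step d p b)
  swap-verts c d a p b = cong (_ ∷_) (trans (ends-⊙ a (step c p b)) (sym (ends-⊙ a (step d p b))))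

  exchange : ∀ {A : Set} (x y : A) xs ys → y ∷ xs ++ x ∷ ys ↭ x ∷ xs ++ y ∷ ys
  exchange x y xs ys = ↭-trans (↭-prep y (shift x xs ys))
    (↭-trans (↭-swap y x ↭-refl) (↭-prep x (↭-sym (shift y xs ys))))

  swap-cols : ∀ {s u v t} i c (a : Walk s u) (p : Opp u v) (b : Walk v t) →
    c ∷ cols (a ⊙ step i p b) ↭ i ∷ cols (a ⊙ step c p b)
  swap-cols i c a p b =
    ↭-trans (↭-reflexive (cong (c ∷_) (cols-⊙ a (step i p b))))
      (↭-trans (exchange i c (cols a) (cols b))
        (↭-reflexive (cong (i ∷_) (sym (cols-⊙ a (step c p b))))))

  swap : ∀ {s u v t i c} (a : Walk s u) (p : Opp u v) (b : Walk v t) →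
    Closed i (a ⊙ step c p b) → Closed c (a ⊙ step i p b)
  swap {i = i} {c} a p b cl = record
    { opp = opp cl
    ; vs  = ↭-trans (↭-reflexive (swap-verts i c a p b)) (vs cl)
    ; cs  = ↭-trans (swap-cols i c a p b) (cs cl)
    }

  swap-cost-< : ∀ {s u v t} i c (a : Walk s u) (p : Opp u v) (b : Walk v t) →
    κ c t s + κ i u v < κ i t s + κ c u v → cost c (a ⊙ step i p b) < cost i (a ⊙ step c p b)
  swap-cost-< i c a p b lt = subst₂ _<_ (sym (cost-step c a i p b)) (sym (cost-step i a c p b))
    (ℕₚ.+-monoˡ-< (total κ a + total κ b) lt)

  swap-cost-≤ : ∀ {s u v t} i c (a : Walk s u) (p : Opp u v) (b : Walk v t) →
    κ c t s + κ i u v ≤ κ i t s + κ c u v → cost c (a ⊙ step i p b) ≤ cost i (a ⊙ step c p b)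
  swap-cost-≤ i c a p b le = subst₂ _≤_ (sym (cost-step c a i p b)) (sym (cost-step i a c p b))
    (ℕₚ.+-monoˡ-≤ (total κ a + total κ b) le)

  swap-better : ∀ {s u v t i c} (a : Walk s u) (p : Opp u v) (b : Walk v t) →
    Closed i (a ⊙ step c p b) → bad i t s ≡ true → bad c t s ≡ false → bad i u v ≡ false →
    Better (cost i (a ⊙ step c p b))
  swap-better {i = i} {c} a p b cl bi bc bi′ = _ , _ , c , _ , swap a p b cl ,
    swap-cost-< i c a p b (subst₂ _<_ (cong₂ _+_ (cong bit (sym bc)) (cong bit (sym bi′)))
      (cong (_+ κ c _ _) (cong bit (sym bi))) (s≤s z≤n))

  -- 2-opt: delete the closing edge and the step u – v, insert u – t and s – v.
  reconnect : ∀ {s u v t i c} j d (a : Walk s u) (p : Opp u v) (q : Opp s v) (b : Walk v t) →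
    Opp u t → j ∷ d ∷ [] ↭ i ∷ c ∷ [] →
    Closed i (a ⊙ step c p b) → Closed j (revOnto a (step d q b))
  reconnect {s} {i = i} {c} j d a p q b o jd cl = record
    { opp = o
    ; vs  = ↭-trans (verts-revOnto a (step d q b))
        (↭-trans (shift s (ends a) (verts b))
          (↭-trans (↭-reflexive (cong (s ∷_) (sym (ends-⊙ a (step c p b))))) (vs cl)))
    ; cs  = ↭-trans (↭-prep j (↭-trans (cols-revOnto a (step d q b)) (shift d (cols a) (cols b))))
        (↭-trans (++⁺ʳ (cols a ++ cols b) jd)
          (↭-trans (↭-prep i (↭-sym (shift c (cols a) (cols b))))
            (↭-trans (↭-reflexive (cong (i ∷_) (sym (cols-⊙ a (step c p b))))) (cs cl))))
    }

  -- The inserted edges can share the colours i and c in two ways, hence the permutation. Both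
  -- inserted edges are good, while the deleted closing edge was bad.
  reconnect-better : ∀ {s u v t i c} j d (a : Walk s u) (p : Opp u v) (q : Opp s v) (b : Walk v t) →
    Opp u t → j ∷ d ∷ [] ↭ i ∷ c ∷ [] →
    Closed i (a ⊙ step c p b) → bad i t s ≡ true → bad j u t ≡ false → bad d s v ≡ false →
    Better (cost i (a ⊙ step c p b))
  reconnect-better {s} {u} {v} {t} {i} {c} j d a p q b o jd cl bi bj bd =
    _ , _ , j , _ , reconnect j d a p q b o jd cl , (begin-strict
      κ j t u + total κ (revOnto a (step d q b))    ≡⟨ cong (_+ total κ (revOnto a (step d q b))) (cong bit (trans (bad-sym j t u) bj)) ⟩
      total κ (revOnto a (step d q b))              ≡⟨ total-revOnto κ κ (λ c u v → κ-sym c v u) a (step d q b) ⟩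
      total κ a + (κ d s v + total κ b)             ≡⟨ cong (λ x → total κ a + (bit x + total κ b)) bd ⟩
      total κ a + total κ b                         <⟨ ℕₚ.m<n+m _ {κ i t s + κ c u v} (subst (0 <_) (cong (λ x → bit x + κ c u v) (sym bi)) (s≤s z≤n)) ⟩
      (κ i t s + κ c u v) + (total κ a + total κ b) ≡⟨ sym (cost-step i a c p b) ⟩
      cost i (a ⊙ step c p b)                       ∎)
    where open ℕₚ.≤-Reasoning

  -- Lets any chosen edge of the cycle become the closing edge: a bad one in `better-cycle`, the
  -- free one in `open-up`.
  rotate : ∀ {s u v t i c} (a : Walk s u) (p : Opp u v) (b : Walk v t)
    (cl : Closed i (a ⊙ step c p b)) → Closed c (b ⊙ step i (not-flip (opp cl)) a)
  rotate {s} {u} {v} {t} {i} {c} a p b cl = record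
    { opp = not-flip p
    ; vs  = ↭-trans (↭-reflexive (cong (v ∷_) (ends-⊙ b (step i _ a))))
        (↭-trans (↭-++-comm (v ∷ ends b) (s ∷ ends a))
          (↭-trans (↭-reflexive (cong (s ∷_) (sym (ends-⊙ a (step c p b))))) (vs cl)))
    ; cs  = ↭-trans (↭-reflexive (cong (c ∷_) (cols-⊙ b (step i _ a))))
        (↭-trans (↭-++-comm (c ∷ cols b) (i ∷ cols a))
          (↭-trans (↭-reflexive (cong (i ∷_) (sym (cols-⊙ a (step c p b))))) (cs cl)))
    }

  rotate-cost : ∀ {s u v t i c} (a : Walk s u) (p : Opp u v) (b : Walk v t) (o : Opp t s) →
    cost c (b ⊙ step i o a) ≡ cost i (a ⊙ step c p b)
  rotate-cost {s} {u} {v} {t} {i} {c} a p b o = begin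
    cost c (b ⊙ step i o a)
      ≡⟨ cost-step c b i o a ⟩
    (κ c u v + κ i t s) + (total κ b + total κ a)
      ≡⟨ cong₂ _+_ (ℕₚ.+-comm (κ c u v) (κ i t s)) (ℕₚ.+-comm (total κ b) (total κ a)) ⟩
    (κ i t s + κ c u v) + (total κ a + total κ b)
      ≡⟨ sym (cost-step i a c p b) ⟩
    cost i (a ⊙ step c p b) ∎
    where open ≡-Reasoning

  -- Exchanges s and t, so that a star at an end of the bad edge may be assumed to be at s.
  turn : ∀ {s t i} (w : Walk s t) → Closed i w → Closed i (revOnto w ε)
  turn {s} {t} {i} w cl = record
    { opp = not-flip (opp cl)
    ; vs  = ↭-trans (verts-revOnto w ε) (↭-trans (↭-++-comm (ends w) (s ∷ [])) (vs cl))
    ; cs  = ↭-trans (↭-prep i (↭-trans (cols-revOnto w ε) (↭-++-comm (cols w) []))) (cs cl)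
    }

  turn-cost : ∀ {s t} i (w : Walk s t) → cost i (revOnto w ε) ≡ cost i w
  turn-cost {s} {t} i w = cong₂ _+_ (κ-sym i s t)
    (trans (total-revOnto κ κ (λ c u v → κ-sym c v u) w ε) (ℕₚ.+-identityʳ (total κ w)))

  turn-blocked : ∀ {s t} (w : Walk s t) → blocked (revOnto w ε) ≡ blocked w
  turn-blocked {s} {t} w = trans
    (total-revOnto (blockedAt s t) (blockedAt t s) (blockedAt-sym s t) w ε) (ℕₚ.+-identityʳ _)

  -- Local search for a cycle without bad edges

  module Search
    (few : ∀ j σ L → Cells j σ L → length L ≤ n)
    (full : ∀ j σ L → Cells j σ L → length L ≡ n → ∀ u v → miss j u v ≡ true → StarAt u j ⊎ StarAt v j)
    where

    dichotomy : ∀ b → b ≡ true ⊎ b ≡ false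
    dichotomy true  = inj₁ refl
    dichotomy false = inj₂ refl

    -- A star already contributes n pairs, the maximum allowed by `few`, so M j has no room for a
    -- pair that avoids its centre.
    star-exact : ∀ {x j} → StarAt x j → ∀ {u v} → miss j u v ≡ true → u ≡ x ⊎ v ≡ x
    star-exact {x} {j} star {u} {v} e with u Finₚ.≟ x | v Finₚ.≟ x
    ... | yes u≡x | _       = inj₁ u≡x
    ... | no _    | yes v≡x = inj₂ v≡x
    ... | no u≢x  | no v≢x  = ⊥-elim (overfull (side u Boolₚ.≟ side x))
      where
      ys : List V
      ys = class (not (side x))
      star-cells : Cells j (side x) (map (x ,_) ys)
      star-cells = Uniqueₚ.map⁺ (λ { refl → refl }) (class-unique _)
                 , Allₚ.map⁺ (All.map (λ {y} sy → star y sy , refl) (class-side _))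
      too-many : ∀ a b → miss j a b ≡ true → side a ≡ side x → a ≢ x → ⊥
      too-many a b e sa a≢x = ℕₚ.<-irrefl refl (subst (_< n) len
        (few j (side x) ((a , b) ∷ map (x ,_) ys)
          ( Allₚ.map⁺ (All.universal (λ y eq → a≢x (cong proj₁ eq)) ys) ∷ proj₁ star-cells
          , (e , sa) ∷ proj₂ star-cells)))
        where
        len : length (map (x ,_) ys) ≡ n
        len = trans (Listₚ.length-map (x ,_) ys) (class-length _)
      overfull : Dec (side u ≡ side x) → ⊥
      overfull (yes su) = too-many u v e su u≢x
      overfull (no su)  = too-many v u (trans (miss-sym j v u) e)
        (trans (miss-opp j u v e) (sym (Boolₚ.¬-not (su ∘ sym)))) v≢x

    -- The pair of M i that explains why no move at the step u - v makes progress. `on-cycle`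
    -- excludes the free colour, because the free edge is counted separately in `advance`.
    data Charge (i : Fin k) (s t : V) (c : Colour) (u v : V) : Set where
      at-end   : miss i u t ≡ true → Charge i s t c u v
      at-start : miss i s v ≡ true → Charge i s t c u v
      on-cycle : miss i u v ≡ true → c ≢ nothing → Charge i s t c u v

    bad⇒coloured : ∀ {c u v} → bad c u v ≡ true → c ≢ nothing
    bad⇒coloured e refl with () ← e

    -- If u - t and s - v are both outside M i, each of the two colourings of a 2-opt move can fail
    -- only through the colour c, so c is bad on both edges and the step is blocked. If u - v is
    -- outside M i as well, swapping i and c lowers the cost or, failing that, `blocked`.
    charge-step : ∀ {s u v t i c} (a : Walk s u) (p : Opp u v) (b : Walk v t) →
      Closed (just i) (a ⊙ step c p b) → miss i t s ≡ true → side u ≡ side s →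
      Smaller (cost (just i) (a ⊙ step c p b)) (blocked (a ⊙ step c p b)) ⊎ Charge i s t c u v
    charge-step {s} {u} {v} {t} {i} {c} a p b cl e su
      with dichotomy (miss i u t)
    ... | inj₁ ut = inj₂ (at-end ut)
    ... | inj₂ ut with dichotomy (miss i s v)
    ... | inj₁ sv = inj₂ (at-start sv)
    ... | inj₂ sv with dichotomy (bad c s v)
    ... | inj₂ csv = inj₁ (inj₁ (reconnect-better (just i) c a p (trans p (cong not su)) b
            (trans (opp cl) (cong not (sym su))) ↭-refl cl e ut csv))
    ... | inj₁ csv with dichotomy (bad c u t)
    ... | inj₂ cut = inj₁ (inj₁ (reconnect-better c (just i) a p (trans p (cong not su)) b
            (trans (opp cl) (cong not (sym su))) (↭-swap c (just i) ↭-refl) cl e cut sv))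
    ... | inj₁ cut with dichotomy (miss i u v)
    ... | inj₁ uv = inj₂ (on-cycle uv (bad⇒coloured csv))
    ... | inj₂ uv with dichotomy (bad c t s)
    ... | inj₂ cts = inj₁ (inj₁ (swap-better a p b cl e cts uv))
    -- The cost does not rise: t - s stays bad, now in colour c, and u - v is good in colour i. By
    -- `cut` and `csv` the step was blocked in colour c; by `ut` it is not in colour i.
    ... | inj₁ cts = inj₁ (inj₂ (_ , _ , c , _ , swap a p b cl , cts
          , swap-cost-≤ (just i) c a p b
              (ℕₚ.≤-trans (ℕₚ.≤-reflexive (cong₂ (λ x y → bit x + bit y) (trans cts (sym e)) uv))
                (ℕₚ.+-monoʳ-≤ (κ (just i) t s) z≤n))
          , subst₂ _<_ (sym (total-step β a (just i) p b)) (sym (total-step β a c p b))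
              (subst₂ (λ x y → x + rest < y + rest)
                (cong bit (sym (cong (_∧ miss i s v) ut)))
                (cong bit (sym (cong₂ _∧_ cut csv)))
                (ℕₚ.n<1+n rest))))
      where
      β : Colour → V → V → ℕ
      β = blockedAt s t
      rest : ℕ
      rest = total β a + total β b

    -- `located` confines the pairs to the part b already treated, apart from a possible first entry
    -- s, so the next charge is new. `not-ends` and `uncoloured` separate the pairs from the closing
    -- edge and from the free edge, in either direction.
    record Charged (i : Fin k) {s t} (w : Walk s t) {u} (b : Walk u t) (L : List (V × V)) : Set where
      field
        distinct  : Unique L
        missing   : All (λ (x , y) → miss i x y ≡ true × side x ≡ side s) L
        not-ends  : All (λ (x , y) → x ≢ s ⊎ y ≢ t) L
        located   : All (λ (x , y) → x ∈ verts b ⊎ (x ≡ s × y ∈ verts b)) L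
        uncoloured : ∀ {x y} → Has x nothing y w → All (λ cell → cell ≢ (x , y) × cell ≢ (y , x)) L
        size      : length (verts b) ≡ 2 + (length L + length L)

    open Charged

    -- Only the steps u – v with u on the side of s are inspected: there 2-opt inserts t – u and s – v.
    charge : ∀ {s t i} (w : Walk s t) → Closed (just i) w → miss i t s ≡ true →
      ∀ {u} (a : Walk s u) (b : Walk u t) → a ⊙ b ≡ w → side u ≡ side s → s ∉ verts b →
      Unique (verts b) → Smaller (cost (just i) w) (blocked w) ⊎ ∃ (Charged i w b)
    charge w cl e a ε eq su s∉ U = ⊥-elim (Boolₚ.not-¬ su (opp cl))
    -- The last step is not inspected: it ends at t, and 2-opt would insert again the two edges it
    -- deletes. Its two vertices are the constant 2 in `size`.
    charge w cl e a (step c p ε) eq su s∉ U = inj₂ ([] , record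
      { distinct = [] ; missing = [] ; not-ends = [] ; located = [] ; uncoloured = λ _ → [] ; size = refl })
    charge {s} {t} {i} w cl e {u} a (step {v = v} c p (step {v = u′} d q b)) refl su s∉ U
      with charge-step a p (step d q b) cl e su
         | charge w cl e (a ⊙ step c p (step d q ε)) b (⊙-assoc a _ b)
             (trans (not-≡-cancel p q) su) (λ s∈ → s∉ (there (there s∈))) (uniq-tail (uniq-tail U))
    ... | inj₁ sm | _       = inj₁ sm
    ... | inj₂ _  | inj₁ sm = inj₁ sm
    ... | inj₂ ch | inj₂ (L , C) = inj₂ (cell ch ∷ L , record
      { distinct   = All.map (new ch) (located C) ∷ distinct C
      ; missing    = cell-missing ch ∷ missing C
      ; not-ends   = cell-not-ends ch ∷ not-ends C
      ; located    = cell-located ch ∷ All.map later (located C)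
      ; uncoloured = λ h → cell-uncoloured ch h ∷ uncoloured C h
      ; size       = trans (cong (2 +_) (size C)) (cong (3 +_) (sym (ℕₚ.+-suc (length L) (length L))))
      })
      where
      u≢s : u ≢ s
      u≢s refl = s∉ (here refl)
      u∉ : u ∉ v ∷ verts b
      u∉ = uniq-head U
      v∉ : v ∉ verts b
      v∉ = uniq-head (uniq-tail U)
      v≢t : v ≢ t
      v≢t refl = v∉ (last∈ b)
      huv : Has u c v w
      huv = has-⊙ʳ a here
      hvu′ : Has v d u′ w
      hvu′ = has-⊙ʳ a (there here)
      U′ : Unique (verts w)
      U′ = uniq cl
      cell : Charge i s t c u v → V × V
      cell (at-end _)     = u , t
      cell (at-start _)   = s , v
      cell (on-cycle _ _) = u , v
      new : ∀ ch {z} → proj₁ z ∈ verts b ⊎ (proj₁ z ≡ s × proj₂ z ∈ verts b) → cell ch ≢ z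
      new (at-end _)     (inj₁ x∈)         refl = u∉ (there x∈)
      new (at-end _)     (inj₂ (x≡s , _))  refl = u≢s x≡s
      new (at-start _)   (inj₁ x∈)         refl = s∉ (there (there x∈))
      new (at-start _)   (inj₂ (_ , y∈))   refl = v∉ y∈
      new (on-cycle _ _) (inj₁ x∈)         refl = u∉ (there x∈)
      new (on-cycle _ _) (inj₂ (x≡s , _))  refl = u≢s x≡s
      later : ∀ {z} → proj₁ z ∈ verts b ⊎ (proj₁ z ≡ s × proj₂ z ∈ verts b) →
        proj₁ z ∈ u ∷ v ∷ verts b ⊎ (proj₁ z ≡ s × proj₂ z ∈ u ∷ v ∷ verts b)
      later (inj₁ x∈)        = inj₁ (there (there x∈))
      later (inj₂ (x≡s , y∈)) = inj₂ (x≡s , there (there y∈))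
      cell-missing : ∀ ch → miss i (proj₁ (cell ch)) (proj₂ (cell ch)) ≡ true × side (proj₁ (cell ch)) ≡ side s
      cell-missing (at-end x)     = x , su
      cell-missing (at-start x)   = x , refl
      cell-missing (on-cycle x _) = x , su
      cell-not-ends : ∀ ch → proj₁ (cell ch) ≢ s ⊎ proj₂ (cell ch) ≢ t
      cell-not-ends (at-end _)     = inj₁ u≢s
      cell-not-ends (at-start _)   = inj₂ v≢t
      cell-not-ends (on-cycle _ _) = inj₁ u≢s
      cell-located : ∀ ch → proj₁ (cell ch) ∈ u ∷ v ∷ verts b ⊎ (proj₁ (cell ch) ≡ s × proj₂ (cell ch) ∈ u ∷ v ∷ verts b)
      cell-located (at-end _)     = inj₁ (here refl)
      cell-located (at-start _)   = inj₂ (refl , there (here refl))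
      cell-located (on-cycle _ _) = inj₁ (here refl)
      -- The charged pair is compared with the free step of w: the successor of u is v, the
      -- predecessor of v is u, s has no predecessor and t no successor.
      cell-uncoloured : ∀ ch {x y} → Has x nothing y w → cell ch ≢ (x , y) × cell ch ≢ (y , x)
      cell-uncoloured (at-end _) h =
          (λ { refl → v≢t (proj₂ (has-functional U′ huv h)) })
        , (λ { refl → has-start≢last U′ h refl })
      cell-uncoloured (at-start _) h =
          (λ { refl → u≢s (has-injective U′ huv h) })
        , (λ { refl → uniq-head U′ (has-end h) })
      cell-uncoloured (on-cycle _ c≢) h =
          (λ { refl → c≢ (proj₁ (has-functional U′ huv h)) })
        , (λ { refl → u∉ (there (here (sym (proj₂ (has-functional U′ hvu′ h))))) })

    has-split : ∀ {s u v t c} (a : Walk s u) (p : Opp u v) (b : Walk v t) → Has u c v (a ⊙ step c p b)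
    has-split a p b = has-⊙ʳ a here

    closed-length : ∀ {s t i} {w : Walk s t} → Closed i w → length (verts w) ≡ n + n
    closed-length cl = trans (↭-length (vs cl)) (trans (Listₚ.length-tabulate id) m≡2n)

    free∈ : ∀ {s t i} {w : Walk s t} → Closed (just i) w → nothing ∈ cols w
    free∈ cl with ∈-resp-↭ (↭-sym (cs cl)) (here refl)
    ... | there h = h

    -- The free colour is good everywhere, so swapping it with i removes a bad edge unless i is bad
    -- on the free edge too. This makes the free edge one of the pairs of M i.
    free-bad : ∀ {s t i} (w : Walk s t) → Closed (just i) w → miss i t s ≡ true →
      Better (cost (just i) w) ⊎ (Σ[ u ∈ V ] Σ[ v ∈ V ] Has u nothing v w × miss i u v ≡ true)
    free-bad {i = i} w cl e with find-colour w (free∈ cl)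
    ... | split {u = u} {v} a p b with dichotomy (miss i u v)
    ...   | inj₁ uv = inj₂ (u , v , has-⊙ʳ a here , uv)
    ...   | inj₂ uv = inj₁ (swap-better a p b cl e refl uv)

    -- Of the n steps that start on the side of s, the first and the last are trivial for 2-opt. The
    -- other n - 2 charge distinct pairs, and the closing edge and the free edge raise the number to
    -- n, where `full` applies.
    advance : ∀ {s t i} (w : Walk s t) → Closed (just i) w → miss i t s ≡ true →
      Smaller (cost (just i) w) (blocked w) ⊎ (StarAt s i ⊎ StarAt t i)
    advance ε cl e = ⊥-elim (Boolₚ.not-¬ refl (opp cl))
    -- Here n ≥ 2 enters: the cycle has more than two vertices.
    advance (step c p ε) cl e =
      ⊥-elim (ℕₚ.<-irrefl (closed-length cl) (ℕₚ.+-mono-≤-< (ℕₚ.≤-trans (s≤s z≤n) 2≤n) 2≤n))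
    advance {s} {t} {i} w@(step {v = v₀} c₀ p₀ (step d₀ q₀ b)) cl e
      with free-bad w cl e
         | charge w cl e (step c₀ p₀ (step d₀ q₀ ε)) b refl (not-≡-cancel p₀ q₀)
             (λ s∈ → uniq-head (uniq cl) (there s∈)) (uniq-tail (uniq-tail (uniq cl)))
    ... | inj₁ better | _ = inj₁ (inj₁ better)
    ... | inj₂ _ | inj₁ sm = inj₁ sm
    ... | inj₂ (u , v , h , uv) | inj₂ (L , C) =
      inj₂ (full i (side s) ((s , t) ∷ f ∷ L) cells size′ s t (trans (miss-sym i s t) e))
      where
      U : Unique (verts w)
      U = uniq cl
      oriented : Σ[ f ∈ V × V ] (miss i (proj₁ f) (proj₂ f) ≡ true × side (proj₁ f) ≡ side s)
        × (f ≡ (u , v) ⊎ f ≡ (v , u))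
      oriented with side u Boolₚ.≟ side s
      ... | yes su = (u , v) , (uv , su) , inj₁ refl
      ... | no su  = (v , u)
                   , (trans (miss-sym i v u) uv , trans (has-opp h) (sym (Boolₚ.¬-not (su ∘ sym))))
                   , inj₂ refl
      f : V × V
      f = proj₁ oriented
      not-f : ∀ {z} → z ≢ (u , v) × z ≢ (v , u) → f ≢ z
      not-f (z≢uv , z≢vu) refl with proj₂ (proj₂ oriented)
      ... | inj₁ eq = z≢uv eq
      ... | inj₂ eq = z≢vu eq
      ends≢f : (s , t) ≢ f
      ends≢f eq = not-f {s , t}
        ( (λ { refl → uniq-head (uniq-tail U)
                 (subst (_∈ verts b) (sym (proj₂ (has-functional U here h))) (last∈ b)) })
        , (λ { refl → has-start≢last U h refl })) (sym eq)
      cells : Cells i (side s) ((s , t) ∷ f ∷ L)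
      cells = ((ends≢f ∷ All.map (λ { (inj₁ ne) refl → ne refl ; (inj₂ ne) refl → ne refl }) (not-ends C))
                ∷ All.map not-f (uncoloured C h) ∷ distinct C)
            , (trans (miss-sym i s t) e , refl) ∷ proj₁ (proj₂ oriented) ∷ missing C
      size′ : 2 + length L ≡ n
      size′ = double-injective (trans
        (trans (cong (2 +_) (ℕₚ.+-comm (length L) (2 + length L))) (cong (2 +_) (sym (size C))))
        (closed-length cl))

    StarAt? : ∀ x j → Dec (StarAt x j)
    StarAt? x j = Finₚ.all? λ v → (side v Boolₚ.≟ not (side x)) →-dec (miss j x v Boolₚ.≟ true)

    AllStars : Set
    AllStars = Σ[ x ∈ V ] ∀ j → StarAt x j

    -- Edges that avoid s are good in colour i by `star-exact`, so i can be swapped onto any of them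
    -- without harm. The obstacle is a free edge at s, which cannot take i; then a colour j without
    -- a star at s is brought onto the closing edge instead.
    star-step : ∀ {s t i} (w : Walk s t) → Closed (just i) w → miss i t s ≡ true → StarAt s i →
      Smaller (cost (just i) w) (blocked w) ⊎ AllStars
    star-step ε cl e star = ⊥-elim (Boolₚ.not-¬ refl (opp cl))
    star-step {s} {t} {i} (step {v = v₀} c₀ p₀ w) cl e star with Finₚ.all? (StarAt? s)
    ... | yes all-star = inj₂ (s , all-star)
    ... | no ¬all-star = inj₁ (go c₀ cl)
      where
      off-star : ∀ {u v} → u ≢ s → v ≢ s → miss i u v ≡ false
      off-star {u} {v} u≢s v≢s with dichotomy (miss i u v)
      ... | inj₂ uv = uv
      ... | inj₁ uv with star-exact star uv
      ...   | inj₁ u≡s = ⊥-elim (u≢s u≡s)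
      ...   | inj₂ v≡s = ⊥-elim (v≢s v≡s)
      not-s : ∀ {u} → u ∈ verts w → u ≢ s
      not-s u∈ refl = uniq-head (uniq cl) u∈
      t≢s : t ≢ s
      t≢s refl = Boolₚ.not-¬ refl (opp cl)
      go : ∀ c₀ → Closed (just i) (step c₀ p₀ w) →
        Smaller (cost (just i) (step c₀ p₀ w)) (blocked (step c₀ p₀ w))
      -- The first step is coloured, so the free edge lies further along, avoids s and can take the
      -- colour i.
      go (just j₀) cl with free∈ cl
      ... | there h with find-colour w h
      ...   | split a p b = inj₁ (swap-better (step (just j₀) p₀ a) p b cl e refl
                (off-star (not-s (has-start (has-split a p b))) (not-s (there (has-end (has-split a p b))))))
      -- The free edge is s - v₀ itself. As M i is a star at s, a colour j without such a star
      -- differs from i and sits on a later step.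
      go nothing cl with Finₚ.¬∀⟶∃¬ _ (StarAt s) (StarAt? s) ¬all-star
      ... | j , ¬star with ∈-resp-↭ (↭-sym (cs cl)) (there (∈ₚ.∈-map⁺ just (∈ₚ.∈-allFin j)))
      ... | here refl = ⊥-elim (¬star star)
      ... | there (there h) with find-colour w h
      ... | split {u = u} {v} a p b with dichotomy (miss j t s)
      ... | inj₂ ts = inj₁ (swap-better (step nothing p₀ a) p b cl e ts off)
        where
        off : miss i u v ≡ false
        off = off-star (not-s (has-start (has-split a p b))) (not-s (there (has-end (has-split a p b))))
      ... | inj₁ ts = smaller-mono cost′≤ blocked′≤ result
        where
        u≢s : u ≢ s
        u≢s = not-s (has-start (has-split a p b))
        v≢s : v ≢ s
        v≢s = not-s (there (has-end (has-split a p b)))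
        w′ : Walk s t
        w′ = step nothing p₀ (a ⊙ step (just i) p b)
        cl′ : Closed (just j) w′
        cl′ = swap (step nothing p₀ a) p b cl
        cost′≤ : cost (just j) w′ ≤ cost (just i) (step nothing p₀ (a ⊙ step (just j) p b))
        cost′≤ = swap-cost-≤ (just i) (just j) (step nothing p₀ a) p b
          (ℕₚ.≤-trans (ℕₚ.≤-reflexive (cong₂ (λ x y → bit x + bit y) (trans ts (sym e)) (off-star u≢s v≢s)))
            (ℕₚ.+-monoʳ-≤ (κ (just i) t s) z≤n))
        blocked′≤ : blocked w′ ≤ blocked (step nothing p₀ (a ⊙ step (just j) p b))
        blocked′≤ = subst₂ _≤_ (sym (total-step β (step nothing p₀ a) (just i) p b))
          (sym (total-step β (step nothing p₀ a) (just j) p b))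
          (ℕₚ.+-monoˡ-≤ (total β (step nothing p₀ a) + total β b)
            (subst (_≤ β (just j) u v) (cong (λ x → bit (x ∧ miss i s v)) (sym (off-star u≢s t≢s))) z≤n))
          where
          β : Colour → V → V → ℕ
          β = blockedAt s t
        result : Smaller (cost (just j) w′) (blocked w′)
        result with dichotomy (miss j s v₀)
        ... | inj₂ sv₀ = inj₁ (swap-better ε p₀ (a ⊙ step (just i) p b) cl′ ts refl sv₀)
        ... | inj₁ sv₀ with advance w′ cl′ ts
        ...   | inj₁ sm           = sm
        ...   | inj₂ (inj₁ star′) = ⊥-elim (¬star star′)
        -- M j contains s - v₀, so a star at t would need s or v₀ to equal t; but the walk goes on
        -- after v₀.
        ...   | inj₂ (inj₂ star′) with star-exact star′ sv₀
        ...     | inj₁ s≡t = ⊥-elim (t≢s (sym s≡t))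
        ...     | inj₂ refl = ⊥-elim (uniq-head (uniq-tail (uniq cl′)) (has-nonempty (has-split a p b)))

    progress : ∀ {s t i} (w : Walk s t) → Closed (just i) w → miss i t s ≡ true →
      Smaller (cost (just i) w) (blocked w) ⊎ AllStars
    progress {s} {t} {i} w cl e with advance w cl e
    ... | inj₁ sm          = inj₁ sm
    ... | inj₂ (inj₁ star) = star-step w cl e star
    ... | inj₂ (inj₂ star) with star-step (revOnto w ε) (turn w cl) (trans (miss-sym i s t) e) star
    ...   | inj₁ sm  = inj₁ (smaller-mono (ℕₚ.≤-reflexive (turn-cost (just i) w))
                         (ℕₚ.≤-reflexive (turn-blocked w)) sm)
    ...   | inj₂ all = inj₂ all

    -- Recursion on `blocked` alone suffices, since the cost never rises along the way: a cycle
    -- better than a later one is also better than the first.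
    improve : ∀ {s t i} (w : Walk s t) → Closed i w → bad i t s ≡ true → Acc _<_ (blocked w) →
      Better (cost i w) ⊎ AllStars
    improve {i = just i} w cl e (acc rec) with progress w cl e
    ... | inj₂ all         = inj₂ all
    ... | inj₁ (inj₁ better) = inj₁ better
    ... | inj₁ (inj₂ (_ , _ , _ , w′ , cl′ , e′ , le , lt)) with improve w′ cl′ e′ (rec lt)
    ...   | inj₂ all = inj₂ all
    ...   | inj₁ (s″ , t″ , i″ , w″ , cl″ , lt″) =
      inj₁ (s″ , t″ , i″ , w″ , cl″ , ℕₚ.<-≤-trans lt″ le)

    Clean : Set
    Clean = Σ[ s ∈ V ] Σ[ t ∈ V ] Σ[ i ∈ Colour ] Σ[ w ∈ Walk s t ] Closed i w × cost i w ≡ 0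

    better-cycle : ∀ {s t i} (w : Walk s t) → Closed i w → cost i w ≢ 0 → Better (cost i w) ⊎ AllStars
    better-cycle {s} {t} {i} w cl ne with dichotomy (bad i t s)
    ... | inj₁ e = improve w cl e (<-wellFounded _)
    ... | inj₂ e with find-bad bad w (λ z → ne (cong₂ _+_ (cong bit e) z))
    ...   | splitBad c a p b e′ with improve _ (rotate a p b cl) e′ (<-wellFounded _)
    ...     | inj₂ all    = inj₂ all
    ...     | inj₁ better = inj₁ (subst Better (rotate-cost a p b _) better)

    descend : ∀ {s t i} (w : Walk s t) → Closed i w → Acc _<_ (cost i w) → Clean ⊎ AllStars
    descend {i = i} w cl (acc rec) with cost i w ℕₚ.≟ 0
    ... | yes z = inj₁ (_ , _ , _ , w , cl , z)
    ... | no ne with better-cycle w cl ne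
    ...   | inj₂ all = inj₂ all
    ...   | inj₁ (_ , _ , _ , w′ , cl′ , lt) = descend w′ cl′ (rec lt)

    -- Opening a clean cycle, and a cycle to start from

    RainbowPath : Set
    RainbowPath = Σ[ s ∈ V ] Σ[ t ∈ V ] Σ[ w ∈ Walk s t ]
      (verts w ↭ allFin m) × (cols w ↭ map just (allFin k)) × total κ w ≡ 0

    open-up : Clean → RainbowPath
    open-up (s , t , nothing , w , cl , z) = s , t , w , vs cl , drop-∷ (cs cl) , z
    open-up (s , t , just i , w , cl , z) with find-colour w (free∈ cl)
    ... | split {u = u} {v} a p b =
      v , u , b ⊙ step (just i) _ a , vs cl′ , drop-∷ (cs cl′) , trans (rotate-cost a p b _) z
      where
      cl′ = rotate a p b cl

    -- Supplies the starting cycle: the descent may begin anywhere, so the two classes are simply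
    -- interleaved and the colours taken in the given order.
    weave : ∀ xs ys cs {u} → All (λ x → side x ≡ side u) ys → All (λ x → Opp u x) xs →
      length xs ≡ length ys → length cs ≡ length xs + length ys →
      Σ[ t ∈ V ] Σ[ w ∈ Walk u t ] side t ≡ side u × ends w ↭ xs ++ ys × cols w ≡ cs
    weave [] [] [] _ _ _ _ = _ , ε , refl , ↭-refl , refl
    weave (x ∷ xs) (y ∷ ys) (c ∷ []) _ _ _ l =
      ⊥-elim (ℕₚ.0≢1+n (trans (ℕₚ.suc-injective l) (ℕₚ.+-suc (length xs) (length ys))))
    weave (x ∷ xs) (y ∷ ys) (c ∷ d ∷ cs) {u} (sy ∷ sys) (sx ∷ sxs) l l′
      with weave xs ys cs {y} (All.map (λ s → trans s (sym sy)) sys)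
             (All.map (λ s → trans s (cong not (sym sy))) sxs)
             (ℕₚ.suc-injective l)
             (ℕₚ.suc-injective (trans (ℕₚ.suc-injective l′) (ℕₚ.+-suc (length xs) (length ys))))
    ... | t , w , st , e , refl = t , step c sx (step d (trans sy (not-flip sx)) w) , trans st sy
        , ↭-prep x (↭-trans (↭-prep y e) (↭-sym (shift y xs ys))) , refl

    initial : Σ[ s ∈ V ] Σ[ t ∈ V ] Σ[ w ∈ Walk s t ] Closed nothing w
    initial = go (class true) (class false) (map just (allFin k)) (class-side true) (class-side false)
        (class-length true) (class-length false) classes refl
      where
      colours-length : length (map just (allFin k)) ≡ k
      colours-length = trans (Listₚ.length-map just (allFin k)) (Listₚ.length-tabulate id)
      go : ∀ xs ys cs → All (λ v → side v ≡ true) xs → All (λ v → side v ≡ false) ys →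
        length xs ≡ n → length ys ≡ n → xs ++ ys ↭ allFin m → cs ≡ map just (allFin k) →
        Σ[ s ∈ V ] Σ[ t ∈ V ] Σ[ w ∈ Walk s t ] Closed nothing w
      go [] ys _ _ _ lx _ _ _ = ⊥-elim (ℕₚ.<⇒≢ (ℕₚ.≤-trans (s≤s z≤n) 2≤n) lx)
      go (x ∷ xs) [] _ _ _ _ ly _ _ = ⊥-elim (ℕₚ.<⇒≢ (ℕₚ.≤-trans (s≤s z≤n) 2≤n) ly)
      go (x ∷ xs) (y ∷ ys) cs (sx ∷ sxs) (sy ∷ sys) lx ly p eq = close cs eq len
        where
        len : length cs ≡ suc (length xs + length ys)
        len = trans (cong length eq) (trans colours-length (ℕₚ.suc-injective (begin
          suc k                              ≡⟨ sym m≡1+k ⟩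
          m                                  ≡⟨ m≡2n ⟩
          n + n                              ≡⟨ sym (cong₂ _+_ lx ly) ⟩
          suc (length xs) + suc (length ys)  ≡⟨ cong suc (ℕₚ.+-suc (length xs) (length ys)) ⟩
          suc (suc (length xs + length ys))  ∎)))
          where open ≡-Reasoning
        close : ∀ cs → cs ≡ map just (allFin k) → length cs ≡ suc (length xs + length ys) →
          Σ[ s ∈ V ] Σ[ t ∈ V ] Σ[ w ∈ Walk s t ] Closed nothing w
        close (c ∷ cs) eq l
          with weave xs ys cs {y} (All.map (λ s → trans s (sym sy)) sys)
                 (All.map (λ s → trans s (cong not (sym sy))) sxs)
                 (ℕₚ.suc-injective (trans lx (sym ly))) (ℕₚ.suc-injective l)
        ... | t , w , st , e , ce = x , t , step c (trans sy (cong not (sym sx))) w , record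
          { opp = trans st (trans sy (cong not (sym sx)))
          ; vs  = ↭-trans (↭-prep x (↭-trans (↭-prep y e) (↭-sym (shift y xs ys)))) p
          ; cs  = ↭-reflexive (cong (nothing ∷_) (trans (cong (c ∷_) ce) eq))
          }

    rainbow : RainbowPath ⊎ AllStars
    rainbow with initial
    ... | _ , _ , w , cl with descend w cl (<-wellFounded _)
    ...   | inj₁ clean = inj₁ (open-up clean)
    ...   | inj₂ all   = inj₂ all

    injective-onto⇒↔ : ∀ {A B : Set} (f : A → B) → (∀ x y → f x ≡ f y → x ≡ y) →
      (∀ y → ∃ λ x → f x ≡ y) → A ↔ B
    injective-onto⇒↔ f inj onto =
      mk↔ₛ′ f (proj₁ ∘ onto) (proj₂ ∘ onto) (λ x → inj _ _ (proj₂ (onto (f x))))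

    walk⇒rainbow : (G : Fin k → Graph m) → (∀ j u v → Opp u v → miss j u v ≡ false → Adj (G j) u v) →
      RainbowPath → HasRainbowHamiltonPath G
    walk⇒rainbow G adj (s , t , w , vs , cs , z) =
      path⇒rainbow (trans (sym (steps-verts w)) (trans (↭-length vs) (Listₚ.length-tabulate id))) p c G good
      where
      p : Fin (suc (steps w)) ↔ Fin m
      p = injective-onto⇒↔ (vertexAt w)
        (vertexAt-injective w (Unique-resp-↭ (↭-sym vs) (Uniqueₚ.allFin⁺ m)))
        (λ x → vertexAt-surjective w (∈-resp-↭ (↭-sym vs) (∈ₚ.∈-allFin x)))
      coloured : ∀ i → Σ[ j ∈ Fin k ] colourAt w i ≡ just j
      coloured i with ∈ₚ.∈-map⁻ just (∈-resp-↭ cs (colourAt∈ w i))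
      ... | j , _ , e = j , e
      c : Fin (steps w) ↔ Fin k
      c = injective-onto⇒↔ (proj₁ ∘ coloured)
        (λ i j e → colourAt-injective w
          (Unique-resp-↭ (↭-sym cs) (Uniqueₚ.map⁺ Maybeₚ.just-injective (Uniqueₚ.allFin⁺ k))) i j
          (trans (proj₂ (coloured i)) (trans (cong just e) (sym (proj₂ (coloured j))))))
        onto
        where
        onto : ∀ j → ∃ λ i → proj₁ (coloured i) ≡ j
        onto j with colourAt-surjective w (∈-resp-↭ (↭-sym cs) (∈ₚ.∈-map⁺ just (∈ₚ.∈-allFin j)))
        ... | i , e = i , Maybeₚ.just-injective (trans (sym (proj₂ (coloured i))) e)
      bit-zero : ∀ {b} → bit b ≡ 0 → b ≡ false
      bit-zero {false} _ = refl
      good : ∀ i → Adj (G (Inverse.to c i)) (vertexAt w (inject₁ i)) (vertexAt w (suc i))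
      good i = adj _ _ _ (has-opp (has-at w i))
        (trans (cong (λ x → bad x (vertexAt w (inject₁ i)) (vertexAt w (suc i))) (sym (proj₂ (coloured i))))
          (bit-zero (total-zero κ (has-at w i) z)))

-- The two vertex classes as lists

elements : ∀ {m} → Bool → Subset m → List (Fin m)
elements σ Vec.[]      = []
elements σ (b Vec.∷ X) = if is σ b then zero ∷ map suc (elements σ X) else map suc (elements σ X)

elements-side : ∀ {m} σ (X : Subset m) → All (λ v → Vec.lookup X v ≡ σ) (elements σ X)
elements-side σ Vec.[]      = []
elements-side σ (b Vec.∷ X) with is σ b in eq
... | true  = is-sound σ b eq ∷ Allₚ.map⁺ (elements-side σ X)
... | false = Allₚ.map⁺ (elements-side σ X)

elements-unique : ∀ {m} σ (X : Subset m) → Unique (elements σ X)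
elements-unique σ Vec.[]      = []
elements-unique σ (b Vec.∷ X) with is σ b
... | true  = Allₚ.map⁺ (All.universal (λ _ ()) (elements σ X)) ∷ Uniqueₚ.map⁺ Finₚ.suc-injective (elements-unique σ X)
... | false = Uniqueₚ.map⁺ Finₚ.suc-injective (elements-unique σ X)

-- Links the two ways of counting: rational sums of indicators in the spectral bounds, lengths of
-- lists in the search.
elements-degree : ∀ {m} σ (X : Subset m) → degree (is σ ∘ Vec.lookup X) ≡ ι (length (elements σ X))
elements-degree σ Vec.[]      = refl
elements-degree σ (b Vec.∷ X) with is σ b
... | true  = cong (ℚ._+_ ℚ.1ℚ) (trans (elements-degree σ X) (cong ι (sym (Listₚ.length-map suc (elements σ X)))))
... | false = trans (ℚₚ.+-identityˡ (degree (is σ ∘ Vec.lookup X)))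
  (trans (elements-degree σ X) (cong ι (sym (Listₚ.length-map suc (elements σ X)))))

elements-partition : ∀ {m} (X : Subset m) → elements true X ++ elements false X ↭ allFin m
elements-partition Vec.[] = ↭-refl
elements-partition {suc m} (b Vec.∷ X) = ↭-trans (first b) (↭-prep zero (↭-trans
    (↭-reflexive (sym (Listₚ.map-++ suc (elements true X) (elements false X))))
    (↭-trans (↭-map⁺ suc (elements-partition X)) (↭-reflexive (Listₚ.map-tabulate id suc)))))
  where
  first : ∀ b → elements true (b Vec.∷ X) ++ elements false (b Vec.∷ X) ↭
    zero ∷ map suc (elements true X) ++ map suc (elements false X)
  first true  = ↭-refl
  first false = shift zero (map suc (elements true X)) (map suc (elements false X))

length-elements-true : ∀ {m} (X : Subset m) → length (elements true X) ≡ Subset.∣ X ∣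
length-elements-true Vec.[]          = refl
length-elements-true (true  Vec.∷ X) = cong suc (trans (Listₚ.length-map suc (elements true X)) (length-elements-true X))
length-elements-true (false Vec.∷ X) = trans (Listₚ.length-map suc (elements true X)) (length-elements-true X)

length-elements-false : ∀ {m} (X : Subset m) → length (elements false X) ≡ Subset.∣ ∁ X ∣
length-elements-false Vec.[]          = refl
length-elements-false (true  Vec.∷ X) = trans (Listₚ.length-map suc (elements false X)) (length-elements-false X)
length-elements-false (false Vec.∷ X) = cong suc (trans (Listₚ.length-map suc (elements false X)) (length-elements-false X))

lookup-injective : ∀ {A : Set} {xs : List A} → Unique xs → ∀ i j → List.lookup xs i ≡ List.lookup xs j → i ≡ j
lookup-injective (_ ∷ U)   zero    zero    e = refl
lookup-injective (new ∷ U) zero    (suc j) e = ⊥-elim (All.lookup new (∈ₚ.∈-lookup j) e)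
lookup-injective (new ∷ U) (suc i) zero    e = ⊥-elim (All.lookup new (∈ₚ.∈-lookup i) (sym e))
lookup-injective (_ ∷ U)   (suc i) (suc j) e = cong suc (lookup-injective U i j e)

-- A complete bipartite graph with one vertex isolated

module StarIsomorphism {m : ℕ} (side : Fin m → Bool) (G : Graph m) (x : Fin m)
  (adj⇒ : ∀ u v → Adj G u v → side v ≡ not (side u) × u ≢ x × v ≢ x)
  (⇒adj : ∀ u v → side v ≡ not (side u) → u ≢ x → v ≢ x → Adj G u v)
  (ys xs : List (Fin m)) (ys-unique : Unique ys) (xs-unique : Unique (x ∷ xs))
  (ys-side : All (λ v → side v ≡ not (side x)) ys) (xs-side : All (λ v → side v ≡ side x) xs)
  (cover : ∀ v → v ∈ ys ⊎ v ∈ x ∷ xs)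
  where

  open KView (length ys) (length xs)

  place : Part → Fin m
  place (inj₁ (inj₁ i)) = List.lookup ys i
  place (inj₁ (inj₂ j)) = List.lookup xs j
  place (inj₂ _)        = x

  side-ys : ∀ i → side (List.lookup ys i) ≡ not (side x)
  side-ys i = All.lookup ys-side (∈ₚ.∈-lookup i)

  side-xs : ∀ j → side (List.lookup xs j) ≡ side x
  side-xs j = All.lookup xs-side (∈ₚ.∈-lookup j)

  ys≢ : ∀ i {v} → side v ≡ side x → List.lookup ys i ≢ v
  ys≢ i s e = Boolₚ.not-¬ refl (trans (sym s) (trans (cong side (sym e)) (side-ys i)))

  xs≢x : ∀ j → List.lookup xs j ≢ x
  xs≢x j e = Uniqueₚ.Unique[x∷xs]⇒x∉xs xs-unique (subst (_∈ xs) e (∈ₚ.∈-lookup j))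

  place-injective : ∀ p q → place p ≡ place q → p ≡ q
  place-injective (inj₁ (inj₁ i)) (inj₁ (inj₁ j)) e = cong (inj₁ ∘ inj₁) (lookup-injective ys-unique i j e)
  place-injective (inj₁ (inj₁ i)) (inj₁ (inj₂ j)) e = ⊥-elim (ys≢ i (side-xs j) e)
  place-injective (inj₁ (inj₁ i)) (inj₂ _)        e = ⊥-elim (ys≢ i refl e)
  place-injective (inj₁ (inj₂ j)) (inj₁ (inj₁ i)) e = ⊥-elim (ys≢ i (side-xs j) (sym e))
  place-injective (inj₁ (inj₂ i)) (inj₁ (inj₂ j)) e = cong (inj₁ ∘ inj₂) (lookup-injective (drop xs-unique) i j e)
    where
    drop : ∀ {x : Fin m} {xs} → Unique (x ∷ xs) → Unique xs
    drop (_ ∷ U) = U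
  place-injective (inj₁ (inj₂ j)) (inj₂ _)        e = ⊥-elim (xs≢x j e)
  place-injective (inj₂ _)        (inj₁ (inj₁ i)) e = ⊥-elim (ys≢ i refl (sym e))
  place-injective (inj₂ _)        (inj₁ (inj₂ j)) e = ⊥-elim (xs≢x j (sym e))
  place-injective (inj₂ zero)     (inj₂ zero)     e = refl

  place-surjective : ∀ v → Σ[ p ∈ Part ] place p ≡ v
  place-surjective v with cover v
  ... | inj₁ v∈           = inj₁ (inj₁ (Any.index v∈)) , sym (Anyₚ.lookup-index v∈)
  ... | inj₂ (here refl)  = inj₂ zero , refl
  ... | inj₂ (there v∈)   = inj₁ (inj₂ (Any.index v∈)) , sym (Anyₚ.lookup-index v∈)

  same-side : ∀ u v → side u ≡ side v → adj G u v ≡ false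
  same-side u v e = Boolₚ.¬-not λ a → Boolₚ.not-¬ (sym e) (proj₁ (adj⇒ u v a))

  at-x : ∀ u v → u ≡ x ⊎ v ≡ x → adj G u v ≡ false
  at-x u v (inj₁ e) = Boolₚ.¬-not λ a → proj₁ (proj₂ (adj⇒ u v a)) e
  at-x u v (inj₂ e) = Boolₚ.¬-not λ a → proj₂ (proj₂ (adj⇒ u v a)) e

  adj-place : ∀ p q → adj G (place p) (place q) ≡ joined p q
  adj-place (inj₁ (inj₁ i)) (inj₁ (inj₁ j)) = same-side _ _ (trans (side-ys i) (sym (side-ys j)))
  adj-place (inj₁ (inj₁ i)) (inj₁ (inj₂ j)) =
    ⇒adj _ _ (trans (side-xs j) (not-flip (side-ys i))) (ys≢ i refl) (xs≢x j)
  adj-place (inj₁ (inj₁ i)) (inj₂ _)        = at-x _ _ (inj₂ refl)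
  adj-place (inj₁ (inj₂ j)) (inj₁ (inj₁ i)) =
    ⇒adj _ _ (trans (side-ys i) (cong not (sym (side-xs j)))) (xs≢x j) (ys≢ i refl)
  adj-place (inj₁ (inj₂ i)) (inj₁ (inj₂ j)) = same-side _ _ (trans (side-xs i) (sym (side-xs j)))
  adj-place (inj₁ (inj₂ j)) (inj₂ _)        = at-x _ _ (inj₂ refl)
  adj-place (inj₂ _)        (inj₁ (inj₁ _)) = at-x _ _ (inj₁ refl)
  adj-place (inj₂ _)        (inj₁ (inj₂ _)) = at-x _ _ (inj₁ refl)
  adj-place (inj₂ _)        (inj₂ _)        = at-x _ _ (inj₁ refl)

  place↔ : Part ↔ Fin m
  place↔ = mk↔ₛ′ place (proj₁ ∘ place-surjective) (proj₂ ∘ place-surjective)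
    (λ p → place-injective _ p (proj₂ (place-surjective (place p))))

  size : ℕ
  size = length ys + length xs

  view↔ : Fin (size + 1) ↔ Part
  view↔ = ↔-trans Finₚ.+↔⊎ (mk↔ₛ′ (Sum.map₁ (splitAt (length ys))) (Sum.map₁ (join (length ys) (length xs))) there-back back-there)
    where
    there-back : ∀ p → Sum.map₁ (splitAt (length ys)) (Sum.map₁ (join (length ys) (length xs)) p) ≡ p
    there-back (inj₁ q) = cong inj₁ (Finₚ.splitAt-join (length ys) (length xs) q)
    there-back (inj₂ _) = refl
    back-there : ∀ p → Sum.map₁ (join (length ys) (length xs)) (Sum.map₁ (splitAt (length ys)) p) ≡ p
    back-there (inj₁ i) = cong inj₁ (Finₚ.join-splitAt (length ys) (length xs) i)
    back-there (inj₂ _) = refl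

  f : Fin m ↔ Fin (size + 1)
  f = ↔-trans (↔-sym place↔) (↔-sym view↔)

  part : Fin m → Part
  part = Inverse.from place↔

  isomorphism : G ≅ K[ length ys , length xs ] ⊔ᴳ K₁
  isomorphism = ↔⇒⤖ f , λ u v → begin
    adj G u v                                  ≡⟨ sym (cong₂ (adj G) (proj₂ (place-surjective u)) (proj₂ (place-surjective v))) ⟩
    adj G (place (part u)) (place (part v))    ≡⟨ adj-place (part u) (part v) ⟩
    joined (part u) (part v)                   ≡⟨ sym (cong₂ joined (view-f u) (view-f v)) ⟩
    joined (view (Inverse.to f u)) (view (Inverse.to f v)) ≡⟨ sym (adj-view (Inverse.to f u) (Inverse.to f v)) ⟩
    adj (K[ length ys , length xs ] ⊔ᴳ K₁) (Inverse.to f u) (Inverse.to f v) ∎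
    where
    open ≡-Reasoning
    view-f : ∀ u → view (Inverse.to f u) ≡ part u
    view-f u = Inverse.strictlyInverseˡ view↔ (part u)

-- The given bipartition, its sides and their sizes

module Bipartition {m : ℕ} (X Y : Subset m) (balanced : IsBalancedBipartition X Y) where

  side : Fin m → Bool
  side = Vec.lookup X

  -- `side` is read off from X alone; this identity gives it the value `false` exactly on Y and
  -- makes both classes equally long.
  Y≡∁X : Y ≡ ∁ X
  Y≡∁X = Subsetₚ.⊆-antisym
    (λ v∈Y → Subsetₚ.x∉p⇒x∈∁p λ v∈X →
      Subsetₚ.∉⊥ (subst (_ Subset.∈_) (proj₁ (proj₂ balanced)) (Subsetₚ.x∈p∩q⁺ (v∈X , v∈Y))))
    (λ v∈∁X → from-union v∈∁X (Subsetₚ.x∈p∪q⁻ X Y (subst (_ Subset.∈_) (sym (proj₁ balanced)) Subsetₚ.∈⊤)))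
    where
    from-union : ∀ {v} → v Subset.∈ ∁ X → v Subset.∈ X ⊎ v Subset.∈ Y → v Subset.∈ Y
    from-union v∈∁X (inj₁ v∈X) = ⊥-elim (Subsetₚ.x∈∁p⇒x∉p v∈∁X v∈X)
    from-union v∈∁X (inj₂ v∈Y) = v∈Y

  side-X : ∀ {v} → v Subset.∈ X → side v ≡ true
  side-X = Vecₚ.[]=⇒lookup

  side-Y : ∀ {v} → v Subset.∈ Y → side v ≡ false
  side-Y {v} v∈Y = trans (sym (Boolₚ.not-involutive (side v)))
    (cong not (trans (sym (Vecₚ.lookup-map v not X)) (Vecₚ.[]=⇒lookup (subst (v Subset.∈_) Y≡∁X v∈Y))))

  opposite : ∀ {G} → IsBipartiteWith X Y G → ∀ u v → Adj G u v → side v ≡ not (side u)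
  opposite bip u v a = from (bip u v a)
    where
    from : (u Subset.∈ X × v Subset.∈ Y) ⊎ (u Subset.∈ Y × v Subset.∈ X) → side v ≡ not (side u)
    from (inj₁ (u∈X , v∈Y)) = trans (side-Y v∈Y) (cong not (sym (side-X u∈X)))
    from (inj₂ (u∈Y , v∈X)) = trans (side-X v∈X) (cong not (sym (side-Y u∈Y)))

  class : Bool → List (Fin m)
  class σ = elements σ X

  class-length : ∀ n → m ≡ n + n → ∀ σ → length (class σ) ≡ n
  class-length n m≡2n = lengths
    where
    false≡true : length (class false) ≡ length (class true)
    false≡true = trans (length-elements-false X)
      (trans (cong Subset.∣_∣ (sym Y≡∁X)) (trans (sym (proj₂ (proj₂ balanced))) (sym (length-elements-true X))))
    true≡n : length (class true) ≡ n
    true≡n = double-injective (begin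
      length (class true) + length (class true)  ≡⟨ cong (length (class true) +_) (sym false≡true) ⟩
      length (class true) + length (class false) ≡⟨ sym (Listₚ.length-++ (class true)) ⟩
      length (class true ++ class false)         ≡⟨ ↭-length (elements-partition X) ⟩
      length (allFin m)                          ≡⟨ Listₚ.length-tabulate id ⟩
      m                                          ≡⟨ m≡2n ⟩
      n + n                                      ∎)
      where open ≡-Reasoning
    lengths : ∀ σ → length (class σ) ≡ n
    lengths true  = true≡n
    lengths false = trans false≡true true≡n

  ∈-class : ∀ v → v ∈ class (side v)
  ∈-class v = from (∈ₚ.∈-++⁻ (class true) (∈-resp-↭ (↭-sym (elements-partition X)) (∈ₚ.∈-allFin v)))
    where
    from : v ∈ class true ⊎ v ∈ class false → v ∈ class (side v)
    from (inj₁ v∈) = subst (λ σ → v ∈ class σ) (sym (All.lookup (elements-side true X) v∈)) v∈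
    from (inj₂ v∈) = subst (λ σ → v ∈ class σ) (sym (All.lookup (elements-side false X) v∈)) v∈

  -- The class of x loses x and becomes the side with n - 1 vertices. The lengths of the lists equal
  -- n and n - 1 only up to proofs, hence the transport.
  star-complement-≅ : ∀ n → m ≡ n + n → (G : Graph m) (x : Fin m) →
    (∀ u v → Adj G u v → side v ≡ not (side u) × u ≢ x × v ≢ x) →
    (∀ u v → side v ≡ not (side u) → u ≢ x → v ≢ x → Adj G u v) →
    G ≅ K[ n , n ∸ 1 ] ⊔ᴳ K₁
  star-complement-≅ n m≡2n G x adj⇒ ⇒adj with ∈ₚ.∈-∃++ (∈-class x)
  ... | before , after , eq = subst₂ (λ s t → G ≅ K[ s , t ] ⊔ᴳ K₁)
      (class-length n m≡2n (not (side x)))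
      (cong (_∸ 1) (trans (sym (↭-length permuted)) (class-length n m≡2n (side x))))
      (StarIsomorphism.isomorphism side G x adj⇒ ⇒adj (class (not (side x))) (before ++ after)
        (elements-unique (not (side x)) X) (Unique-resp-↭ permuted (elements-unique (side x) X))
        (elements-side (not (side x)) X) (tail (All.tabulate (λ v∈ → All.lookup (elements-side (side x) X) (∈-resp-↭ (↭-sym permuted) v∈))))
        (λ v → cover v (side v Boolₚ.≟ side x)))
    where
    permuted : class (side x) ↭ x ∷ before ++ after
    permuted = ↭-trans (↭-reflexive eq) (shift x before after)
    tail : ∀ {P : Fin m → Set} {y ys} → All P (y ∷ ys) → All P ys
    tail (_ ∷ ps) = ps
    cover : ∀ v → Dec (side v ≡ side x) → v ∈ class (not (side x)) ⊎ v ∈ x ∷ before ++ after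
    cover v (yes e) = inj₂ (∈-resp-↭ permuted (subst (λ σ → v ∈ class σ) e (∈-class v)))
    cover v (no ne) = inj₁ (subst (λ σ → v ∈ class σ) (Boolₚ.¬-not ne) (∈-class v))

theorem1p3 : (n : ℕ) → 2 ≤ n →
    (X Y : Subset (2 * n)) → IsBalancedBipartition X Y →
    (G : Fin (2 * n ∸ 1) → Graph (2 * n)) →
    (∀ i → IsBipartiteWith X Y (G i)) →
    (ρ : Fin (2 * n ∸ 1) → ℝ) → (∀ i → IsSpectralRadius (G i) (ρ i)) →
    (ρ₀ : ℝ) → IsSpectralRadius (K[ n , n ∸ 1 ] ⊔ᴳ K₁) ρ₀ →
    (∀ i → ρ₀ ≤ℝ ρ i) →
    HasRainbowHamiltonPath G
      ⊎ ((∀ i j → G i ≗ᴳ G j) × (∀ i → G i ≅ K[ n , n ∸ 1 ] ⊔ᴳ K₁))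
theorem1p3 (suc a) (s≤s 1≤a) X Y balanced G bipartite ρ spectral ρ₀ spectral₀ ρ₀≤ρ =
  conclude (Path.rainbow few full)
  where
  open Bipartition X Y balanced
  m≡2n : 2 * suc a ≡ suc a + suc a
  m≡2n = cong (suc a +_) (ℕₚ.+-identityʳ (suc a))
  opp : ∀ j u v → Adj (G j) u v → side v ≡ not (side u)
  opp j = opposite {G j} (bipartite j)
  class-size : ∀ σ → degree (is σ ∘ side) ≡ ι (suc a)
  class-size σ = trans (elements-degree σ X) (cong ι (class-length (suc a) m≡2n σ))
  module At j = SingleGraph a side class-size (G j) (opp j)
  large : ∀ j δ → ℚ.0ℚ ℚ.< δ →
    Eventually λ n → ι (a * suc a) ℚ.≤ seq (ρ j) n ℚ.* seq (ρ j) n ℚ.+ δ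
  large j = ExtremalEigenvector.spectralRadius-large a 1≤a ρ₀ (ρ j) spectral₀ (ρ₀≤ρ j)
  -- `2 * suc a` reduces to a successor, so `refl` proves that there is one vertex more than there
  -- are colours.
  module Path = Rainbow.Search {2 * suc a} {2 * suc a ∸ 1} (suc a) side At.missing At.missing-sym At.missing-opp
    m≡2n refl (s≤s 1≤a) class (λ σ → elements-unique σ X) (λ σ → elements-side σ X)
    (class-length (suc a) m≡2n) (elements-partition X)
  few : ∀ j σ L → At.MissingCells j σ L → length L ≤ suc a
  few j = At.few-missing j (ρ j) (spectral j) (large j)
  full : ∀ j σ L → At.MissingCells j σ L → length L ≡ suc a →
    ∀ u v → At.missing j u v ≡ true → At.StarAt j u ⊎ At.StarAt j v
  full j = At.all-missing j (ρ j) (spectral j) (large j)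
  conclude : Path.RainbowPath few full ⊎ Path.AllStars few full →
    HasRainbowHamiltonPath G ⊎ ((∀ i j → G i ≗ᴳ G j) × (∀ i → G i ≅ K[ suc a , suc a ∸ 1 ] ⊔ᴳ K₁))
  conclude (inj₁ path) = inj₁ (Path.walk⇒rainbow few full G (λ j u v o e → At.¬missing⇒adj j u v o e) path)
  -- A star at the same x in every M i determines every edge set: all pairs of opposite vertices
  -- that avoid x. Equality of the graphs and the isomorphism both follow from this description.
  conclude (inj₂ (x , star)) = inj₂
    ( (λ i j u v → Boolₚ.⇔→≡ (mk⇔ (transfer i j u v) (transfer j i u v)))
    , (λ i → star-complement-≅ (suc a) m≡2n (G i) x (adj⇒ i) (⇒adj i)))
    where
    adj⇒ : ∀ i u v → Adj (G i) u v → side v ≡ not (side u) × u ≢ x × v ≢ x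
    adj⇒ i u v e = o
      , (λ { refl → true≢false e (At.missing⇒¬adj i u v (star i v o)) })
      , (λ { refl → true≢false (trans (symmetric (G i) v u) e) (At.missing⇒¬adj i v u (star i u (not-flip o))) })
      where
      o = opp i u v e
    ⇒adj : ∀ i u v → side v ≡ not (side u) → u ≢ x → v ≢ x → Adj (G i) u v
    ⇒adj i u v o u≢x v≢x = At.¬missing⇒adj i u v o
      -- A missing pair would have x as an end, by `star-exact`.
      (Boolₚ.¬-not λ e → Sum.[ u≢x , v≢x ] (Path.star-exact few full (star i) e))
    transfer : ∀ i j u v → Adj (G i) u v → Adj (G j) u v
    transfer i j u v e = ⇒adj j u v (proj₁ c) (proj₁ (proj₂ c)) (proj₂ (proj₂ c))
      where
      c = adj⇒ i u v e
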